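{- Let $n\geq 4$ be an even integer. Then $L_n$ is a basic strong CR tournament.
   Context: A tournament is a digraph with exactly one arc between each pair of distinct vertices. For $n\ge2$, $L_n$ is the $n$-tournament with vertices $v_1,\dots,v_n$ such that for $1\le i<j\le n-1$, $v_i\to v_j$, and for $1\le i\le n-1$, $v_n\to v_i$ if $i$ is odd and $v_i\to v_n$ if $i$ is even. For distinct vertices write $\theta_T(u,v)=1$ if $u\to v$, $-1$ otherwise. Skew-adjacency matrix $S_T$: entry $1$ if $v_i\to v_j$, $-1$ if $v_j\to v_i$, $0$ on the diagonal; $\det(T)=\det(S_T)$. For odd $k\ge1$, $\mathcal{D}_k$ is the set of tournaments all of whose induced subtournaments have determinant at most $k^2$; $\mathcal{D}_{ -1}=\emptyset$. Transitive blowup: for $T$ on $v_1,\dots,v_n$ and positive integers $a_i$, replace each $v_i$ by a transitive tournament on $a_i$ vertices, with all arcs from the $i$-th block to the $j$-th block whenever $v_i\to v_j$; a 1-transitive blowup has one $a_i=2$ and the others $1$. A diamond is a 4-tournament consisting of a 3-cycle plus a vertex dominating all of it or dominated by all of it. Two vertices $u_1,u_2$ of $T$ are covertices and revertices if $|V(T)|=2$; if $|V(T)|\ge3$ they are covertices if $\theta_T(u_1,v)=\theta_T(u_2,v)$ for all other $v$, revertices if $\theta_T(u_1,v)=-\theta_T(u_2,v)$ for all other $v$; CR-associated if covertices or revertices. For $u\notin V(T)=\{w_1,\dots,w_n\}$ and $\sigma=(r_1,\dots,r_n)\in\{\pm1\}^n$, $T(u,\sigma)$ extends $T$ by $u$ with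 $u\to w_i$ iff $r_i=1$; $u$ is a CR vertex for $T$ with $\sigma$ if $u$ is CR-associated in $T(u,\sigma)$ with some vertex of $T$, otherwise a non-CR vertex. Let $T\in\mathcal{D}_k\setminus\mathcal{D}_{k-2}$, $k$ odd. $T$ is a CR tournament if $T$ is a 1-tournament, a 2-tournament or a diamond, or else for every $u\notin V(T)$ and every $\sigma$ with $u$ a non-CR vertex for $T$ with $\sigma$, $T(u,\sigma)\notin\mathcal{D}_k$. A strong CR tournament is a CR tournament all of whose 1-transitive blowups are CR tournaments. A tournament of order at least 4 is basic if no two of its vertices are CR-associated. -}

module Defs where

open import Data.Bool using (Bool; true; false; not; if_then_else_; _∧_)
open import Data.Nat as ℕ using (ℕ; zero; suc; _<ᵇ_; _≡ᵇ_; _∸_)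
open import Data.Fin using (Fin; zero; suc; toℕ; punchIn)
open import Data.Fin.Properties using (_≟_)
open import Data.Integer as ℤ using (ℤ; +_; -_)
open import Data.Product using (Σ; ∃; _×_; _,_)
open import Data.Sum using (_⊎_)
open import Relation.Nullary using (¬_; yes; no)
open import Relation.Binary.PropositionalEquality using (_≡_; _≢_)
open import Function.Definitions using (Injective)

-- A digraph on vertex set Fin n, given by its arc relation:
-- T i j ≡ true means i → j.  (The diagonal value is irrelevant.)
Digraph : ℕ → Set
Digraph n = Fin n → Fin n → Bool

IsTournament : ∀ {n} → Digraph n → Set
IsTournament {n} T = ∀ (i j : Fin n) → i ≢ j → T j i ≡ not (T i j)

isEven : ℕ → Bool
isEven zero = true
isEven (suc n) = not (isEven n)

-- L_n : vertex v_{t+1} is Fin index t.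
--  v_i → v_j for i < j ≤ n-1;  v_n → v_i iff i odd (1-indexed), i.e. index i-1 even.
L : (n : ℕ) → Digraph n
L n a b =
  let x = toℕ a ; y = toℕ b ; l = n ∸ 1 in
  if x ≡ᵇ l then (if y ≡ᵇ l then false else isEven y)
  else (if y ≡ᵇ l then not (isEven x) else x <ᵇ y)

skew : ∀ {n} → Digraph n → Fin n → Fin n → ℤ
skew T i j with i ≟ j
... | yes _ = + 0
... | no _ = if T i j then + 1 else - (+ 1)

sumFin : ∀ {n} → (Fin n → ℤ) → ℤ
sumFin {zero} f = + 0
sumFin {suc n} f = f zero ℤ.+ sumFin (λ i → f (suc i))

det : ∀ {n} → (Fin n → Fin n → ℤ) → ℤ
det {zero} M = + 1
det {suc n} M =
  sumFin (λ j → (if isEven (toℕ j) then + 1 else - (+ 1)) ℤ.* (M zero j ℤ.*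
                 det (λ a b → M (suc a) (punchIn j b))))

detT : ∀ {n} → Digraph n → ℤ
detT T = det (skew T)

induced : ∀ {m n} → Digraph n → (Fin m → Fin n) → Digraph m
induced T f a b = T (f a) (f b)

-- Membership in D_k for k = 2j+1 (odd, k ≥ 1): all induced
-- subtournaments have determinant at most k².
InD : ℕ → ∀ {n} → Digraph n → Set
InD j {n} T = ∀ (m : ℕ) (f : Fin m → Fin n) → Injective _≡_ _≡_ f →
  detT (induced T f) ℤ.≤ + ((2 ℕ.* j ℕ.+ 1) ℕ.* (2 ℕ.* j ℕ.+ 1))

-- T ∈ D_k \ D_{k-2} with k = 2j+1 (D_{-1} = ∅, so for j = 0 nothing to exclude).
InLevel : ℕ → ∀ {n} → Digraph n → Set
InLevel j T = InD j T × (∀ j' → j ≡ suc j' → ¬ InD j' T)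

-- Covertices / revertices / CR-associated (for distinct u1 u2).
-- For order 2 the quantification over other vertices is vacuous,
-- so both hold, matching the paper's convention.
Covertices : ∀ {n} → Digraph n → Fin n → Fin n → Set
Covertices {n} T u1 u2 = ∀ (v : Fin n) → v ≢ u1 → v ≢ u2 → T u1 v ≡ T u2 v

Revertices : ∀ {n} → Digraph n → Fin n → Fin n → Set
Revertices {n} T u1 u2 = ∀ (v : Fin n) → v ≢ u1 → v ≢ u2 → T u1 v ≡ not (T u2 v)

CRAssoc : ∀ {n} → Digraph n → Fin n → Fin n → Set
CRAssoc T u1 u2 = Covertices T u1 u2 ⊎ Revertices T u1 u2

extend : ∀ {n} → Digraph n → (Fin n → Bool) → Digraph (suc n)
extend T σ zero zero = false
extend T σ zero (suc i) = σ i
extend T σ (suc i) zero = not (σ i)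
extend T σ (suc i) (suc j) = T i j

NonCRVertex : ∀ {n} → Digraph n → (Fin n → Bool) → Set
NonCRVertex {n} T σ = ¬ (Σ (Fin n) λ w → CRAssoc (extend T σ) zero (suc w))

IsDiamond : ∀ {n} → Digraph n → Set
IsDiamond {n} T = (n ≡ 4) × Σ (Fin n) λ v → Σ (Fin n) λ a → Σ (Fin n) λ b → Σ (Fin n) λ c →
  (v ≢ a × v ≢ b × v ≢ c × a ≢ b × b ≢ c × a ≢ c) ×
  (T a b ≡ true × T b c ≡ true × T c a ≡ true) ×
  ((T v a ≡ true × T v b ≡ true × T v c ≡ true) ⊎
   (T a v ≡ true × T b v ≡ true × T c v ≡ true))

IsCR : ∀ {n} → Digraph n → Set
IsCR {n} T = Σ ℕ λ j → InLevel j T ×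
  ((n ≡ 1) ⊎ (n ≡ 2) ⊎ IsDiamond T ⊎
   (∀ (σ : Fin n → Bool) → NonCRVertex T σ → ¬ InD j (extend T σ)))

-- 1-transitive blowup at vertex i: new vertex zero is a copy of i
-- (the 2-vertex transitive block is zero → suc i).
blowup : ∀ {n} → Digraph n → Fin n → Digraph (suc n)
blowup T i zero zero = false
blowup T i zero (suc w) with w ≟ i
... | yes _ = true
... | no _ = T i w
blowup T i (suc w) zero with w ≟ i
... | yes _ = false
... | no _ = T w i
blowup T i (suc a) (suc b) = T a b

IsStrongCR : ∀ {n} → Digraph n → Set
IsStrongCR {n} T = IsCR T × (∀ (i : Fin n) → IsCR (blowup T i))

IsBasic : ∀ {n} → Digraph n → Set
IsBasic {n} T = (4 ℕ.≤ n) × (∀ (a b : Fin n) → a ≢ b → ¬ CRAssoc T a b)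

{-# OPTIONS --safe #-}
module Submission where

open import Defs
open import Data.Nat using (ℕ; _≤_)
open import Data.Nat.Divisibility using (_∣_)
open import Data.Product using (_×_)

open import Data.Bool using (Bool; true; false; not; if_then_else_; _xor_)
open import Data.Bool.Properties using (not-involutive)
open import Data.Empty using (⊥; ⊥-elim)
open import Data.Fin using (Fin; zero; suc; toℕ; punchIn; punchOut; fromℕ; fromℕ<; inject₁)
open import Data.Fin.Properties as FP using (_≟_)
open import Data.Integer as ℤ using (ℤ; +_; -_; _+_; _*_; _-_)
import Data.Integer.Properties as ℤP
open import Data.Integer.Tactic.RingSolver using (solve-∀)
open import Data.List using (List; []; _∷_; _++_; length; map; initLast; _∷ʳ′_)
open import Data.List.Properties using (++-assoc; ++-identityʳ)
open import Data.Nat as ℕ using (zero; suc; _∸_; _<ᵇ_; _≡ᵇ_)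
open import Data.Nat.Divisibility using (divides; ∣m+n∣m⇒∣n; ∣1⇒≡1)
import Data.Nat.Properties as ℕP
import Data.Nat.Tactic.RingSolver as ℕR
open import Data.Product using (Σ; ∃; _,_; proj₁; proj₂)
open import Data.Sum using (_⊎_; inj₁; inj₂)
open import Function.Base using (_∘_; id)
open import Function.Definitions using (Injective)
open import Relation.Binary.Definitions using (tri<; tri≈; tri>)
open import Relation.Binary.PropositionalEquality
open import Relation.Nullary using (¬_; yes; no)
open import Relation.Nullary.Negation using (contradiction)
open ≡-Reasoning

-- Write m = n - 1, so that v_1, …, v_m is transitive. Eliminating pairs of transitive vertices by
-- Schur complements shows that, for an even set of them together with v_n and one more vertex u,
-- the determinant is the square of θ(u,v_n) plus twice the signed area swept out by the path whose steps
-- are the vectors (θ(v_j,v_n), θ(u,v_j)) with alternating signs. For subtournaments of L_n this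
-- Pfaffian is an alternating sum of signs, whence det ≤ m² with equality for L_n.
--
-- For an extension of L_n by u, the path is coded by a cyclic word in the steps A = (1,1) and
-- B = (1,-1): deleting a vertex reverses all later steps, and the area is invariant under rotation
-- of the word. If all Pfaffians are at most m in absolute value, comparing those for deletions of
-- nearby vertices shows, when A is more frequent than B, that BB does not occur, that AAA does not
-- occur together with B, and that ABAABA does not occur if there are at least 3 more A than B.
-- Hence the word is constant (u is associated with v_n) or has a single cyclic repetition
-- (u is associated with one of two consecutive transitive vertices).
--
-- For a blowup of v_i, let v be the twin of v_i. If u sees v and v_i differently, pivoting on the
-- twins gives the Pfaffian P(u) ± 2 P(v_i) for the whole tournament, where P is linear in the
-- bordering row and |P(v_i)| = m. This exceeds m unless |P(u)| = m, which excludes that u is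
-- associated with a vertex other than v_i, v.

-- All inequalities come from one comparison. Two selections that agree after the first few letters
-- share `θ` and the area of the common tail; the rest of the difference of their Pfaffians is
-- linear in the numbers α of A and β of B, and it is at most 2m = 2(α + β). For α > β this makes BB
-- impossible, as it gives 4α ≤ 2(α + β). ABA gives α ≤ 3β, AAA gives 3β ≤ α, and ABAABA gives 3(α -
-- β) ≤ 8. The evenness of n enters as the oddness of α + β and settles the boundary cases: α = β is
-- impossible, so is α = 3β (then α + β = 4β), and α ≥ β + 2 already means α ≥ β + 3. A repeated
-- letter marks a change in the row of u between consecutive transitive vertices. With at most one
-- repetition u fits, up to reversal, into a gap of the transitive order, and its arc to v_n selects
-- the neighbour with which it is associated. The blowups need a sharper bound for small
-- subtournaments: order k ≥ 2 has determinant at most (k - 1)². If u is associated with a vertex w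
-- other than the twins, then removing u and w from T - v_i + u leaves order n - 2, whence |P(u)| <
-- m.

Mat : ℕ → Set
Mat n = Fin n → Fin n → ℤ

sg : Bool → ℤ
sg b = if b then + 1 else - (+ 1)

sg-not : ∀ b → sg (not b) ≡ - sg b
sg-not true = refl
sg-not false = refl

-- Finite sums, cofactor expansion and transposition.

sum-cong : ∀ {n} {f g : Fin n → ℤ} → (∀ i → f i ≡ g i) → sumFin f ≡ sumFin g
sum-cong {zero} e = refl
sum-cong {suc n} e = cong₂ _+_ (e zero) (sum-cong (e ∘ suc))

sum-0 : ∀ {n} (f : Fin n → ℤ) → (∀ i → f i ≡ + 0) → sumFin f ≡ + 0
sum-0 {zero} f e = refl
sum-0 {suc n} f e = cong₂ _+_ (e zero) (sum-0 (f ∘ suc) (e ∘ suc))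

sum-+ : ∀ {n} (f g : Fin n → ℤ) → sumFin (λ i → f i + g i) ≡ sumFin f + sumFin g
sum-+ {zero} f g = refl
sum-+ {suc n} f g = trans (cong (_+_ (f zero + g zero)) (sum-+ (f ∘ suc) (g ∘ suc)))
  (lem (f zero) (g zero) (sumFin (f ∘ suc)) (sumFin (g ∘ suc)))
  where
  lem : ∀ a b c d → (a + b) + (c + d) ≡ (a + c) + (b + d)
  lem = solve-∀

sum-* : ∀ {n} c (f : Fin n → ℤ) → sumFin (λ i → c * f i) ≡ c * sumFin f
sum-* {zero} c f = sym (ℤP.*-zeroʳ c)
sum-* {suc n} c f = trans (cong (_+_ (c * f zero)) (sum-* c (f ∘ suc))) (sym (ℤP.*-distribˡ-+ c _ _))

sum-swap : ∀ {n k} (f : Fin n → Fin k → ℤ) →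
  sumFin (λ i → sumFin (f i)) ≡ sumFin (λ j → sumFin (λ i → f i j))
sum-swap {zero} {k} f = sym (sum-0 {k} (λ _ → + 0) (λ _ → refl))
sum-swap {suc n} f = trans (cong (_+_ (sumFin (f zero))) (sum-swap (f ∘ suc)))
  (sym (sum-+ (f zero) _))

minor : ∀ {n} → Mat (suc n) → Fin (suc n) → Fin (suc n) → Mat n
minor M i j a b = M (punchIn i a) (punchIn j b)

sgᶠ : ∀ {n} → Fin n → ℤ
sgᶠ j = sg (isEven (toℕ j))

det-cong : ∀ {n} {M N : Mat n} → (∀ a b → M a b ≡ N a b) → det M ≡ det N
det-cong {zero} e = refl
det-cong {suc n} e = sum-cong λ j → cong₂ (λ x y → sgᶠ j * (x * y)) (e zero j)
  (det-cong λ a b → e (suc a) (punchIn j b))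

transpose : ∀ {n} → Mat n → Mat n
transpose M a b = M b a

private
  -- Outside the corner term, row expansion followed by column expansion of the minors and column
  -- expansion followed by row expansion give the same double sum over `D i j`. The minors are one
  -- and two sizes smaller, hence the two induction hypotheses.
  transpose-step : ∀ {n} → (∀ (M : Mat (suc n)) → det (transpose M) ≡ det M) →
    (∀ (M : Mat n) → det (transpose M) ≡ det M) →
    ∀ (M : Mat (suc (suc n))) → det (transpose M) ≡ det M
  transpose-step {n} ih₁ ih₂ M = cong₂ _+_
    (cong (λ d → + 1 * (M zero zero * d)) (ih₁ (minor M zero zero)))
    (begin
      sumFin (λ i → sgᶠ (suc i) * (M (suc i) zero * det (λ a b → M (punchIn (suc i) b) (suc a))))
        ≡⟨ sum-cong (λ i → trans (cong (λ d → sgᶠ (suc i) * (M (suc i) zero * d))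
              (ih₁ (minor M (suc i) zero)))
              (expandRow i)) ⟩
      sumFin (λ i → sumFin (term i))
        ≡⟨ sum-swap term ⟩
      sumFin (λ j → sumFin (λ i → term i j))
        ≡⟨ sum-cong (λ j → sym (expandCol j)) ⟩
      sumFin (λ j → sgᶠ (suc j) * (M zero (suc j) * det (minor M zero (suc j)))) ∎)
    where
    D : Fin (suc n) → Fin (suc n) → ℤ
    D i j = det (λ a b → M (suc (punchIn i a)) (suc (punchIn j b)))

    term : Fin (suc n) → Fin (suc n) → ℤ
    term i j = - (sgᶠ i * (M (suc i) zero * (sgᶠ j * (M zero (suc j) * D i j))))

    lem₁ : ∀ s x t y d → - s * (x * (t * (y * d))) ≡ - (s * (x * (t * (y * d))))
    lem₁ = solve-∀
    lem₂ : ∀ s x t y d → - t * (y * (s * (x * d))) ≡ - (s * (x * (t * (y * d))))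
    lem₂ = solve-∀
    neg-sum : ∀ {k} (f : Fin k → ℤ) s x → - s * (x * sumFin f) ≡ sumFin (λ j → - s * (x * f j))
    neg-sum f s x = trans (cong (_*_ (- s)) (sym (sum-* x f))) (sym (sum-* (- s) (λ j → x * f j)))

    expandRow : ∀ i → sgᶠ (suc i) * (M (suc i) zero * det (minor M (suc i) zero)) ≡ sumFin (term i)
    expandRow i = begin
      sgᶠ (suc i) * (M (suc i) zero * det (minor M (suc i) zero))
        ≡⟨ cong (λ s → s * (M (suc i) zero * det (minor M (suc i) zero))) (sg-not (isEven (toℕ i))) ⟩
      - sgᶠ i * (M (suc i) zero * det (minor M (suc i) zero))
        ≡⟨ neg-sum (λ j → sgᶠ j * (M zero (suc j) * D i j)) (sgᶠ i) (M (suc i) zero) ⟩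
      sumFin (λ j → - sgᶠ i * (M (suc i) zero * (sgᶠ j * (M zero (suc j) * D i j))))
        ≡⟨ sum-cong (λ j → lem₁ (sgᶠ i) (M (suc i) zero) (sgᶠ j) (M zero (suc j)) (D i j)) ⟩
      sumFin (term i) ∎

    expandCol : ∀ j → sgᶠ (suc j) * (M zero (suc j) * det (minor M zero (suc j))) ≡ sumFin (λ i → term i j)
    expandCol j = begin
      sgᶠ (suc j) * (M zero (suc j) * det (minor M zero (suc j)))
        ≡⟨ cong₂ (λ s d → s * (M zero (suc j) * d)) (sg-not (isEven (toℕ j)))
            (trans (sym (ih₁ (minor M zero (suc j))))
              (sum-cong λ i → cong (λ d → sgᶠ i * (M (suc i) zero * d))
                (ih₂ (λ a b → M (suc (punchIn i a)) (suc (punchIn j b)))))) ⟩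
      - sgᶠ j * (M zero (suc j) * sumFin (λ i → sgᶠ i * (M (suc i) zero * D i j)))
        ≡⟨ neg-sum (λ i → sgᶠ i * (M (suc i) zero * D i j)) (sgᶠ j) (M zero (suc j)) ⟩
      sumFin (λ i → - sgᶠ j * (M zero (suc j) * (sgᶠ i * (M (suc i) zero * D i j))))
        ≡⟨ sum-cong (λ i → lem₂ (sgᶠ i) (M (suc i) zero) (sgᶠ j) (M zero (suc j)) (D i j)) ⟩
      sumFin (λ i → term i j) ∎

det-transpose : ∀ {n} (M : Mat n) → det (transpose M) ≡ det M
det-transpose {zero} M = refl
det-transpose {suc zero} M = refl
det-transpose {suc (suc n)} M = transpose-step (det-transpose {suc n}) (det-transpose {n}) M

det-column₀ : ∀ {n} (M : Mat (suc n)) →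
  det M ≡ sumFin (λ i → sgᶠ i * (M i zero * det (minor M i zero)))
det-column₀ M = trans (sym (det-transpose M))
  (sum-cong λ i → cong (λ d → sgᶠ i * (M i zero * d)) (det-transpose (minor M i zero)))

-- Column permutations

-- Replaces the sign of a permutation: permuting the columns multiplies every determinant by one
-- fixed unit `ε`, which cancels as soon as the rows are permuted too.
record Signed {n} (π : Fin n → Fin n) : Set where
  field
    ε : ℤ
    ε² : ε * ε ≡ + 1
    scales : ∀ M → det (λ a b → M a (π b)) ≡ ε * det M
open Signed

det-permute : ∀ {n} {π : Fin n → Fin n} → Signed π → ∀ M → det (λ a b → M (π a) (π b)) ≡ det M
det-permute {π = π} p M = begin
  det (λ a b → M (π a) (π b))  ≡⟨ scales p (λ a b → M (π a) b) ⟩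
  ε p * det (λ a b → M (π a) b)  ≡⟨ cong (_*_ (ε p)) (sym (det-transpose (λ a b → M (π a) b))) ⟩
  ε p * det (λ a b → M (π b) a)  ≡⟨ cong (_*_ (ε p)) (scales p (λ a b → M b a)) ⟩
  ε p * (ε p * det (transpose M))  ≡⟨ sym (ℤP.*-assoc (ε p) (ε p) _) ⟩
  ε p * ε p * det (transpose M)  ≡⟨ cong₂ _*_ (ε² p) (det-transpose M) ⟩
  + 1 * det M  ≡⟨ ℤP.*-identityˡ _ ⟩
  det M ∎

signed-id : ∀ {n} → Signed {n} id
signed-id .ε = + 1
signed-id .ε² = refl
signed-id .scales M = sym (ℤP.*-identityˡ _)

signed-∘ : ∀ {n} {π ρ : Fin n → Fin n} → Signed π → Signed ρ → Signed (π ∘ ρ)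
signed-∘ p q .ε = ε q * ε p
signed-∘ p q .ε² = trans (lem (ε q) (ε p)) (cong₂ _*_ (ε² q) (ε² p))
  where
  lem : ∀ a b → a * b * (a * b) ≡ a * a * (b * b)
  lem = solve-∀
signed-∘ {π = π} p q .scales M = trans (scales q (λ a b → M a (π b)))
  (trans (cong (_*_ (ε q)) (scales p M)) (sym (ℤP.*-assoc (ε q) (ε p) _)))

signed-ext : ∀ {n} {π ρ : Fin n → Fin n} → (∀ a → π a ≡ ρ a) → Signed π → Signed ρ
signed-ext e p .ε = ε p
signed-ext e p .ε² = ε² p
signed-ext e p .scales M = trans (det-cong λ a b → cong (M a) (sym (e b))) (scales p M)

lift : ∀ {n} → (Fin n → Fin n) → Fin (suc n) → Fin (suc n)
lift π zero = zero
lift π (suc a) = suc (π a)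

-- The first column stays in place, so expansion along it passes the scaling to the minors.
signed-lift : ∀ {n} {π : Fin n → Fin n} → Signed π → Signed (lift π)
signed-lift p .ε = ε p
signed-lift p .ε² = ε² p
signed-lift {π = π} p .scales M = begin
  det (λ a b → M a (lift π b))
    ≡⟨ det-column₀ (λ a b → M a (lift π b)) ⟩
  sumFin (λ i → sgᶠ i * (M i zero * det (λ a b → minor M i zero a (π b))))
    ≡⟨ sum-cong (λ i → trans (cong (λ d → sgᶠ i * (M i zero * d)) (scales p (minor M i zero)))
         (lem (sgᶠ i) (M i zero) (ε p) _)) ⟩
  sumFin (λ i → ε p * (sgᶠ i * (M i zero * det (minor M i zero))))
    ≡⟨ sum-* (ε p) (λ i → sgᶠ i * (M i zero * det (minor M i zero))) ⟩
  ε p * sumFin (λ i → sgᶠ i * (M i zero * det (minor M i zero)))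
    ≡⟨ cong (_*_ (ε p)) (sym (det-column₀ M)) ⟩
  ε p * det M ∎
  where
  lem : ∀ s x e d → s * (x * (e * d)) ≡ e * (s * (x * d))
  lem = solve-∀

swap₀₁ : ∀ {n} → Fin (suc (suc n)) → Fin (suc (suc n))
swap₀₁ zero = suc zero
swap₀₁ (suc zero) = zero
swap₀₁ (suc (suc b)) = suc (suc b)

-- The two leading terms of the row expansion trade places with opposite signs. In every other minor
-- the two columns are still in front, whence the recursion.
det-swap₀₁ : ∀ {n} (M : Mat (suc (suc n))) → det (λ a b → M a (swap₀₁ b)) ≡ - det M
det-swap₀₁ {n} M = begin
  + 1 * (M zero (suc zero) * d₁) + (- + 1 * (M zero zero * d₀) + sumFin rest)
    ≡⟨ cong₂ (λ p q → + 1 * (M zero (suc zero) * p) + (- + 1 * (M zero zero * q) + sumFin rest))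
         (det-cong e₁) (det-cong e₀) ⟩
  + 1 * (M zero (suc zero) * d₁′) + (- + 1 * (M zero zero * d₀′) + sumFin rest)
    ≡⟨ cong (λ r → + 1 * (M zero (suc zero) * d₁′) + (- + 1 * (M zero zero * d₀′) + r))
         (trans (sum-cong rest-neg) (trans (sum-* (- + 1) rest′) (ℤP.-1*i≡-i _))) ⟩
  + 1 * (M zero (suc zero) * d₁′) + (- + 1 * (M zero zero * d₀′) + - sumFin rest′)
    ≡⟨ lem (M zero (suc zero) * d₁′) (M zero zero * d₀′) (sumFin rest′) ⟩
  - det M ∎
  where
  d₁ = det (λ a b → M (suc a) (swap₀₁ (suc b)))
  d₀ = det (λ a b → M (suc a) (swap₀₁ (punchIn (suc zero) b)))
  d₁′ = det (minor M zero (suc zero))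
  d₀′ = det (minor M zero zero)
  rest rest′ : Fin n → ℤ
  rest j = sgᶠ (suc (suc j)) * (M zero (suc (suc j)) * det (λ a b → M (suc a) (swap₀₁ (punchIn (suc (suc j)) b))))
  rest′ j = sgᶠ (suc (suc j)) * (M zero (suc (suc j)) * det (minor M zero (suc (suc j))))
  e₁ : ∀ a b → M (suc a) (swap₀₁ (suc b)) ≡ M (suc a) (punchIn (suc zero) b)
  e₁ a zero = refl
  e₁ a (suc b) = refl
  e₀ : ∀ a b → M (suc a) (swap₀₁ (punchIn (suc zero) b)) ≡ M (suc a) (suc b)
  e₀ a zero = refl
  e₀ a (suc b) = refl
  swap-punchIn : ∀ {k} (j : Fin (suc k)) b →
    swap₀₁ (punchIn (suc (suc j)) b) ≡ punchIn (suc (suc j)) (swap₀₁ b)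
  swap-punchIn j zero = refl
  swap-punchIn j (suc zero) = refl
  swap-punchIn j (suc (suc b)) = refl
  minor-swap : ∀ {n} (M : Mat (suc (suc n))) (j : Fin n) →
    det (λ a b → M (suc a) (swap₀₁ (punchIn (suc (suc j)) b))) ≡ - det (minor M zero (suc (suc j)))
  minor-swap {suc n} M j = trans (det-cong λ a b → cong (M (suc a)) (swap-punchIn j b))
    (det-swap₀₁ (minor M zero (suc (suc j))))
  rest-neg : ∀ j → rest j ≡ - + 1 * rest′ j
  rest-neg j = trans (cong (λ d → sgᶠ (suc (suc j)) * (M zero (suc (suc j)) * d)) (minor-swap M j))
    (lem₂ (sgᶠ (suc (suc j))) (M zero (suc (suc j))) _)
    where
    lem₂ : ∀ s x d → s * (x * - d) ≡ - + 1 * (s * (x * d))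
    lem₂ = solve-∀
  lem : ∀ x y r → + 1 * x + (- + 1 * y + - r) ≡ - (+ 1 * y + (- + 1 * x + r))
  lem = solve-∀

signed-swap₀₁ : ∀ {n} → Signed (swap₀₁ {n})
signed-swap₀₁ .ε = - + 1
signed-swap₀₁ .ε² = refl
signed-swap₀₁ .scales M = trans (det-swap₀₁ M) (sym (ℤP.-1*i≡-i _))

toFront : ∀ {n} → Fin (suc n) → Fin (suc n) → Fin (suc n)
toFront p zero = p
toFront p (suc b) = punchIn p b

signed-toFront : ∀ {n} (p : Fin (suc n)) → Signed (toFront p)
signed-toFront {n} zero = signed-ext e signed-id
  where
  e : ∀ (a : Fin (suc n)) → id a ≡ toFront zero a
  e zero = refl
  e (suc a) = refl
signed-toFront {suc n} (suc p) = signed-ext e (signed-∘ (signed-lift (signed-toFront p)) signed-swap₀₁)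
  where
  e : ∀ a → lift (toFront p) (swap₀₁ a) ≡ toFront (suc p) a
  e zero = refl
  e (suc zero) = refl
  e (suc (suc a)) = refl

-- Column operations and the Schur complement

i≡-i⇒i≡0 : ∀ i → i ≡ - i → i ≡ + 0
i≡-i⇒i≡0 (+ zero) e = refl
i≡-i⇒i≡0 (+ suc n) ()
i≡-i⇒i≡0 (ℤ.-[1+ n ]) ()

-- Column 0 enters linearly, and the added part is the determinant of `K`, which has two equal
-- columns.
det-add₀ : ∀ {n} (M N : Mat (suc (suc n))) x →
  (∀ a b → N a (suc b) ≡ M a (suc b)) → (∀ a → N a zero ≡ M a zero + x * M a (suc zero)) →
  det N ≡ det M
det-add₀ {n} M N x same op = begin
  det N
    ≡⟨ det-column₀ N ⟩
  sumFin (λ i → sgᶠ i * (N i zero * det (minor N i zero)))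
    ≡⟨ sum-cong (λ i → trans (cong₂ (λ p d → sgᶠ i * (p * d)) (op i)
          (det-cong λ a b → same (punchIn i a) b)) (lem (sgᶠ i) (M i zero) x (M i (suc zero)) _)) ⟩
  sumFin (λ i → sgᶠ i * (M i zero * det (minor M i zero)) + x * (sgᶠ i * (K i zero * det (minor K i zero))))
    ≡⟨ trans (sum-+ (column M) (λ i → x * column K i)) (cong₂ _+_ (sym (det-column₀ M))
         (trans (sum-* x (column K)) (cong (_*_ x) (sym (det-column₀ K))))) ⟩
  det M + x * det K
    ≡⟨ cong (λ d → det M + x * d) K≡0 ⟩
  det M + x * + 0
    ≡⟨ lem₂ (det M) x ⟩
  det M ∎
  where
  K : Mat (suc (suc n))
  K a zero = M a (suc zero)
  K a (suc b) = M a (suc b)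
  column : Mat (suc (suc n)) → Fin (suc (suc n)) → ℤ
  column M i = sgᶠ i * (M i zero * det (minor M i zero))
  K-swap : ∀ a b → K a b ≡ K a (swap₀₁ b)
  K-swap a zero = refl
  K-swap a (suc zero) = refl
  K-swap a (suc (suc b)) = refl
  K≡0 : det K ≡ + 0
  K≡0 = i≡-i⇒i≡0 (det K) (trans (det-cong K-swap) (det-swap₀₁ K))
  lem : ∀ s p x q d → s * ((p + x * q) * d) ≡ s * (p * d) + x * (s * (q * d))
  lem = solve-∀
  lem₂ : ∀ d x → d + x * + 0 ≡ d
  lem₂ = solve-∀

*-cancel-unit : ∀ e x y → e * e ≡ + 1 → e * x ≡ e * y → x ≡ y
*-cancel-unit e x y e² eq = trans (lem x) (trans (cong (_*_ e) eq) (sym (lem y)))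
  where
  lem : ∀ z → z ≡ e * (e * z)
  lem z = sym (trans (sym (ℤP.*-assoc e e z)) (trans (cong (_* z) e²) (ℤP.*-identityˡ z)))

det-addColumn : ∀ {n} (M N : Mat n) (q p : Fin n) → q ≢ p → ∀ x →
  (∀ a b → b ≢ q → N a b ≡ M a b) → (∀ a → N a q ≡ M a q + x * M a p) → det N ≡ det M
det-addColumn {suc zero} M N zero zero q≢p x same op = contradiction refl q≢p
det-addColumn {suc (suc n)} M N q p q≢p x same op =
  *-cancel-unit (ε S) (det N) (det M) (ε² S) (trans (sym (scales S N)) (trans
    (det-add₀ (λ a b → M a (π b)) (λ a b → N a (π b)) x
      (λ a b → same a (π (suc b)) (FP.punchInᵢ≢i q _))
      (λ a → trans (op a) (cong (λ r → M a q + x * M a r) (sym (FP.punchIn-punchOut q≢p)))))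
    (scales S M)))
  where
  π : Fin (suc (suc n)) → Fin (suc (suc n))
  π b = toFront q (lift (toFront (punchOut q≢p)) b)
  S : Signed π
  S = signed-∘ (signed-toFront q) (signed-lift (signed-toFront (punchOut q≢p)))

-- Since `x p ≡ + 0` the pivot column never changes, so the additions can be made one column at a
-- time; in `N k` they are done for the columns below `k`.
det-addColumns : ∀ {n} (M : Mat n) (p : Fin n) (x : Fin n → ℤ) → x p ≡ + 0 →
  det (λ a b → M a b + x b * M a p) ≡ det M
det-addColumns {n} M p x xp = trans (det-cong λ a b → sym (full a b)) (go n)
  where
  N : ℕ → Mat n
  N k a b with toℕ b ℕ.<? k
  ... | yes _ = M a b + x b * M a p
  ... | no _ = M a b
  full : ∀ a b → N n a b ≡ M a b + x b * M a p
  full a b with toℕ b ℕ.<? n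
  ... | yes _ = refl
  ... | no b≮n = contradiction (FP.toℕ<n b) b≮n
  zero-mul : ∀ y c → y ≡ + 0 → ∀ d → c + y * d ≡ c
  zero-mul y c refl d = trans (cong (_+_ c) (ℤP.*-zeroˡ d)) (ℤP.+-identityʳ c)
  N-p : ∀ k a → N k a p ≡ M a p
  N-p k a with toℕ p ℕ.<? k
  ... | yes _ = zero-mul (x p) (M a p) xp (M a p)
  ... | no _ = refl
  N-≢ : ∀ k a b → toℕ b ≢ k → N (suc k) a b ≡ N k a b
  N-≢ k a b b≢k with toℕ b ℕ.<? suc k | toℕ b ℕ.<? k
  ... | yes _ | yes _ = refl
  ... | no _ | no _ = refl
  ... | yes (ℕ.s≤s b≤k) | no b≮k = contradiction (ℕP.≤∧≢⇒< b≤k b≢k) b≮k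
  ... | no b≮ | yes b< = contradiction (ℕP.m<n⇒m<1+n b<) b≮
  N-≡ : ∀ k a b → toℕ b ≡ k → N (suc k) a b ≡ N k a b + x b * M a p
  N-≡ k a b refl with toℕ b ℕ.<? suc (toℕ b) | toℕ b ℕ.<? toℕ b
  ... | _ | yes b<b = contradiction b<b (ℕP.<-irrefl refl)
  ... | no b≮ | no _ = contradiction (ℕP.n<1+n _) b≮
  ... | yes _ | no _ = refl
  go : ∀ k → det (N k) ≡ det M
  go zero = det-cong {M = N zero} {N = M} λ a b → refl
  go (suc k) with k ℕ.<? n
  ... | no k≮n = trans (det-cong λ a b → N-≢ k a b
                   (λ e → k≮n (subst (ℕ._< n) e (FP.toℕ<n b)))) (go k)
  ... | yes k<n with fromℕ< k<n ≟ p
  ...   | yes refl = trans (det-cong same) (go k)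
    where
    same : ∀ a b → N (suc k) a b ≡ N k a b
    same a b with b ≟ fromℕ< k<n
    ... | yes refl = trans (N-p (suc k) a) (sym (N-p k a))
    ... | no b≢ = N-≢ k a b λ e → b≢ (FP.toℕ-injective (trans e (sym (FP.toℕ-fromℕ< k<n))))
  ...   | no q≢p = trans (det-addColumn (N k) (N (suc k)) (fromℕ< k<n) p q≢p (x (fromℕ< k<n))
      (λ a b b≢ → N-≢ k a b λ e → b≢ (FP.toℕ-injective (trans e (sym (FP.toℕ-fromℕ< k<n)))))
      (λ a → trans (N-≡ k a (fromℕ< k<n) (FP.toℕ-fromℕ< k<n))
        (cong (λ r → N k a (fromℕ< k<n) + x (fromℕ< k<n) * r) (sym (N-p k a))))) (go k)

-- Adding multiples of column 0 (by `x`) clears row 1, and then multiples of column 1 (by `y`) clear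
-- row 0, outside the leading 2 by 2 block. That block has determinant 1, so the lower right block
-- remains.
det-schur : ∀ {n} (N : Mat (suc (suc n))) →
  N zero zero ≡ + 0 → N zero (suc zero) ≡ + 1 → N (suc zero) zero ≡ - + 1 → N (suc zero) (suc zero) ≡ + 0 →
  det N ≡ det (λ a b → N (suc (suc a)) (suc (suc b))
                       + N (suc (suc a)) zero * N (suc zero) (suc (suc b))
                       - N (suc (suc a)) (suc zero) * N zero (suc (suc b)))
det-schur {n} N e₀₀ e₀₁ e₁₀ e₁₁ = begin
  det N ≡⟨ sym (det-addColumns N zero x refl) ⟩
  det M₁ ≡⟨ sym (det-addColumns M₁ (suc zero) y refl) ⟩
  det M₂ ≡⟨ refl ⟩
  + 1 * (M₂ zero zero * det (minor M₂ zero zero)) +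
    (- + 1 * (M₂ zero (suc zero) * det K) + sumFin rest)
    ≡⟨ cong₂ (λ p q → p + (- + 1 * q + sumFin rest))
        (cong (λ r → + 1 * (r * det (minor M₂ zero zero))) z₀₀)
        (cong₂ _*_ z₀₁ K-det) ⟩
  + 1 * (+ 0 * det (minor M₂ zero zero)) + (- + 1 * (+ 1 * - det A) + sumFin rest)
    ≡⟨ cong (λ r → + 1 * (+ 0 * det (minor M₂ zero zero)) + (- + 1 * (+ 1 * - det A) + r))
         (sum-0 rest λ j → trans (cong (λ r → sgᶠ (suc (suc j)) * (r * det (minor M₂ zero (suc (suc j))))) (z₀ j))
           (ℤP.*-zeroʳ (sgᶠ (suc (suc j))))) ⟩
  + 1 * (+ 0 * det (minor M₂ zero zero)) + (- + 1 * (+ 1 * - det A) + + 0)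
    ≡⟨ lem₃ (det A) (det (minor M₂ zero zero)) ⟩
  det A
    ≡⟨ det-cong z ⟩
  _ ∎
  where
  x y : Fin (suc (suc n)) → ℤ
  x zero = + 0
  x (suc zero) = + 0
  x (suc (suc b)) = N (suc zero) (suc (suc b))
  y zero = + 0
  y (suc zero) = + 0
  y (suc (suc b)) = - N zero (suc (suc b))
  M₁ M₂ : Mat (suc (suc n))
  M₁ a b = N a b + x b * N a zero
  M₂ a b = M₁ a b + y b * M₁ a (suc zero)
  K : Mat (suc n)
  K = minor M₂ zero (suc zero)
  A : Mat n
  A a b = M₂ (suc (suc a)) (suc (suc b))
  rest : Fin n → ℤ
  rest j = sgᶠ (suc (suc j)) * (M₂ zero (suc (suc j)) * det (minor M₂ zero (suc (suc j))))
  lem : ∀ p q r s t → p + q * r + - s * (t + + 0 * r) ≡ p + r * q - t * s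
  lem = solve-∀
  z : ∀ a b → A a b ≡ _
  z a b = lem (N (suc (suc a)) (suc (suc b))) (N (suc zero) (suc (suc b))) (N (suc (suc a)) zero)
            (N zero (suc (suc b))) (N (suc (suc a)) (suc zero))
  z₀₀ : M₂ zero zero ≡ + 0
  z₀₀ = trans (lem₀ (N zero zero) (N zero (suc zero))) e₀₀
    where
    lem₀ : ∀ p q → p + + 0 * p + + 0 * (q + + 0 * p) ≡ p
    lem₀ = solve-∀
  z₀₁ : M₂ zero (suc zero) ≡ + 1
  z₀₁ = trans (lem₀ (N zero zero) (N zero (suc zero))) e₀₁
    where
    lem₀ : ∀ p q → q + + 0 * p + + 0 * (q + + 0 * p) ≡ q
    lem₀ = solve-∀
  z₁₀ : M₂ (suc zero) zero ≡ - + 1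
  z₁₀ = trans (lem₀ (N (suc zero) zero) (N (suc zero) (suc zero))) e₁₀
    where
    lem₀ : ∀ p q → p + + 0 * p + + 0 * (q + + 0 * p) ≡ p
    lem₀ = solve-∀
  z₀ : ∀ b → M₂ zero (suc (suc b)) ≡ + 0
  z₀ b = trans (cong₂ (λ p q → N zero (suc (suc b)) + N (suc zero) (suc (suc b)) * p
                  + - N zero (suc (suc b)) * (q + + 0 * p)) e₀₀ e₀₁)
               (lem₀ (N zero (suc (suc b))) (N (suc zero) (suc (suc b))))
    where
    lem₀ : ∀ p q → p + q * + 0 + - p * (+ 1 + + 0 * + 0) ≡ + 0
    lem₀ = solve-∀
  z₁ : ∀ b → M₂ (suc zero) (suc (suc b)) ≡ + 0
  z₁ b = trans (cong₂ (λ p q → N (suc zero) (suc (suc b)) + N (suc zero) (suc (suc b)) * p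
                  + - N zero (suc (suc b)) * (q + + 0 * p)) e₁₀ e₁₁)
               (lem₀ (N (suc zero) (suc (suc b))) (N zero (suc (suc b))))
    where
    lem₀ : ∀ q p → q + q * - + 1 + - p * (+ 0 + + 0 * - + 1) ≡ + 0
    lem₀ = solve-∀
  K-det : det K ≡ - det A
  K-det = trans (cong₂ _+_ (cong (λ r → + 1 * (r * det A)) z₁₀)
      (sum-0 (λ j → sgᶠ (suc j) * (K zero (suc j) * det (minor K zero (suc j)))) λ j →
        trans (cong (λ r → sgᶠ (suc j) * (r * det (minor K zero (suc j)))) (z₁ j)) (ℤP.*-zeroʳ (sgᶠ (suc j)))))
      (lem₀ (det A))
    where
    lem₀ : ∀ d → + 1 * (- + 1 * d) + + 0 ≡ - d
    lem₀ = solve-∀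
  lem₃ : ∀ d e → + 1 * (+ 0 * e) + (- + 1 * (+ 1 * - d) + + 0) ≡ d
  lem₃ = solve-∀

det-neg : ∀ {n} (M : Mat n) → det (λ a b → - M a b) ≡ sg (isEven n) * det M
det-neg {zero} M = refl
det-neg {suc n} M = trans (sum-cong λ j →
    trans (cong (λ d → sgᶠ j * (- M zero j * d)) (det-neg (minor M zero j)))
      (trans (lem (sgᶠ j) (M zero j) (sg (isEven n)) (det (minor M zero j)))
        (cong (λ s → s * (sgᶠ j * (M zero j * det (minor M zero j)))) (sym (sg-not (isEven n))))))
  (sum-* (sg (isEven (suc n))) (λ j → sgᶠ j * (M zero j * det (minor M zero j))))
  where
  lem : ∀ s x e d → s * (- x * (e * d)) ≡ - e * (s * (x * d))
  lem = solve-∀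

det-odd-skew : ∀ {n} (M : Mat n) → isEven n ≡ false → (∀ a b → M b a ≡ - M a b) → det M ≡ + 0
det-odd-skew {n} M odd anti = i≡-i⇒i≡0 (det M) (begin
  det M ≡⟨ sym (det-transpose M) ⟩
  det (transpose M) ≡⟨ det-cong anti ⟩
  det (λ a b → - M a b) ≡⟨ det-neg M ⟩
  sg (isEven n) * det M ≡⟨ cong (λ e → sg e * det M) odd ⟩
  - + 1 * det M ≡⟨ ℤP.-1*i≡-i _ ⟩
  - det M ∎)

-- Skew-symmetric borders and the area formula

border : ∀ {n} → (Fin n → ℤ) → Mat n → Mat (suc n)
border r M zero zero = + 0
border r M zero (suc b) = r b
border r M (suc a) zero = - r a
border r M (suc a) (suc b) = M a b

border-cong : ∀ {n} {r s : Fin n → ℤ} {M N : Mat n} → (∀ b → r b ≡ s b) → (∀ a b → M a b ≡ N a b) →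
  ∀ a b → border r M a b ≡ border s N a b
border-cong r≗s M≗N zero zero = refl
border-cong r≗s M≗N zero (suc b) = r≗s b
border-cong r≗s M≗N (suc a) zero = cong -_ (r≗s a)
border-cong r≗s M≗N (suc a) (suc b) = M≗N a b

schur : ∀ {n} → (r s : Fin n → ℤ) → Mat n → Mat n
schur r s M a b = M a b + - r a * s b - - s a * r b

det-border₂ : ∀ {n} (r : Fin (suc n) → ℤ) (s : Fin n → ℤ) (M : Mat n) → r zero ≡ + 1 →
  det (border r (border s M)) ≡ det (schur (r ∘ suc) s M)
det-border₂ r s M r₀ = det-schur (border r (border s M)) refl r₀ (cong -_ r₀) refl

-- The pivots are the second and third rows, so that the outer border survives as a border of the
-- Schur complement; `π` moves it behind them.
det-border₃ : ∀ {n} (x : Fin (suc (suc n)) → ℤ) (r : Fin (suc n) → ℤ) (s : Fin n → ℤ) (M : Mat n) →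
  r zero ≡ + 1 →
  det (border x (border r (border s M))) ≡
  det (border (λ b → x (suc (suc b)) + x zero * s b - x (suc zero) * r (suc b)) (schur (r ∘ suc) s M))
det-border₃ {n} x r s M r₀ = begin
  det B
    ≡⟨ sym (det-permute (signed-∘ signed-swap₀₁ (signed-lift signed-swap₀₁)) B) ⟩
  det (λ a b → B (π a) (π b))
    ≡⟨ det-schur (λ a b → B (π a) (π b)) refl r₀ (cong -_ r₀) refl ⟩
  _ ≡⟨ det-cong eq ⟩
  _ ∎
  where
  B = border x (border r (border s M))
  π : Fin (suc (suc (suc n))) → Fin (suc (suc (suc n)))
  π b = swap₀₁ (lift swap₀₁ b)
  lem₁ : ∀ p q → + 0 + p * - q - q * - p ≡ + 0
  lem₁ = solve-∀
  lem₂ : ∀ y p s q r → - y + - r * - q - - s * - p ≡ - (y + p * s - q * r)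
  lem₂ = solve-∀
  eq : ∀ a b → B (π (suc (suc a))) (π (suc (suc b)))
                + B (π (suc (suc a))) (π zero) * B (π (suc zero)) (π (suc (suc b)))
                - B (π (suc (suc a))) (π (suc zero)) * B (π zero) (π (suc (suc b)))
       ≡ border (λ b → x (suc (suc b)) + x zero * s b - x (suc zero) * r (suc b)) (schur (r ∘ suc) s M) a b
  eq zero zero = lem₁ (x zero) (x (suc zero))
  eq zero (suc b) = refl
  eq (suc a) zero = lem₂ (x (suc (suc a))) (x zero) (s a) (x (suc zero)) (r (suc a))
  eq (suc a) (suc b) = refl

V : Set
V = ℤ × ℤ

_⨯_ : V → V → ℤ
(a , x) ⨯ (b , y) = a * y - x * b

infixl 6 _⊕_
_⊕_ : V → V → V
(a , x) ⊕ (b , y) = (a + b) , (x + y)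

ΣV : List V → V
ΣV [] = + 0 , + 0
ΣV (v ∷ p) = v ⊕ ΣV p

-- Twice the signed area swept out by the path with the given steps.
area : List V → ℤ
area [] = + 0
area (v ∷ p) = v ⨯ ΣV p + area p

alternating : ∀ k → ℤ → (a x : Fin k → ℤ) → List V
alternating zero t a x = []
alternating (suc k) t a x = (t * a zero , t * x zero) ∷ alternating k (- t) (a ∘ suc) (x ∘ suc)

double : ℕ → ℕ
double zero = zero
double (suc t) = suc (suc (double t))

tail₂ : ∀ {n} → (Fin (suc (suc n)) → ℤ) → Fin n → ℤ
tail₂ a j = a (suc (suc j))

snoc : ∀ k → (Fin k → ℤ) → ℤ → Fin (suc k) → ℤ
snoc zero x θ _ = θ
snoc (suc k) x θ zero = x zero
snoc (suc k) x θ (suc b) = snoc k (x ∘ suc) θ b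

snoc-η : ∀ k (x : Fin (suc k) → ℤ) b → x b ≡ snoc k (x ∘ inject₁) (x (fromℕ k)) b
snoc-η zero x zero = refl
snoc-η (suc k) x zero = refl
snoc-η (suc k) x (suc b) = snoc-η k (x ∘ suc) b

snoc-cong : ∀ k {x y : Fin k → ℤ} {θ} → (∀ j → x j ≡ y j) → ∀ b → snoc k x θ b ≡ snoc k y θ b
snoc-cong zero e b = refl
snoc-cong (suc k) e zero = e zero
snoc-cong (suc k) e (suc b) = snoc-cong k (e ∘ suc) b

-- The skew matrix of a transitive tournament followed by one more vertex,
-- towards which the transitive ones have the entries a.
transMat : ∀ k → (Fin k → ℤ) → Mat (suc k)
transMat zero a _ _ = + 0
transMat (suc k) a = border (snoc k (λ _ → + 1) (a zero)) (transMat k (a ∘ suc))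

private
  ΣV-shift : ∀ t (a x : Fin (double t) → ℤ) d e →
    ΣV (alternating (double t) (+ 1) (λ j → a j + d) (λ j → x j + e)) ≡ ΣV (alternating (double t) (+ 1) a x)
  ΣV-shift zero a x d e = refl
  ΣV-shift (suc t) a x d e = trans
    (cong (λ S → (+ 1 * (a zero + d) , + 1 * (x zero + e)) ⊕
                 ((- + 1 * (a (suc zero) + d) , - + 1 * (x (suc zero) + e)) ⊕ S))
      (ΣV-shift t (tail₂ a) (tail₂ x) d e))
    (cong₂ _,_ (lem (a zero) (a (suc zero)) d _) (lem (x zero) (x (suc zero)) e _))
    where
    lem : ∀ p q d s → + 1 * (p + d) + (- + 1 * (q + d) + s) ≡ + 1 * p + (- + 1 * q + s)
    lem = solve-∀

  -- Write δ = (d, e). In the cross terms the j-th step meets δ with the sum of the signs before it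
  -- minus the sum of those after it. As the number of steps is even, this is 1 for every j.
  area-shift : ∀ t (a x : Fin (double t) → ℤ) d e →
    area (alternating (double t) (+ 1) (λ j → a j + d) (λ j → x j + e)) ≡
    area (alternating (double t) (+ 1) a x) + (d , e) ⨯ ΣV (alternating (double t) (+ 1) a x)
  area-shift zero a x d e = lem d e
    where
    lem : ∀ d e → + 0 ≡ + 0 + (d * + 0 - e * + 0)
    lem = solve-∀
  area-shift (suc t) a x d e = trans
    (cong₂ (λ S P → v ⨯ (w ⊕ S) + (w ⨯ S + P)) (ΣV-shift t (tail₂ a) (tail₂ x) d e)
      (area-shift t (tail₂ a) (tail₂ x) d e))
    (lem (a zero) (a (suc zero)) (x zero) (x (suc zero)) d e _ _ _)
    where
    v w : V
    v = + 1 * (a zero + d) , + 1 * (x zero + e)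
    w = - + 1 * (a (suc zero) + d) , - + 1 * (x (suc zero) + e)
    lem : ∀ a b x y d e s r P →
      + 1 * (a + d) * (- + 1 * (y + e) + r) - + 1 * (x + e) * (- + 1 * (b + d) + s)
        + (- + 1 * (b + d) * r - - + 1 * (y + e) * s + (P + (d * r - e * s)))
      ≡ + 1 * a * (- + 1 * y + r) - + 1 * x * (- + 1 * b + s)
        + (- + 1 * b * r - - + 1 * y * s + P)
        + (d * (+ 1 * x + (- + 1 * y + r)) - e * (+ 1 * a + (- + 1 * b + s)))
    lem = solve-∀

  -- Both pivots have entry 1 towards every remaining transitive vertex, so the two corrections
  -- cancel there; only the entries towards the last vertex move.
  schur-trans : ∀ k (c : Fin k → ℤ) p q a b →
    schur (snoc k (λ _ → + 1) p) (snoc k (λ _ → + 1) q) (transMat k c) a b ≡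
    transMat k (λ j → c j + (p - q)) a b
  schur-trans zero c p q a b = lem p q
    where
    lem : ∀ p q → + 0 + - p * q - - q * p ≡ + 0
    lem = solve-∀
  schur-trans (suc k) c p q zero zero = refl
  schur-trans (suc k) c p q zero (suc b) = row k b
    where
    lem : ∀ c p q → c + - + 1 * q - - + 1 * p ≡ c + (p - q)
    lem = solve-∀
    row : ∀ k b → snoc k (λ _ → + 1) (c zero) b + - + 1 * snoc k (λ _ → + 1) q b - - + 1 * snoc k (λ _ → + 1) p b
      ≡ snoc k (λ _ → + 1) (c zero + (p - q)) b
    row zero b = lem (c zero) p q
    row (suc k) zero = refl
    row (suc k) (suc b) = row k b
  schur-trans (suc k) c p q (suc a) zero = row k a
    where
    lem : ∀ c p q → - c + - p * + 1 - - q * + 1 ≡ - (c + (p - q))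
    lem = solve-∀
    row : ∀ k b → - snoc k (λ _ → + 1) (c zero) b + - snoc k (λ _ → + 1) p b * + 1 - - snoc k (λ _ → + 1) q b * + 1
      ≡ - snoc k (λ _ → + 1) (c zero + (p - q)) b
    row zero b = lem (c zero) p q
    row (suc k) zero = refl
    row (suc k) (suc b) = row k b
  schur-trans (suc k) c p q (suc a) (suc b) = schur-trans k (c ∘ suc) p q a b

  snoc-update : ∀ k (x : Fin k → ℤ) θ x₀ x₁ p q b →
    snoc k x θ b + x₀ * snoc k (λ _ → + 1) q b - x₁ * snoc k (λ _ → + 1) p b ≡
    snoc k (λ j → x j + (x₀ - x₁)) (θ + x₀ * q - x₁ * p) b
  snoc-update zero x θ x₀ x₁ p q b = refl
  snoc-update (suc k) x θ x₀ x₁ p q zero = lem (x zero) x₀ x₁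
    where
    lem : ∀ x p q → x + p * + 1 - q * + 1 ≡ x + (p - q)
    lem = solve-∀
  snoc-update (suc k) x θ x₀ x₁ p q (suc b) = snoc-update k (x ∘ suc) θ x₀ x₁ p q b

-- Eliminating the first two transitive vertices adds to `θ` the cross product of the first two
-- steps, and shifts all later entries by the sum of these steps. By `area-shift` that shift yields
-- the cross products of the two steps with the rest of the path.
det-transMat : ∀ t (a x : Fin (double t) → ℤ) θ →
  let P = θ + area (alternating (double t) (+ 1) a x) in
  det (border (snoc (double t) x θ) (transMat (double t) a)) ≡ P * P
det-transMat zero a x θ = lem θ
  where
  lem : ∀ θ → + 1 * (+ 0 * (+ 1 * (+ 0 * + 1) + + 0)) + (- + 1 * (θ * (+ 1 * (- θ * + 1) + + 0)) + + 0)
    ≡ (θ + + 0) * (θ + + 0)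
  lem = solve-∀
det-transMat (suc t) a x θ = begin
  det (border (snoc (double (suc t)) x θ) (transMat (double (suc t)) a))
    ≡⟨ det-border₃ (snoc (double (suc t)) x θ) (snoc (suc (double t)) (λ _ → + 1) (a zero))
         (snoc (double t) (λ _ → + 1) (a (suc zero))) (transMat (double t) (tail₂ a)) refl ⟩
  _ ≡⟨ det-cong (border-cong
         (snoc-update (double t) (tail₂ x) θ (x zero) (x (suc zero)) (a zero) (a (suc zero)))
         (schur-trans (double t) (tail₂ a) (a zero) (a (suc zero)))) ⟩
  _ ≡⟨ det-transMat t (λ j → a (suc (suc j)) + (a zero - a (suc zero)))
         (λ j → x (suc (suc j)) + (x zero - x (suc zero))) _ ⟩
  _ ≡⟨ cong (λ P → P * P) (trans
         (cong (_+_ (θ + x zero * a (suc zero) - x (suc zero) * a zero))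
           (area-shift t (tail₂ a) (tail₂ x) (a zero - a (suc zero)) (x zero - x (suc zero))))
         (lem θ (a zero) (a (suc zero)) (x zero) (x (suc zero)) _ _ _)) ⟩
  _ ∎
  where
  lem : ∀ θ a b x y s r P →
    θ + x * b - y * a + (P + ((a - b) * r - (x - y) * s)) ≡
    θ + (+ 1 * a * (- + 1 * y + r) - + 1 * x * (- + 1 * b + s)
        + (- + 1 * b * r - - + 1 * y * s + P))
  lem = solve-∀

-- Tournaments

skew-diag : ∀ {n} (S : Digraph n) a → skew S a a ≡ + 0
skew-diag S a with a ≟ a
... | yes _ = refl
... | no a≢a = contradiction refl a≢a

skew-off : ∀ {n} (S : Digraph n) a b → a ≢ b → skew S a b ≡ sg (S a b)
skew-off S a b a≢b with a ≟ b
... | yes a≡b = contradiction a≡b a≢b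
... | no _ = refl

skew-anti : ∀ {n} (S : Digraph n) → IsTournament S → ∀ a b → skew S b a ≡ - skew S a b
skew-anti S tour a b with a ≟ b
... | yes refl = skew-diag S a
... | no a≢b = trans (skew-off S b a (a≢b ∘ sym)) (trans (cong sg (tour a b a≢b)) (sg-not (S a b)))

skew-cong : ∀ {n} {S T : Digraph n} → (∀ a b → a ≢ b → S a b ≡ T a b) → ∀ a b → skew S a b ≡ skew T a b
skew-cong {S = S} {T} e a b with a ≟ b
... | yes refl = refl
... | no a≢b = cong sg (e a b a≢b)

induced-tournament : ∀ {k n} {T : Digraph n} → IsTournament T → {f : Fin k → Fin n} →
  Injective _≡_ _≡_ f → IsTournament (induced T f)
induced-tournament tour f-inj a b a≢b = tour _ _ (a≢b ∘ f-inj)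

skew-suc : ∀ {n} (S : Digraph (suc n)) a b → skew S (suc a) (suc b) ≡ skew (induced S suc) a b
skew-suc S a b with a ≟ b
... | yes refl = refl
... | no a≢b = refl

skew-border : ∀ {n} (S : Digraph (suc n)) → IsTournament S → ∀ a b →
  skew S a b ≡ border (λ b → sg (S zero (suc b))) (skew (induced S suc)) a b
skew-border S tour zero zero = refl
skew-border S tour zero (suc b) = refl
skew-border S tour (suc a) zero = trans (cong sg (tour zero (suc a) λ ())) (sg-not (S zero (suc a)))
skew-border S tour (suc a) (suc b) = skew-suc S a b

TransitiveButLast : ∀ {k} → Digraph (suc k) → Set
TransitiveButLast {k} S = ∀ a b → toℕ a ℕ.< toℕ b → toℕ b ℕ.< k → S a b ≡ true

toLast : ∀ {k} → Digraph (suc k) → Fin k → ℤ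
toLast {k} S j = sg (S (inject₁ j) (fromℕ k))

skew-transMat : ∀ {k} (S : Digraph (suc k)) → IsTournament S → TransitiveButLast S →
  ∀ a b → skew S a b ≡ transMat k (toLast S) a b
skew-transMat {zero} S tour tr zero zero = refl
skew-transMat {suc k} S tour tr a b = trans (skew-border S tour a b)
  (border-cong row
    (skew-transMat (induced S suc) (induced-tournament tour FP.suc-injective)
      (λ a b a<b b<k → tr (suc a) (suc b) (ℕ.s≤s a<b) (ℕ.s≤s b<k)))
    a b)
  where
  row : ∀ b → sg (S zero (suc b)) ≡ snoc k (λ _ → + 1) (toLast S zero) b
  row b = trans (snoc-η k (λ b → sg (S zero (suc b))) b)
    (snoc-cong k (λ j → cong sg (tr zero (suc (inject₁ j)) (ℕ.s≤s ℕ.z≤n)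
      (ℕ.s≤s (subst (ℕ._< k) (sym (FP.toℕ-inject₁ j)) (FP.toℕ<n j))))) b)

-- Up to sign the Pfaffian of `border x (skew S)`, for even `k` and `S` transitive up to its last
-- vertex. Unlike the determinant it is linear in `x`.
pf : ∀ {k} → Digraph (suc k) → (Fin (suc k) → ℤ) → ℤ
pf {k} S x = x (fromℕ k) + area (alternating k (+ 1) (toLast S) (x ∘ inject₁))

det-border-skew : ∀ t (S : Digraph (suc (double t))) → IsTournament S → TransitiveButLast S → ∀ x →
  det (border x (skew S)) ≡ pf S x * pf S x
det-border-skew t S tour tr x = trans
  (det-cong (border-cong (snoc-η (double t) x) (skew-transMat S tour tr)))
  (det-transMat t (toLast S) (x ∘ inject₁) (x (fromℕ (double t))))

detT-cong : ∀ {n} {S T : Digraph n} → (∀ a b → a ≢ b → S a b ≡ T a b) → detT S ≡ detT T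
detT-cong e = det-cong (skew-cong e)

detT-permute : ∀ {n} {π : Fin n → Fin n} → Signed π → Injective _≡_ _≡_ π →
  ∀ (S : Digraph n) → detT (induced S π) ≡ detT S
detT-permute {π = π} p π-inj S = trans (det-cong eq) (det-permute p (skew S))
  where
  eq : ∀ a b → skew (induced S π) a b ≡ skew S (π a) (π b)
  eq a b with a ≟ b
  ... | yes refl = sym (skew-diag S (π a))
  ... | no a≢b = sym (skew-off S (π a) (π b) (a≢b ∘ π-inj))

swap₀₁-injective : ∀ {n} → Injective _≡_ _≡_ (swap₀₁ {n})
swap₀₁-injective {x = zero} {zero} _ = refl
swap₀₁-injective {x = zero} {suc zero} ()
swap₀₁-injective {x = zero} {suc (suc b)} ()
swap₀₁-injective {x = suc zero} {zero} ()
swap₀₁-injective {x = suc zero} {suc (suc b)} ()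
swap₀₁-injective {x = suc (suc a)} {zero} ()
swap₀₁-injective {x = suc (suc a)} {suc zero} ()
swap₀₁-injective {x = suc zero} {suc zero} _ = refl
swap₀₁-injective {x = suc (suc a)} {suc (suc b)} e = e

-- The rows of associated vertices are equal or opposite on the remaining ones, so the two rank-one
-- corrections in the Schur complement cancel. The pivot has to be 1, which is arranged by swapping
-- the two vertices if necessary.
detT-CR : ∀ {n} (S : Digraph (suc (suc n))) → IsTournament S → CRAssoc S zero (suc zero) →
  detT S ≡ detT (λ a b → S (suc (suc a)) (suc (suc b)))
detT-CR {n} S tour cr = case _ refl cr
  where
  forward : ∀ (S : Digraph (suc (suc n))) → IsTournament S → S zero (suc zero) ≡ true →
    (∀ a b → sg (S (suc zero) (suc (suc a))) * sg (S zero (suc (suc b))) ≡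
             sg (S zero (suc (suc a))) * sg (S (suc zero) (suc (suc b)))) →
    detT S ≡ detT (λ a b → S (suc (suc a)) (suc (suc b)))
  forward S tour S₀₁ par = begin
    detT S
      ≡⟨ det-cong (λ a b → trans (skew-border S tour a b) (border-cong (λ _ → refl)
           (skew-border (induced S suc) (induced-tournament tour FP.suc-injective)) a b)) ⟩
    det (border r (border s (skew S″)))
      ≡⟨ det-border₂ r s (skew S″) (cong sg S₀₁) ⟩
    det (schur (r ∘ suc) s (skew S″))
      ≡⟨ det-cong (λ a b → lem (skew S″ a b) (r (suc a)) (s b) (s a) (r (suc b)) (par a b)) ⟩
    detT S″ ∎
    where
    S″ : Digraph n
    S″ a b = S (suc (suc a)) (suc (suc b))
    r : Fin (suc n) → ℤ
    r b = sg (S zero (suc b))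
    s : Fin n → ℤ
    s b = sg (S (suc zero) (suc (suc b)))
    lem : ∀ m p q p′ q′ → p′ * q′ ≡ p * q → m + - p * q - - p′ * q′ ≡ m
    lem m p q p′ q′ e = trans (lem₁ m p q p′ q′) (trans (cong (λ z → m - p * q + z) e) (lem₂ m (p * q)))
      where
      lem₁ : ∀ m p q p′ q′ → m + - p * q - - p′ * q′ ≡ m - p * q + p′ * q′
      lem₁ = solve-∀
      lem₂ : ∀ m z → m - z + z ≡ m
      lem₂ = solve-∀
  flip-par : ∀ b c d e → b ≡ not d → c ≡ not e → sg b * sg e ≡ sg d * sg c
  flip-par b c true true refl refl = refl
  flip-par b c true false refl refl = refl
  flip-par b c false true refl refl = refl
  flip-par b c false false refl refl = refl
  parallel : CRAssoc S zero (suc zero) → ∀ a b →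
    sg (S (suc zero) (suc (suc a))) * sg (S zero (suc (suc b))) ≡
    sg (S zero (suc (suc a))) * sg (S (suc zero) (suc (suc b)))
  parallel (inj₁ co) a b = cong₂ _*_ (cong sg (sym (co (suc (suc a)) (λ ()) (λ ()))))
                                     (cong sg (co (suc (suc b)) (λ ()) (λ ())))
  parallel (inj₂ re) a b = sym (flip-par _ _ _ _ (re (suc (suc a)) (λ ()) (λ ())) (re (suc (suc b)) (λ ()) (λ ())))
  case : ∀ v → S zero (suc zero) ≡ v → CRAssoc S zero (suc zero) →
    detT S ≡ detT (λ a b → S (suc (suc a)) (suc (suc b)))
  case true e cr = forward S tour e (parallel cr)
  case false e cr = trans (sym (detT-permute signed-swap₀₁ swap₀₁-injective S))
    (forward (induced S swap₀₁) (induced-tournament tour swap₀₁-injective)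
      (trans (tour zero (suc zero) λ ()) (cong not e))
      (λ a b → sym (parallel cr a b)))

-- Words coding the rows of the new vertex

step : Bool → Bool → V
step s q = sg s , sg s * sg q

-- Deleting a vertex of the transitive part reverses the sign pattern after it.
-- The indices are the signs before the first and after the last letter.
data Selection : Bool → Bool → List Bool → List V → Set where
  done : ∀ {s} → Selection s s [] []
  keep : ∀ {s e q w p} → Selection s e w p → Selection s e (q ∷ w) (step s q ∷ p)
  drop : ∀ {s e q w p} → Selection (not s) e w p → Selection s e (q ∷ w) p

keepAll : ∀ s w → Selection s s w (map (step s) w)
keepAll s [] = done
keepAll s (q ∷ w) = keep (keepAll s w)

-- Opposite end signs mean an odd number of drops. For a word of odd length the number of kept
-- letters is then even, so that together with `u` and the last vertex the order is even. The
-- condition also closes the word up cyclically, see `bounded-rotate`.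
Bounded : ℕ → ℤ → List Bool → Set
Bounded m θ w = ∀ s p → Selection s (not s) w p → ℤ.∣ θ + area p ∣ ℕ.≤ m

split-last : ∀ {s e x} w {p} → Selection s e (w ++ x ∷ []) p →
  (Σ (List V) λ p′ → Selection s e w p′ × p ≡ p′ ++ step e x ∷ []) ⊎
  (Σ Bool λ e′ → Selection s e′ w p × e ≡ not e′)
split-last [] (keep done) = inj₁ ([] , done , refl)
split-last {s} [] (drop done) = inj₂ (s , done , refl)
split-last {s} (q ∷ w) (keep sel) with split-last w sel
... | inj₁ (p′ , sel′ , refl) = inj₁ (step s q ∷ p′ , keep sel′ , refl)
... | inj₂ (e′ , sel′ , eq) = inj₂ (e′ , keep sel′ , eq)
split-last (q ∷ w) (drop sel) with split-last w sel
... | inj₁ (p′ , sel′ , eq) = inj₁ (p′ , drop sel′ , eq)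
... | inj₂ (e′ , sel′ , eq) = inj₂ (e′ , drop sel′ , eq)

ΣV-snoc : ∀ p v → ΣV (p ++ v ∷ []) ≡ ΣV p ⊕ v
ΣV-snoc [] (a , x) = cong₂ _,_ (ℤP.+-comm a (+ 0)) (ℤP.+-comm x (+ 0))
ΣV-snoc ((b , y) ∷ p) v@(a , x) rewrite ΣV-snoc p v =
  cong₂ _,_ (sym (ℤP.+-assoc b _ a)) (sym (ℤP.+-assoc y _ x))

area-snoc : ∀ p v → area (p ++ v ∷ []) ≡ area p + ΣV p ⨯ v
area-snoc [] (a , x) = lem a x
  where
  lem : ∀ a x → a * + 0 - x * + 0 + + 0 ≡ + 0 + (+ 0 * x - + 0 * a)
  lem = solve-∀
area-snoc ((b , y) ∷ p) v@(a , x) rewrite ΣV-snoc p v | area-snoc p v = lem b y a x _ _ _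
  where
  lem : ∀ b y a x s r P → b * (r + x) - y * (s + a) + (P + (s * x - r * a))
    ≡ b * r - y * s + P + ((b + s) * x - (y + r) * a)
  lem = solve-∀

-- Moving a step from the front to the end negates its cross product with the rest; reversing the
-- step negates it again.
area-rotate : ∀ s x p → area (step s x ∷ p) ≡ area (p ++ step (not s) x ∷ [])
area-rotate s x p = sym (trans (area-snoc p (step (not s) x))
  (trans (cong (λ t → area p + ΣV p ⨯ (t , t * sg x)) (sg-not s)) (lem (area p) (sg s) (sg x) _ _)))
  where
  lem : ∀ P s x a r → P + (a * (- s * x) - r * - s) ≡ s * r - s * x * a + P
  lem = solve-∀

-- A final letter kept with sign `not s` becomes an initial letter kept with sign `s`, of the same
-- area. A final letter that is dropped is dropped in front, with the opposite start sign.
bounded-rotate : ∀ {m θ} x w → Bounded m θ (x ∷ w) → Bounded m θ (w ++ x ∷ [])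
bounded-rotate {m} {θ} x w bd s p sel with split-last w sel
... | inj₁ (p′ , sel′ , refl) = subst (λ z → ℤ.∣ θ + z ∣ ℕ.≤ m) (area-rotate s x p′) (bd s (step s x ∷ p′) (keep sel′))
... | inj₂ (e′ , sel′ , eq) = bd (not s) p (drop (subst₂ (λ a b → Selection a b w p)
        (sym (not-involutive s)) (trans (not-injective e′ s (sym eq)) (sym (not-involutive s))) sel′))
  where
  not-injective : ∀ a b → not a ≡ not b → a ≡ b
  not-injective true true _ = refl
  not-injective false false _ = refl

-- Letter counts and inequalities from pairs of selections.

countA countB : List Bool → ℕ
countA [] = 0
countA (true ∷ w) = suc (countA w)
countA (false ∷ w) = countA w
countB [] = 0
countB (true ∷ w) = countB w
countB (false ∷ w) = suc (countB w)

ΣV-keepAll : ∀ w → ΣV (map (step true) w) ≡ (+ countA w + + countB w , + countA w - + countB w)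
ΣV-keepAll [] = refl
ΣV-keepAll (true ∷ w) rewrite ΣV-keepAll w = cong₂ _,_ (lem₁ (+ countA w) (+ countB w)) (lem₂ (+ countA w) (+ countB w))
  where
  lem₁ : ∀ a b → + 1 + (a + b) ≡ + 1 + a + b
  lem₁ = solve-∀
  lem₂ : ∀ a b → + 1 + (a - b) ≡ + 1 + a - b
  lem₂ = solve-∀
ΣV-keepAll (false ∷ w) rewrite ΣV-keepAll w = cong₂ _,_ (lem₁ (+ countA w) (+ countB w)) (lem₂ (+ countA w) (+ countB w))
  where
  lem₁ : ∀ a b → + 1 + (a + b) ≡ a + (+ 1 + b)
  lem₁ = solve-∀
  lem₂ : ∀ a b → - + 1 + (a - b) ≡ a - (+ 1 + b)
  lem₂ = solve-∀

-- `θ` cancels in the difference of two Pfaffians. The summand `y` collects the negative terms, so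
-- that the inequality can be stated in ℕ.
bounded-diff : ∀ {m} θ {w} → Bounded m θ w → ∀ p q → Selection false true w p → Selection false true w q →
  ∀ x y → area p - area q + + y ≡ + x → x ℕ.≤ m ℕ.+ m ℕ.+ y
bounded-diff {m} θ bd p q sp sq x y eq = ℤP.drop‿+≤+ (subst (ℤ._≤ + (m ℕ.+ m ℕ.+ y)) eq
  (ℤP.+-monoˡ-≤ (+ y) (ℤP.≤-trans (i≤∣i∣ (area p - area q)) (ℤ.+≤+ diff≤))))
  where
  i≤∣i∣ : ∀ i → i ℤ.≤ + ℤ.∣ i ∣
  i≤∣i∣ (+ n) = ℤP.≤-refl
  i≤∣i∣ (ℤ.-[1+ n ]) = ℤ.-≤+
  lem : ∀ t a b → (t + a) - (t + b) ≡ a - b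
  lem = solve-∀
  diff≤ : ℤ.∣ area p - area q ∣ ℕ.≤ m ℕ.+ m
  diff≤ = subst (λ z → ℤ.∣ z ∣ ℕ.≤ m ℕ.+ m) (lem θ (area p) (area q))
    (ℕP.≤-trans (ℤP.∣i-j∣≤∣i∣+∣j∣ (θ + area p) (θ + area q)) (ℕP.+-mono-≤ (bd false p sp) (bd false q sq)))

module _ {m : ℕ} (θ : ℤ) (w : List Bool) where
  private
    R = map (step true) w
    a = countA w
    b = countB w
    A = + a
    B = + b

  -- Keeping only the second B or only the first gives opposite first steps before the same tail,
  -- and the areas differ by twice the cross product of that step with the tail.
  pattern-BB : Bounded m θ (false ∷ false ∷ w) → a ℕ.+ a ℕ.+ (a ℕ.+ a) ℕ.≤ m ℕ.+ m ℕ.+ 0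
  pattern-BB bd = bounded-diff θ bd
    (step true false ∷ R)
    (step false false ∷ R)
    (drop (keep (keepAll true w))) (keep (drop (keepAll true w)))
    (a ℕ.+ a ℕ.+ (a ℕ.+ a)) 0
    (trans (cong (λ σ → (step true false ⨯ σ + area R) - (step false false ⨯ σ + area R) + + 0) (ΣV-keepAll w))
      (lem A B (area R)))
    where
    lem : ∀ a b g → (+ 1 * (a - b) - - + 1 * (a + b) + g) - (- + 1 * (a - b) - + 1 * (a + b) + g) + + 0
      ≡ a + a + (a + a)
    lem = solve-∀

  -- Compares dropping the first letter with dropping the third. In terms of the full counts α = a +
  -- 2, β = b + 1 and m = α + β it reads α ≤ 3β.
  pattern-ABA : Bounded m θ (true ∷ false ∷ true ∷ w) →
    4 ℕ.+ (a ℕ.+ a ℕ.+ (a ℕ.+ a)) ℕ.≤ m ℕ.+ m ℕ.+ (b ℕ.+ b ℕ.+ (b ℕ.+ b))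
  pattern-ABA bd = bounded-diff θ bd
    (step true false ∷ step true true ∷ R)
    (step false true ∷ step false false ∷ R)
    (drop (keep (keep (keepAll true w)))) (keep (keep (drop (keepAll true w))))
    (4 ℕ.+ (a ℕ.+ a ℕ.+ (a ℕ.+ a))) (b ℕ.+ b ℕ.+ (b ℕ.+ b))
    (trans (cong (λ σ → (step true false ⨯ (step true true ⊕ σ) + (step true true ⨯ σ + area R))
                      - (step false true ⨯ (step false false ⊕ σ) + (step false false ⨯ σ + area R))
                      + (B + B + (B + B))) (ΣV-keepAll w))
      (lem A B (area R)))
    where
    lem : ∀ a b g →
      (+ 1 * (+ 1 + (a - b)) - - + 1 * (+ 1 + (a + b)) + (+ 1 * (a - b) - + 1 * (a + b) + g))
      - (- + 1 * (+ 1 + (a - b)) - - + 1 * (- + 1 + (a + b)) + (- + 1 * (a - b) - + 1 * (a + b) + g))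
      + (b + b + (b + b)) ≡ + 4 + (a + a + (a + a))
    lem = solve-∀

  -- Compares dropping the third letter with dropping the first. For m = α + β and β = b it reads 3β
  -- ≤ α.
  pattern-AAA : Bounded m θ (true ∷ true ∷ true ∷ w) →
    b ℕ.+ b ℕ.+ (b ℕ.+ b) ℕ.+ (b ℕ.+ b ℕ.+ (b ℕ.+ b)) ℕ.≤ m ℕ.+ m ℕ.+ 0
  pattern-AAA bd = bounded-diff θ bd
    (step false true ∷ step false true ∷ R)
    (step true true ∷ step true true ∷ R)
    (keep (keep (drop (keepAll true w)))) (drop (keep (keep (keepAll true w))))
    (b ℕ.+ b ℕ.+ (b ℕ.+ b) ℕ.+ (b ℕ.+ b ℕ.+ (b ℕ.+ b))) 0
    (trans (cong (λ σ → (step false true ⨯ (step false true ⊕ σ) + (step false true ⨯ σ + area R))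
                      - (step true true ⨯ (step true true ⊕ σ) + (step true true ⨯ σ + area R))
                      + + 0) (ΣV-keepAll w))
      (lem A B (area R)))
    where
    lem : ∀ a b g →
      (- + 1 * (- + 1 + (a - b)) - - + 1 * (- + 1 + (a + b)) + (- + 1 * (a - b) - - + 1 * (a + b) + g))
      - (+ 1 * (+ 1 + (a - b)) - + 1 * (+ 1 + (a + b)) + (+ 1 * (a - b) - + 1 * (a + b) + g))
      + + 0 ≡ b + b + (b + b) + (b + b + (b + b))
    lem = solve-∀

  -- Dropping the two middle letters turns ABAABA into ABBA.
  pattern-ABAABA : Bounded m θ (true ∷ false ∷ true ∷ true ∷ false ∷ true ∷ w) →
    8 ℕ.+ (a ℕ.+ a ℕ.+ (a ℕ.+ a) ℕ.+ (a ℕ.+ a ℕ.+ (a ℕ.+ a))) ℕ.≤ m ℕ.+ m ℕ.+ (b ℕ.+ b ℕ.+ (b ℕ.+ b))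
  pattern-ABAABA bd = bounded-diff θ bd
    (step true false ∷ step true false ∷ step true true ∷ R)
    (step false true ∷ step false false ∷ step false false ∷ R)
    (drop (keep (drop (drop (keep (keep (keepAll true w)))))))
                     (keep (keep (drop (drop (keep (drop (keepAll true w)))))))
    (8 ℕ.+ (a ℕ.+ a ℕ.+ (a ℕ.+ a) ℕ.+ (a ℕ.+ a ℕ.+ (a ℕ.+ a)))) (b ℕ.+ b ℕ.+ (b ℕ.+ b))
    (trans (cong (λ σ →
          (step true false ⨯ (step true false ⊕ (step true true ⊕ σ))
            + (step true false ⨯ (step true true ⊕ σ) + (step true true ⨯ σ + area R)))
        - (step false true ⨯ (step false false ⊕ (step false false ⊕ σ))
            + (step false false ⨯ (step false false ⊕ σ) + (step false false ⨯ σ + area R)))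
        + (B + B + (B + B))) (ΣV-keepAll w))
      (lem A B (area R)))
    where
    lem : ∀ a b g →
      (+ 1 * (- + 1 + (+ 1 + (a - b))) - - + 1 * (+ 1 + (+ 1 + (a + b)))
        + (+ 1 * (+ 1 + (a - b)) - - + 1 * (+ 1 + (a + b)) + (+ 1 * (a - b) - + 1 * (a + b) + g)))
      - (- + 1 * (+ 1 + (+ 1 + (a - b))) - - + 1 * (- + 1 + (- + 1 + (a + b)))
        + (- + 1 * (+ 1 + (a - b)) - + 1 * (- + 1 + (a + b)) + (- + 1 * (a - b) - + 1 * (a + b) + g)))
      + (b + b + (b + b)) ≡ + 8 + (a + a + (a + a) + (a + a + (a + a)))
    lem = solve-∀

n+n-even : ∀ n → isEven (n ℕ.+ n) ≡ true
n+n-even zero = refl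
n+n-even (suc n) rewrite ℕP.+-suc n n = trans (not-involutive _) (n+n-even n)

private
  -- With the slack of a hypothesis as a variable `c`, a violated inequality becomes a polynomial
  -- identity, which the ring solver can prove.
  exceeds : ∀ {x y} k → x ≡ y ℕ.+ suc k → ¬ x ℕ.≤ y
  exceeds k refl = ℕP.m+1+n≰m _

countA-snoc : ∀ w x → countA (w ++ x ∷ []) ≡ countA (x ∷ w)
countA-snoc [] x = refl
countA-snoc (true ∷ w) true = cong suc (countA-snoc w true)
countA-snoc (true ∷ w) false = cong suc (countA-snoc w false)
countA-snoc (false ∷ w) true = countA-snoc w true
countA-snoc (false ∷ w) false = countA-snoc w false

countB-snoc : ∀ w x → countB (w ++ x ∷ []) ≡ countB (x ∷ w)
countB-snoc [] x = refl
countB-snoc (true ∷ w) true = countB-snoc w true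
countB-snoc (true ∷ w) false = countB-snoc w false
countB-snoc (false ∷ w) true = cong suc (countB-snoc w true)
countB-snoc (false ∷ w) false = cong suc (countB-snoc w false)

-- Repetitions and cyclic words.

repeats : List Bool → ℕ
repeats [] = 0
repeats (x ∷ []) = 0
repeats (true ∷ true ∷ w) = suc (repeats (true ∷ w))
repeats (false ∷ false ∷ w) = suc (repeats (false ∷ w))
repeats (true ∷ false ∷ w) = repeats (false ∷ w)
repeats (false ∷ true ∷ w) = repeats (true ∷ w)

repeats-snoc : ∀ w x → repeats w ℕ.≤ repeats (w ++ x ∷ [])
repeats-snoc [] x = ℕ.z≤n
repeats-snoc (y ∷ []) x = ℕ.z≤n
repeats-snoc (true ∷ true ∷ w) x = ℕ.s≤s (repeats-snoc (true ∷ w) x)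
repeats-snoc (false ∷ false ∷ w) x = ℕ.s≤s (repeats-snoc (false ∷ w) x)
repeats-snoc (true ∷ false ∷ w) x = repeats-snoc (false ∷ w) x
repeats-snoc (false ∷ true ∷ w) x = repeats-snoc (true ∷ w) x

-- Apart from the initial A, each A follows an A, which is a repetition, or follows a B. Without BB
-- every B is followed by an A, except possibly a final B, which the initial A compensates.
repeats≤ : ∀ w → (∀ xs ys → true ∷ w ≢ xs ++ false ∷ false ∷ ys) →
  repeats (true ∷ w) ℕ.+ countB w ℕ.≤ suc (countA w)
repeats≤ [] noBB = ℕ.z≤n
repeats≤ (true ∷ w) noBB = ℕ.s≤s (repeats≤ w λ xs ys e → noBB (true ∷ xs) ys (cong (true ∷_) e))
repeats≤ (false ∷ []) noBB = ℕ.s≤s ℕ.z≤n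
repeats≤ (false ∷ false ∷ w) noBB = contradiction refl (noBB (true ∷ []) w)
repeats≤ (false ∷ true ∷ w) noBB = subst (ℕ._≤ suc (suc (countA w)))
  (sym (ℕP.+-suc (repeats (true ∷ w)) (countB w)))
  (ℕ.s≤s (repeats≤ w λ xs ys e → noBB (true ∷ false ∷ xs) ys (cong (λ v → true ∷ false ∷ v) e)))

blocks : ℕ → List Bool
blocks zero = []
blocks (suc k) = false ∷ true ∷ blocks k

blocks-snoc : ∀ k → blocks k ++ false ∷ true ∷ [] ≡ blocks (suc k)
blocks-snoc zero = refl
blocks-snoc (suc k) = cong (λ v → false ∷ true ∷ v) (blocks-snoc k)

blocks-balanced : ∀ k → countA (blocks k) ≡ countB (blocks k)
blocks-balanced zero = refl
blocks-balanced (suc k) = cong suc (blocks-balanced k)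

module Rotations (θ : ℤ) (α β : ℕ) (β<α : β ℕ.< α) (odd : isEven (α ℕ.+ β) ≡ false) where

  record Good (w : List Bool) : Set where
    constructor good
    field
      bounded : Bounded (α ℕ.+ β) θ w
      #A : countA w ≡ α
      #B : countB w ≡ β

  rotate₁ : ∀ x w → Good (x ∷ w) → Good (w ++ x ∷ [])
  rotate₁ x w (good bd a b) = good (bounded-rotate {θ = θ} x w bd)
    (trans (countA-snoc w x) a) (trans (countB-snoc w x) b)

  rotate : ∀ xs ys → Good (xs ++ ys) → Good (ys ++ xs)
  rotate [] ys g = subst Good (sym (++-identityʳ ys)) g
  rotate (x ∷ xs) ys g = subst Good (++-assoc ys (x ∷ []) xs)
    (rotate xs (ys ++ x ∷ []) (subst Good (++-assoc xs ys (x ∷ [])) (rotate₁ x (xs ++ ys) g)))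

  ¬BB : ∀ {w} → ¬ Good (false ∷ false ∷ w)
  ¬BB {w} (good bd refl refl) with ℕP.m≤n⇒∃[o]m+o≡n β<α
  ... | c , eq = exceeds (suc (c ℕ.+ c)) (lem (countB w) c (countA w) eq) (pattern-BB θ w bd)
    where
    lem : ∀ b c a → suc (suc (suc b)) ℕ.+ c ≡ a →
      a ℕ.+ a ℕ.+ (a ℕ.+ a) ≡
      (a ℕ.+ suc (suc b)) ℕ.+ (a ℕ.+ suc (suc b)) ℕ.+ 0 ℕ.+ suc (suc (c ℕ.+ c))
    lem b c a refl = lem′ b c
      where
      lem′ : ∀ b c → let a = suc (suc (suc b)) ℕ.+ c in a ℕ.+ a ℕ.+ (a ℕ.+ a) ≡
        (a ℕ.+ suc (suc b)) ℕ.+ (a ℕ.+ suc (suc b)) ℕ.+ 0 ℕ.+ suc (suc (c ℕ.+ c))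
      lem′ = ℕR.solve-∀

  ¬B⋯B : ∀ {w} → ¬ Good (false ∷ w ++ false ∷ [])
  ¬B⋯B {w} g = ¬BB (rotate (false ∷ w) (false ∷ []) g)

  noBB : ∀ {w} → Good w → ∀ xs ys → w ≢ xs ++ false ∷ false ∷ ys
  noBB g xs ys refl = ¬BB (rotate xs (false ∷ false ∷ ys) g)

  ABA⇒α≤3β : ∀ {w} → Good (true ∷ false ∷ true ∷ w) → α ℕ.≤ β ℕ.+ β ℕ.+ β
  ABA⇒α≤3β {w} (good bd refl refl) = ℕP.≮⇒≥ λ lt → case (ℕP.m≤n⇒∃[o]m+o≡n lt)
    where
    b = countB w
    case : (∃ λ c → suc (suc b ℕ.+ suc b ℕ.+ suc b) ℕ.+ c ≡ suc (suc (countA w))) → ⊥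
    case (c , eq) = exceeds (suc (c ℕ.+ c)) (lem b c (countA w) (trans (shape b c) eq)) (pattern-ABA θ w bd)
      where
      shape : ∀ b c → suc (suc (b ℕ.+ b ℕ.+ b ℕ.+ 2 ℕ.+ c)) ≡ suc (suc b ℕ.+ suc b ℕ.+ suc b) ℕ.+ c
      shape = ℕR.solve-∀
      lem : ∀ b c a → suc (suc (b ℕ.+ b ℕ.+ b ℕ.+ 2 ℕ.+ c)) ≡ suc (suc a) →
        4 ℕ.+ (a ℕ.+ a ℕ.+ (a ℕ.+ a)) ≡
        (suc (suc a) ℕ.+ suc b) ℕ.+ (suc (suc a) ℕ.+ suc b) ℕ.+ (b ℕ.+ b ℕ.+ (b ℕ.+ b)) ℕ.+ suc (suc (c ℕ.+ c))
      lem b c a refl = lem′ b c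
        where
        lem′ : ∀ b c → let a = b ℕ.+ b ℕ.+ b ℕ.+ 2 ℕ.+ c in
          4 ℕ.+ (a ℕ.+ a ℕ.+ (a ℕ.+ a)) ≡
          (suc (suc a) ℕ.+ suc b) ℕ.+ (suc (suc a) ℕ.+ suc b) ℕ.+ (b ℕ.+ b ℕ.+ (b ℕ.+ b)) ℕ.+ suc (suc (c ℕ.+ c))
        lem′ = ℕR.solve-∀

  ¬AAA : α ℕ.≤ β ℕ.+ β ℕ.+ β → ∀ {w} → ¬ Good (true ∷ true ∷ true ∷ w)
  ¬AAA α≤3β {w} (good bd refl refl) with ℕP.m≤n⇒∃[o]m+o≡n α≤3β
  -- Equality α = 3β would make α + β = 4β even.
  ... | zero , eq = contradiction
    (trans (sym odd) (trans (cong isEven (trans (cong (ℕ._+ countB w) (trans (sym (ℕP.+-identityʳ _)) eq))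
      (lem (countB w)))) (n+n-even (countB w ℕ.+ countB w)))) λ ()
    where
    lem : ∀ b → b ℕ.+ b ℕ.+ b ℕ.+ b ≡ b ℕ.+ b ℕ.+ (b ℕ.+ b)
    lem = ℕR.solve-∀
  ... | suc c , eq = exceeds (suc (c ℕ.+ c)) (lem (countB w) c (countA w) eq) (pattern-AAA θ w bd)
    where
    lem : ∀ b c a → suc (suc (suc a)) ℕ.+ suc c ≡ b ℕ.+ b ℕ.+ b →
      b ℕ.+ b ℕ.+ (b ℕ.+ b) ℕ.+ (b ℕ.+ b ℕ.+ (b ℕ.+ b)) ≡
      (suc (suc (suc a)) ℕ.+ b) ℕ.+ (suc (suc (suc a)) ℕ.+ b) ℕ.+ 0 ℕ.+ suc (suc (c ℕ.+ c))
    lem b c a eq = trans (split b) (trans (cong₂ (λ u v → u ℕ.+ v ℕ.+ (b ℕ.+ b)) (sym eq) (sym eq)) (lem′ b c a))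
      where
      split : ∀ b → b ℕ.+ b ℕ.+ (b ℕ.+ b) ℕ.+ (b ℕ.+ b ℕ.+ (b ℕ.+ b)) ≡ (b ℕ.+ b ℕ.+ b) ℕ.+ (b ℕ.+ b ℕ.+ b) ℕ.+ (b ℕ.+ b)
      split = ℕR.solve-∀
      lem′ : ∀ b c a → suc (suc (suc a)) ℕ.+ suc c ℕ.+ (suc (suc (suc a)) ℕ.+ suc c) ℕ.+ (b ℕ.+ b) ≡
        (suc (suc (suc a)) ℕ.+ b) ℕ.+ (suc (suc (suc a)) ℕ.+ b) ℕ.+ 0 ℕ.+ suc (suc (c ℕ.+ c))
      lem′ = ℕR.solve-∀

  ¬ABAABA : 3 ℕ.+ β ℕ.≤ α → ∀ {w} → ¬ Good (true ∷ false ∷ true ∷ true ∷ false ∷ true ∷ w)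
  ¬ABAABA 3+β≤α {w} (good bd refl refl) with ℕP.m≤n⇒∃[o]m+o≡n 3+β≤α
  ... | c , eq = exceeds (suc (c ℕ.+ c ℕ.+ (c ℕ.+ c) ℕ.+ (c ℕ.+ c))) (lem (countB w) c (countA w) eq) (pattern-ABAABA θ w bd)
    where
    lem : ∀ b c a → 3 ℕ.+ (2 ℕ.+ b) ℕ.+ c ≡ 4 ℕ.+ a →
      8 ℕ.+ (a ℕ.+ a ℕ.+ (a ℕ.+ a) ℕ.+ (a ℕ.+ a ℕ.+ (a ℕ.+ a))) ≡
      (4 ℕ.+ a ℕ.+ (2 ℕ.+ b)) ℕ.+ (4 ℕ.+ a ℕ.+ (2 ℕ.+ b)) ℕ.+ (b ℕ.+ b ℕ.+ (b ℕ.+ b))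
        ℕ.+ suc (suc (c ℕ.+ c ℕ.+ (c ℕ.+ c) ℕ.+ (c ℕ.+ c)))
    lem b c a refl = lem′ b c
      where
      lem′ : ∀ b c → let a = 1 ℕ.+ b ℕ.+ c in
        8 ℕ.+ (a ℕ.+ a ℕ.+ (a ℕ.+ a) ℕ.+ (a ℕ.+ a ℕ.+ (a ℕ.+ a))) ≡
        (4 ℕ.+ a ℕ.+ (2 ℕ.+ b)) ℕ.+ (4 ℕ.+ a ℕ.+ (2 ℕ.+ b)) ℕ.+ (b ℕ.+ b ℕ.+ (b ℕ.+ b))
          ℕ.+ suc (suc (c ℕ.+ c ℕ.+ (c ℕ.+ c) ℕ.+ (c ℕ.+ c)))
      lem′ = ℕR.solve-∀

  -- A good word starting with B is a cyclic product of blocks BA and BAA, and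
  -- there are α ∸ β of the latter.
  module _ (3+β≤α : 3 ℕ.+ β ℕ.≤ α) (α≤3β : α ℕ.≤ β ℕ.+ β ℕ.+ β) where

    -- Cyclically BAA must be preceded by A and followed by BA, as BB and AAA are excluded; this
    -- completes ABAABA. Words too short for that have too few A for `3+β≤α`.
    ¬BAA : ∀ u → ¬ Good (false ∷ true ∷ true ∷ u)
    ¬BAA [] (good _ refl refl) = contradiction 3+β≤α λ { (ℕ.s≤s (ℕ.s≤s ())) }
    ¬BAA (true ∷ u) g = ¬AAA α≤3β (rotate₁ false _ g)
    ¬BAA (false ∷ []) g = ¬B⋯B {true ∷ true ∷ []} g
    ¬BAA (false ∷ false ∷ u) g = noBB g (false ∷ true ∷ true ∷ []) u refl
    ¬BAA (false ∷ true ∷ u) g with initLast u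
    ... | [] = impossible g
      where
      impossible : ¬ Good (false ∷ true ∷ true ∷ false ∷ true ∷ [])
      impossible (good _ refl refl) = contradiction 3+β≤α λ { (ℕ.s≤s (ℕ.s≤s (ℕ.s≤s ()))) }
    ... | u′ ∷ʳ′ false = ¬B⋯B {true ∷ true ∷ false ∷ true ∷ u′} g
    ... | u′ ∷ʳ′ true = ¬ABAABA 3+β≤α (rotate (false ∷ true ∷ true ∷ false ∷ true ∷ u′) (true ∷ []) g)

    -- Leading blocks BA are rotated to the end, where `blocks k` collects them. As BAA never
    -- appears, all of the word is used up and the counts balance, against `β<α`.
    scan : ∀ v k → ¬ Good (false ∷ true ∷ v ++ blocks k)
    scan [] k (good _ refl refl) = ℕP.<⇒≢ β<α (cong suc (sym (blocks-balanced k)))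
    scan (true ∷ v) k g = ¬BAA (v ++ blocks k) g
    scan (false ∷ []) zero g = ¬B⋯B {true ∷ []} g
    scan (false ∷ []) (suc k) g = noBB g (false ∷ true ∷ []) (true ∷ blocks k) refl
    scan (false ∷ false ∷ v) k g = noBB g (false ∷ true ∷ []) (v ++ blocks k) refl
    scan (false ∷ true ∷ v) k g = scan v (suc k) (subst (λ u → Good (false ∷ true ∷ u))
      (trans (++-assoc v (blocks k) (false ∷ true ∷ [])) (cong (v ++_) (blocks-snoc k)))
      (rotate (false ∷ true ∷ []) (false ∷ true ∷ v ++ blocks k) g))

  ¬good-B : 3 ℕ.+ β ℕ.≤ α → ∀ w → ¬ Good (false ∷ w)
  ¬good-B _ [] (good _ refl refl) = contradiction β<α λ ()
  ¬good-B _ (false ∷ w) g = ¬BB g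
  ¬good-B 3+β≤α (true ∷ w) g = scan 3+β≤α α≤3β w zero (subst (λ v → Good (false ∷ true ∷ v)) (sym (++-identityʳ w)) g)
    where
    α≤3β : α ℕ.≤ β ℕ.+ β ℕ.+ β
    -- The initial B has an A on both sides cyclically, so rotating the last letter to the front
    -- exhibits ABA.
    α≤3β with initLast w
    ... | [] = impossible g
      where
      impossible : Good (false ∷ true ∷ []) → α ℕ.≤ β ℕ.+ β ℕ.+ β
      impossible (good _ refl refl) = ℕ.s≤s ℕ.z≤n
    ... | w′ ∷ʳ′ false = ⊥-elim (¬B⋯B {true ∷ w′} g)
    ... | w′ ∷ʳ′ true = ABA⇒α≤3β (rotate (false ∷ true ∷ w′) (true ∷ []) g)

  -- Reduces to words starting with A: an initial B is followed by A, hence belongs to no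
  -- repetition, and rotating it to the end loses none.
  repeats-bound : ∀ w → Good w → repeats w ℕ.+ β ℕ.≤ α
  repeats-bound [] (good _ refl refl) = ℕ.z≤n
  repeats-bound (true ∷ w) g@(good _ refl refl) = repeats≤ w (noBB g)
  repeats-bound (false ∷ []) (good _ refl refl) = ⊥-elim (contradiction β<α λ ())
  repeats-bound (false ∷ false ∷ w) g = ⊥-elim (¬BB g)
  repeats-bound (false ∷ true ∷ w) g = ℕP.≤-trans
    (ℕP.+-monoˡ-≤ β (repeats-snoc (true ∷ w) false))
    (subst₂ (λ b a → repeats (true ∷ w ++ false ∷ []) ℕ.+ b ℕ.≤ a) (Good.#B g′) (Good.#A g′)
      (repeats≤ (w ++ false ∷ []) (noBB g′)))
    where
    g′ : Good (true ∷ w ++ false ∷ [])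
    g′ = rotate₁ false (true ∷ w) g

  -- Two repetitions give α ≥ β + 2, and oddness of α + β excludes equality. Rotating some B to the
  -- front then leads to `¬good-B`.
  ¬good : ∀ w → 2 ℕ.≤ repeats w → 1 ℕ.≤ countB w → ¬ Good w
  ¬good w 2≤r 1≤b g with split w 1≤b
    where
    split : ∀ w → 1 ℕ.≤ countB w → Σ (List Bool) λ xs → Σ (List Bool) λ ys → w ≡ xs ++ false ∷ ys
    split (true ∷ w) 1≤b with split w 1≤b
    ... | xs , ys , refl = true ∷ xs , ys , refl
    split (false ∷ w) _ = [] , w , refl
  ... | xs , ys , refl = ¬good-B 3+β≤α (ys ++ xs) (rotate xs (false ∷ ys) g)
    where
    2+β≤α : 2 ℕ.+ β ℕ.≤ α
    2+β≤α = ℕP.≤-trans (ℕP.+-monoˡ-≤ β 2≤r) (repeats-bound w g)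
    lem : ∀ b → 2 ℕ.+ b ℕ.+ b ≡ suc b ℕ.+ suc b
    lem = ℕR.solve-∀
    3+β≤α : 3 ℕ.+ β ℕ.≤ α
    3+β≤α = ℕP.≤∧≢⇒< 2+β≤α λ eq → contradiction
      (trans (sym odd) (trans (cong isEven (trans (cong (ℕ._+ β) (sym eq)) (lem β))) (n+n-even (suc β)))) λ ()

-- Exchange of the two letters by reflection.

conj : V → V
conj (a , x) = a , - x

ΣV-conj : ∀ p → ΣV (map conj p) ≡ conj (ΣV p)
ΣV-conj [] = refl
ΣV-conj ((a , x) ∷ p) rewrite ΣV-conj p = cong₂ _,_ refl (sym (ℤP.neg-distrib-+ x _))

area-conj : ∀ p → area (map conj p) ≡ - area p
area-conj [] = refl
area-conj ((a , x) ∷ p) rewrite ΣV-conj p | area-conj p = lem a x _ _ _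
  where
  lem : ∀ a x s r P → a * - r - - x * s + - P ≡ - (a * r - x * s + P)
  lem = solve-∀

selection-not : ∀ {s e} w {p} → Selection s e (map not w) p → Selection s e w (map conj p)
selection-not [] done = done
selection-not {s} (q ∷ w) (keep {p = p} sel) =
  subst (λ v → Selection s _ (q ∷ w) (v ∷ map conj p)) (eq s q) (keep (selection-not w sel))
  where
  eq : ∀ s q → step s q ≡ conj (step s (not q))
  eq true true = refl
  eq true false = refl
  eq false true = refl
  eq false false = refl
selection-not (q ∷ w) (drop sel) = drop (selection-not w sel)

-- Exchanging A and B reflects the path and so negates its area; with `θ` negated too, every
-- Pfaffian merely changes sign. This allows assuming that A is the more frequent letter.
bounded-not : ∀ {m} θ w → Bounded m θ w → Bounded m (- θ) (map not w)
bounded-not {m} θ w bd s p sel = subst (ℕ._≤ m)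
  (trans (sym (ℤP.∣-i∣≡∣i∣ (θ + area (map conj p)))) (cong ℤ.∣_∣ (trans (ℤP.neg-distrib-+ θ _)
    (cong (_+_ (- θ)) (trans (cong -_ (area-conj p)) (ℤP.neg-involutive (area p)))))))
  (bd s (map conj p) (selection-not w sel))

countA-not : ∀ w → countA (map not w) ≡ countB w
countA-not [] = refl
countA-not (true ∷ w) = countA-not w
countA-not (false ∷ w) = cong suc (countA-not w)

countB-not : ∀ w → countB (map not w) ≡ countA w
countB-not [] = refl
countB-not (true ∷ w) = cong suc (countB-not w)
countB-not (false ∷ w) = countB-not w

repeats-not : ∀ w → repeats (map not w) ≡ repeats w
repeats-not [] = refl
repeats-not (x ∷ []) = refl
repeats-not (true ∷ true ∷ w) = cong suc (repeats-not (true ∷ w))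
repeats-not (false ∷ false ∷ w) = cong suc (repeats-not (false ∷ w))
repeats-not (true ∷ false ∷ w) = repeats-not (false ∷ w)
repeats-not (false ∷ true ∷ w) = repeats-not (true ∷ w)

length-count : ∀ w → length w ≡ countA w ℕ.+ countB w
length-count [] = refl
length-count (true ∷ w) = cong suc (length-count w)
length-count (false ∷ w) = trans (cong suc (length-count w)) (sym (ℕP.+-suc (countA w) (countB w)))

bounded⇒few-repeats : ∀ θ w → isEven (length w) ≡ false → Bounded (length w) θ w →
  1 ℕ.≤ countA w → 1 ℕ.≤ countB w → ¬ 2 ℕ.≤ repeats w
bounded⇒few-repeats θ w odd bd 1≤a 1≤b 2≤r with ℕP.<-cmp (countB w) (countA w)
... | tri< b<a _ _ = ¬good w 2≤r 1≤b (good (subst (λ m → Bounded m θ w) (length-count w) bd) refl refl)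
  where open Rotations θ (countA w) (countB w) b<a (trans (cong isEven (sym (length-count w))) odd)
... | tri≈ _ b≡a _ = contradiction (trans (sym odd) (trans (cong isEven
        (trans (length-count w) (cong (ℕ._+ countB w) (sym b≡a)))) (n+n-even (countB w)))) λ ()
... | tri> _ _ a<b = ¬good (map not w) (subst (2 ℕ.≤_) (sym (repeats-not w)) 2≤r)
        (subst (1 ℕ.≤_) (sym (countB-not w)) 1≤a)
        (good (subst (λ m → Bounded m (- θ) (map not w)) len (bounded-not θ w bd)) (countA-not w) (countB-not w))
  where
  len : length w ≡ countB w ℕ.+ countA w
  len = trans (length-count w) (ℕP.+-comm (countA w) (countB w))
  open Rotations (- θ) (countB w) (countA w) a<b (trans (cong isEven (sym len)) odd)

-- Determinants of tournaments that are transitive up to one vertex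

alternating-cong : ∀ k t {a a′ x x′ : Fin k → ℤ} → (∀ j → a j ≡ a′ j) → (∀ j → x j ≡ x′ j) →
  alternating k t a x ≡ alternating k t a′ x′
alternating-cong zero t a≗ x≗ = refl
alternating-cong (suc k) t a≗ x≗ = cong₂ _∷_ (cong₂ (λ a x → t * a , t * x) (a≗ zero) (x≗ zero))
  (alternating-cong k (- t) (λ j → a≗ (suc j)) (λ j → x≗ (suc j)))

private
  ones : ∀ k → Fin k → ℤ
  ones k _ = + 1

  ΣV-ones : ∀ t a → proj₂ (ΣV (alternating (double t) (+ 1) a (ones _))) ≡ + 0
  ΣV-ones zero a = refl
  ΣV-ones (suc t) a rewrite ΣV-ones t (tail₂ a) = refl

  -- The second coordinates cancel in pairs, so a pair of steps sees only the first coordinate of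
  -- the tail, and these contributions cancel as well. Only the cross product within the pair is
  -- left.
  area-ones : ∀ t a → area (alternating (double (suc t)) (+ 1) a (ones _)) ≡
    a (suc zero) - a zero + area (alternating (double t) (+ 1) (tail₂ a) (ones _))
  area-ones t a = trans (cong (λ r → + 1 * a zero * (- + 1 * + 1 + r) - + 1 * + 1 * (- + 1 * a (suc zero) + s)
      + (- + 1 * a (suc zero) * r - - + 1 * + 1 * s + P)) (ΣV-ones t (tail₂ a)))
    (lem (a zero) (a (suc zero)) s P)
    where
    s = proj₁ (ΣV (alternating (double t) (+ 1) (tail₂ a) (ones _)))
    P = area (alternating (double t) (+ 1) (tail₂ a) (ones _))
    lem : ∀ a b s P → + 1 * a * (- + 1 * + 1 + + 0) - + 1 * + 1 * (- + 1 * b + s)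
      + (- + 1 * b * + 0 - - + 1 * + 1 * s + P) ≡ b - a + P
    lem = solve-∀

area-ones-≤ : ∀ t a → (∀ j → ℤ.∣ a j ∣ ≡ 1) → ℤ.∣ area (alternating (double t) (+ 1) a (ones _)) ∣ ℕ.≤ double t
area-ones-≤ zero a ∣a∣ = ℕ.z≤n
area-ones-≤ (suc t) a ∣a∣ = subst (ℕ._≤ double (suc t)) (sym (cong ℤ.∣_∣ (area-ones t a)))
  (ℕP.≤-trans (ℤP.∣i+j∣≤∣i∣+∣j∣ (a (suc zero) - a zero) _)
    (ℕP.+-mono-≤ {v = double t} (ℕP.≤-trans (ℤP.∣i-j∣≤∣i∣+∣j∣ (a (suc zero)) (a zero))
        (ℕP.≤-reflexive (cong₂ ℕ._+_ (∣a∣ (suc zero)) (∣a∣ zero))))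
      (area-ones-≤ t (tail₂ a) (λ j → ∣a∣ (suc (suc j))))))

-- Alternating entries make every pair contribute -2, the extreme value; this is why the arcs at
-- `v_n` alternate in `L n`.
area-ones-≡ : ∀ t a → (∀ j → a j ≡ sgᶠ j) → area (alternating (double t) (+ 1) a (ones _)) ≡ - + double t
area-ones-≡ zero a e = refl
area-ones-≡ (suc t) a e = trans (area-ones t a) (trans
  (cong₂ _+_ (cong₂ _-_ (e (suc zero)) (e zero))
    (area-ones-≡ t (tail₂ a) λ j → trans (e (suc (suc j))) (cong sg (not-involutive (isEven (toℕ j))))))
  (lem (+ double t)))
  where
  lem : ∀ d → - + 1 - + 1 + - d ≡ - (+ 2 + d)
  lem = solve-∀

∣sg∣ : ∀ b → ℤ.∣ sg b ∣ ≡ 1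
∣sg∣ true = refl
∣sg∣ false = refl

square-abs : ∀ i → i * i ≡ + (ℤ.∣ i ∣ ℕ.* ℤ.∣ i ∣)
square-abs i = trans (sym (ℤP.0≤i⇒+∣i∣≡i (nonneg i))) (cong +_ (ℤP.abs-* i i))
  where
  nonneg : ∀ i → + 0 ℤ.≤ i * i
  nonneg (+ zero) = ℤP.≤-refl
  nonneg (+ suc n) = ℤ.+≤+ ℕ.z≤n
  nonneg (ℤ.-[1+ n ]) = ℤ.+≤+ ℕ.z≤n

square-≤ : ∀ i {m} → ℤ.∣ i ∣ ℕ.≤ m → i * i ℤ.≤ + (m ℕ.* m)
square-≤ i le = subst (ℤ._≤ _) (sym (square-abs i)) (ℤ.+≤+ (ℕP.*-mono-≤ le le))

square-≤⁻¹ : ∀ i {m} → i * i ℤ.≤ + (m ℕ.* m) → ℤ.∣ i ∣ ℕ.≤ m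
square-≤⁻¹ i {m} le = ℕP.≮⇒≥ λ m<i → ℕP.<⇒≱ (ℕP.*-mono-< m<i m<i)
  (ℤP.drop‿+≤+ (subst (ℤ._≤ _) (square-abs i) le))

-- The first transitive vertex takes the place of `u`: its row is constantly 1 on the other
-- transitive ones.
detT-transitiveButLast : ∀ t (S : Digraph (suc (suc (double t)))) → IsTournament S → TransitiveButLast S →
  let P = sg (S zero (fromℕ _)) + area (alternating (double t) (+ 1) (toLast (induced S suc)) (ones _)) in
  detT S ≡ P * P
detT-transitiveButLast t S tour tr = trans (det-cong (skew-border S tour)) (trans
  (det-border-skew t (induced S suc) (induced-tournament tour FP.suc-injective)
    (λ a b a<b b<k → tr (suc a) (suc b) (ℕ.s≤s a<b) (ℕ.s≤s b<k)) (λ b → sg (S zero (suc b))))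
  (cong (λ p → (sg (S zero (fromℕ _)) + area p) * (sg (S zero (fromℕ _)) + area p))
    (alternating-cong (double t) (+ 1) (λ _ → refl) (λ j → cong sg (tr zero (suc (inject₁ j)) (ℕ.s≤s ℕ.z≤n)
      (ℕ.s≤s (subst (ℕ._< double t) (sym (FP.toℕ-inject₁ j)) (FP.toℕ<n j))))))))

data Parity : ℕ → Set where
  even : ∀ t → Parity (double t)
  odd : ∀ t → Parity (suc (double t))

parity : ∀ n → Parity n
parity zero = even zero
parity (suc n) with parity n
... | even t = odd t
... | odd t = even (suc t)

double-even : ∀ t → isEven (double t) ≡ true
double-even zero = refl
double-even (suc t) = trans (not-involutive _) (double-even t)

det-border-skew-even : ∀ {k} → isEven k ≡ true → (S : Digraph (suc k)) → IsTournament S → TransitiveButLast S →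
  ∀ x → det (border x (skew S)) ≡ pf S x * pf S x
det-border-skew-even {k} e with parity k
... | even t = det-border-skew t
... | odd t = contradiction (trans (sym e) (cong not (double-even t))) λ ()

detT-odd : ∀ t (S : Digraph (suc (double t))) → IsTournament S → detT S ≡ + 0
detT-odd t S tour = det-odd-skew (skew S) (cong not (double-even t)) (skew-anti S tour)

-- For odd `k` the entry between first and last vertex contributes at most 1, and so does each of
-- the other `k ∸ 1` transitive vertices. For even `k` the order is odd and the determinant
-- vanishes.
detT-transitiveButLast-≤ : ∀ k (S : Digraph (suc k)) → IsTournament S → TransitiveButLast S →
  detT S ℤ.≤ + (suc (k ∸ 1) ℕ.* suc (k ∸ 1))
detT-transitiveButLast-≤ k S tour tr with parity k
... | even t = subst (ℤ._≤ _) (sym (detT-odd t S tour)) (ℤ.+≤+ ℕ.z≤n)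
... | odd t = subst (ℤ._≤ _) (sym (detT-transitiveButLast t S tour tr)) (square-≤ (θ + A)
  (ℕP.≤-trans (ℤP.∣i+j∣≤∣i∣+∣j∣ θ A) (ℕP.+-mono-≤ (ℕP.≤-reflexive (∣sg∣ (S zero (fromℕ (suc (double t))))))
    (area-ones-≤ t (toLast (induced S suc)) (λ j → ∣sg∣ (S (suc (inject₁ j)) (fromℕ (suc (double t)))))))))
  where
  θ = sg (S zero (fromℕ (suc (double t))))
  A = area (alternating (double t) (+ 1) (toLast (induced S suc)) (ones (double t)))

toFront-injective : ∀ {n} (p : Fin (suc n)) → Injective _≡_ _≡_ (toFront p)
toFront-injective p {zero} {zero} _ = refl
toFront-injective p {zero} {suc b} e = contradiction (sym e) (FP.punchInᵢ≢i p b)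
toFront-injective p {suc a} {zero} e = contradiction e (FP.punchInᵢ≢i p a)
toFront-injective p {suc a} {suc b} e = cong suc (FP.punchIn-injective p a b e)

lift-injective : ∀ {n} {π : Fin n → Fin n} → Injective _≡_ _≡_ π → Injective _≡_ _≡_ (lift π)
lift-injective inj {zero} {zero} _ = refl
lift-injective inj {suc a} {suc b} e = cong suc (inj (FP.suc-injective e))

argmin : ∀ {k} (g : Fin (suc k) → ℕ) → Σ (Fin (suc k)) λ p → ∀ a → g p ℕ.≤ g a
argmin {zero} g = zero , λ { zero → ℕP.≤-refl }
argmin {suc k} g with argmin (g ∘ suc)
... | p , min with g zero ℕ.≤? g (suc p)
...   | yes le = zero , λ { zero → ℕP.≤-refl ; (suc a) → ℕP.≤-trans le (min a) }
...   | no nle = suc p , λ { zero → ℕP.<⇒≤ (ℕP.≰⇒> nle) ; (suc a) → min a }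

-- Selection sort that carries a `Signed` witness, so that an arbitrary injection may be replaced by
-- an increasing one without changing the determinant.
sort : ∀ {k} (g : Fin k → ℕ) → Injective _≡_ _≡_ g → Σ (Fin k → Fin k) λ π →
  Signed π × Injective _≡_ _≡_ π × (∀ a b → toℕ a ℕ.< toℕ b → g (π a) ℕ.< g (π b))
sort {zero} g inj = id , signed-id , id , λ ()
sort {suc k} g inj with argmin g
... | p , min with sort (g ∘ punchIn p) (FP.punchIn-injective p _ _ ∘ inj)
...   | π , S , π-inj , inc = toFront p ∘ lift π , signed-∘ (signed-toFront p) (signed-lift S) ,
        (λ e → lift-injective π-inj (toFront-injective p e)) , inc′
  where
  inc′ : ∀ a b → toℕ a ℕ.< toℕ b → g (toFront p (lift π a)) ℕ.< g (toFront p (lift π b))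
  inc′ zero (suc b) _ = ℕP.≤∧≢⇒< (min _) λ e → FP.punchInᵢ≢i p (π b) (sym (inj e))
  inc′ (suc a) (suc b) (ℕ.s≤s a<b) = inc a b a<b

-- The tournaments L n

≡ᵇ-false : ∀ {x y} → x ≢ y → (x ≡ᵇ y) ≡ false
≡ᵇ-false {zero} {zero} 0≢0 = contradiction refl 0≢0
≡ᵇ-false {zero} {suc y} _ = refl
≡ᵇ-false {suc x} {zero} _ = refl
≡ᵇ-false {suc x} {suc y} x≢y = ≡ᵇ-false (x≢y ∘ cong suc)

≡ᵇ-refl : ∀ x → (x ≡ᵇ x) ≡ true
≡ᵇ-refl zero = refl
≡ᵇ-refl (suc x) = ≡ᵇ-refl x

<ᵇ-true : ∀ {x y} → x ℕ.< y → (x <ᵇ y) ≡ true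
<ᵇ-true {zero} {suc y} _ = refl
<ᵇ-true {suc x} {suc y} (ℕ.s≤s lt) = <ᵇ-true lt

<ᵇ-false : ∀ {x y} → y ℕ.≤ x → (x <ᵇ y) ≡ false
<ᵇ-false {zero} {zero} _ = refl
<ᵇ-false {suc x} {zero} _ = refl
<ᵇ-false {suc x} {suc y} (ℕ.s≤s le) = <ᵇ-false le

module _ {m : ℕ} (a b : Fin (suc m)) where
  L-low : toℕ a ℕ.< m → toℕ b ℕ.< m → L (suc m) a b ≡ (toℕ a <ᵇ toℕ b)
  L-low a<m b<m rewrite ≡ᵇ-false (ℕP.<⇒≢ a<m) | ≡ᵇ-false (ℕP.<⇒≢ b<m) = refl

  L-last-row : toℕ a ≡ m → toℕ b ℕ.< m → L (suc m) a b ≡ isEven (toℕ b)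
  L-last-row a≡m b<m rewrite a≡m | ≡ᵇ-refl m | ≡ᵇ-false (ℕP.<⇒≢ b<m) = refl

  L-last-column : toℕ a ℕ.< m → toℕ b ≡ m → L (suc m) a b ≡ not (isEven (toℕ a))
  L-last-column a<m b≡m rewrite b≡m | ≡ᵇ-refl m | ≡ᵇ-false (ℕP.<⇒≢ a<m) = refl

<m⊎≡m : ∀ {m} (a : Fin (suc m)) → toℕ a ℕ.< m ⊎ toℕ a ≡ m
<m⊎≡m a = ℕP.m≤n⇒m<n∨m≡n (ℕP.≤-pred (FP.toℕ<n a))

L-tournament : ∀ m → IsTournament (L (suc m))
L-tournament m i j i≢j with <m⊎≡m i | <m⊎≡m j
... | inj₁ i<m | inj₂ j≡m = trans (L-last-row j i j≡m i<m)
  (sym (trans (cong not (L-last-column i j i<m j≡m)) (not-involutive _)))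
... | inj₂ i≡m | inj₁ j<m = trans (L-last-column j i j<m i≡m) (cong not (sym (L-last-row i j i≡m j<m)))
... | inj₂ i≡m | inj₂ j≡m = contradiction (FP.toℕ-injective (trans i≡m (sym j≡m))) i≢j
... | inj₁ i<m | inj₁ j<m with ℕP.<-cmp (toℕ i) (toℕ j)
...   | tri< i<j _ _ = trans (L-low j i j<m i<m) (trans (<ᵇ-false (ℕP.<⇒≤ i<j))
          (sym (cong not (trans (L-low i j i<m j<m) (<ᵇ-true i<j)))))
...   | tri≈ _ i≡j _ = contradiction (FP.toℕ-injective i≡j) i≢j
...   | tri> _ _ j<i = trans (L-low j i j<m i<m) (trans (<ᵇ-true j<i)
          (sym (cong not (trans (L-low i j i<m j<m) (<ᵇ-false (ℕP.<⇒≤ j<i))))))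

-- An index below `k` has a larger one above it, so its image is not the last vertex of `L`. If that
-- vertex is missed altogether, the subtournament is simply transitive.
L-increasing : ∀ {k m} (f : Fin (suc k) → Fin (suc m)) → (∀ a b → toℕ a ℕ.< toℕ b → toℕ (f a) ℕ.< toℕ (f b)) →
  TransitiveButLast (induced (L (suc m)) f)
L-increasing {k} {m} f inc a b a<b b<k = trans
  (L-low (f a) (f b) (ℕP.<-trans (inc a b a<b) fb<m) fb<m) (<ᵇ-true (inc a b a<b))
  where
  fb<m : toℕ (f b) ℕ.< m
  fb<m = ℕP.<-≤-trans (inc b (fromℕ k) (subst (toℕ b ℕ.<_) (sym (FP.toℕ-fromℕ k)) b<k))
    (ℕP.≤-pred (FP.toℕ<n (f (fromℕ k))))

-- The bound is in terms of the order `k` of the subtournament; besides the global bound, the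
-- blowups need its sharper value at order n - 2.
detT-L-≤ : ∀ {k m} (f : Fin k → Fin (suc m)) → Injective _≡_ _≡_ f →
  detT (induced (L (suc m)) f) ℤ.≤ + (suc (k ∸ 2) ℕ.* suc (k ∸ 2))
detT-L-≤ {zero} f f-inj = ℤP.≤-refl
detT-L-≤ {suc k} {m} f f-inj with sort (toℕ ∘ f) (f-inj ∘ FP.toℕ-injective)
... | π , S , π-inj , inc = subst (ℤ._≤ _) (detT-permute S π-inj (induced (L (suc m)) f))
  (detT-transitiveButLast-≤ k _ (induced-tournament (L-tournament m) (π-inj ∘ f-inj)) (L-increasing (f ∘ π) inc))

detT-L : ∀ t → let m = suc (double t) in detT (L (suc m)) ≡ + (m ℕ.* m)
detT-L t = trans (detT-transitiveButLast t (L (suc m)) (L-tournament m) (L-increasing id λ _ _ → id)) (trans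
  (cong (λ P → P * P) (trans (cong₂ _+_ (cong sg (L-last-column zero (fromℕ m) (ℕ.s≤s ℕ.z≤n) (FP.toℕ-fromℕ m)))
      (area-ones-≡ t _ λ j → cong sg (entry j)))
    (lem (+ double t))))
  (trans (lem₂ (+ m)) (sym (ℤP.pos-* m m))))
  where
  m = suc (double t)
  entry : ∀ j → L (suc m) (suc (inject₁ j)) (fromℕ m) ≡ isEven (toℕ j)
  entry j = trans (L-last-column (suc (inject₁ j)) (fromℕ m)
      (ℕ.s≤s (subst (ℕ._< double t) (sym (FP.toℕ-inject₁ j)) (FP.toℕ<n j))) (FP.toℕ-fromℕ m))
    (trans (not-involutive _) (cong isEven (FP.toℕ-inject₁ j)))
  lem : ∀ d → - + 1 + - d ≡ - (+ 1 + d)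
  lem = solve-∀
  lem₂ : ∀ d → - d * - d ≡ d * d
  lem₂ = solve-∀

-- Extensions of L n

extend-tournament : ∀ {n} {T : Digraph n} → IsTournament T → ∀ σ → IsTournament (extend T σ)
extend-tournament tour σ zero zero 0≢0 = contradiction refl 0≢0
extend-tournament tour σ zero (suc j) _ = refl
extend-tournament tour σ (suc i) zero _ = sym (not-involutive (σ i))
extend-tournament tour σ (suc i) (suc j) i≢j = tour i j (i≢j ∘ cong suc)

CR-of-parallel : ∀ {n} {T : Digraph n} {σ} w β → (∀ v → v ≢ w → σ v ≡ β xor T w v) →
  CRAssoc (extend T σ) zero (suc w)
CR-of-parallel w false par = inj₁ λ
  { zero 0≢0 _ → contradiction refl 0≢0
  ; (suc v) _ v≢w → par v (v≢w ∘ cong suc) }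
CR-of-parallel w true par = inj₂ λ
  { zero 0≢0 _ → contradiction refl 0≢0
  ; (suc v) _ v≢w → par v (v≢w ∘ cong suc) }

DetBounded : ℕ → ∀ {n} → Digraph n → Set
DetBounded c {n} T = ∀ k (f : Fin k → Fin n) → Injective _≡_ _≡_ f → detT (induced T f) ℤ.≤ + c

-- Reversing all steps leaves every cross product unchanged.
area-alternating-neg : ∀ k t a x → area (alternating k (- t) a x) ≡ area (alternating k t a x)
area-alternating-neg k t a x = proj₂ (both k t a x)
  where
  both : ∀ k t a x →
    ΣV (alternating k (- t) a x) ≡ (- proj₁ (ΣV (alternating k t a x)) , - proj₂ (ΣV (alternating k t a x)))
    × area (alternating k (- t) a x) ≡ area (alternating k t a x)
  both zero t a x = refl , refl
  both (suc k) t a x with both k (- t) (a ∘ suc) (x ∘ suc)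
  ... | eΣ , eA = trans (cong ((- t * a zero , - t * x zero) ⊕_) eΣ) (cong₂ _,_ (lem₁ t (a zero) _) (lem₁ t (x zero) _)) ,
    trans (cong₂ (λ S A → (- t * a zero , - t * x zero) ⨯ S + A) eΣ eA) (lem₂ t (a zero) (x zero) _ _ _)
    where
    lem₁ : ∀ t a s → - t * a + - s ≡ - (t * a + s)
    lem₁ = solve-∀
    lem₂ : ∀ t a x s r P → - t * a * - r - - t * x * - s + P ≡ t * a * r - t * x * s + P
    lem₂ = solve-∀

-- Indices beyond `m` give the last vertex; totality lets words and chains be indexed by plain
-- naturals.
at : ∀ {m} → ℕ → Fin (suc m)
at zero = zero
at {zero} (suc j) = zero
at {suc m} (suc j) = suc (at j)

toℕ-at : ∀ {m j} → j ℕ.≤ m → toℕ (at {m} j) ≡ j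
toℕ-at {m} {zero} _ = refl
toℕ-at {suc m} {suc j} (ℕ.s≤s le) = cong suc (toℕ-at le)

at-toℕ : ∀ {m} (a : Fin (suc m)) → at (toℕ a) ≡ a
at-toℕ {m} a = FP.toℕ-injective (toℕ-at (ℕP.≤-pred (FP.toℕ<n a)))

-- With `g` the row of `u`, the letter is A when the arc from `u` to `i` and the arc from `i` to the
-- last vertex have the same sign, since `not (isEven i)` is the latter.
word : (ℕ → Bool) → ℕ → ℕ → List Bool
word g i zero = []
word g i (suc k) = (g i xor isEven i) ∷ word g (suc i) k

length-word : ∀ g i k → length (word g i k) ≡ k
length-word g i zero = refl
length-word g i (suc k) = cong suc (length-word g (suc i) k)

increasing⇒injective : ∀ {m k} {f : Fin k → Fin m} → (∀ a b → toℕ a ℕ.< toℕ b → toℕ (f a) ℕ.< toℕ (f b)) →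
  Injective _≡_ _≡_ f
increasing⇒injective {f = f} inc {a} {b} e with ℕP.<-cmp (toℕ a) (toℕ b)
... | tri< a<b _ _ = contradiction (cong toℕ e) (ℕP.<⇒≢ (inc a b a<b))
... | tri≈ _ a≡b _ = FP.toℕ-injective a≡b
... | tri> _ _ b<a = contradiction (cong toℕ (sym e)) (ℕP.<⇒≢ (inc b a b<a))

withApex : ∀ {m k} → (Fin k → Fin m) → Fin (suc k) → Fin (suc m)
withApex f zero = zero
withApex f (suc a) = suc (f a)

withApex-injective : ∀ {m k} {f : Fin k → Fin m} → Injective _≡_ _≡_ f → Injective _≡_ _≡_ (withApex f)
withApex-injective inj {zero} {zero} _ = refl
withApex-injective inj {suc a} {suc b} e = cong suc (inj (FP.suc-injective e))

module _ {m : ℕ} (σ : Fin (suc m) → Bool) where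

  -- The vertices f kept by a selection, followed by the last vertex of L.
  record Chain (i : ℕ) (s e : Bool) (p : List V) : Set where
    field
      k : ℕ
      f : Fin (suc k) → Fin (suc m)
      last : toℕ (f (fromℕ k)) ≡ m
      lower : ∀ a → i ℕ.≤ toℕ (f a)
      increasing : ∀ a b → toℕ a ℕ.< toℕ b → toℕ (f a) ℕ.< toℕ (f b)
      path : alternating k (sg (s xor isEven i)) (toLast (induced (L (suc m)) f)) (λ j → sg (σ (f (inject₁ j)))) ≡ p
      sign : e xor isEven m ≡ (s xor isEven i) xor not (isEven k)

  -- The alternating sign at position `i` is `s xor isEven i`. Keeping a letter flips it together
  -- with the parity of `i`; dropping one must preserve it although the parity changes, so `s` is
  -- flipped instead. The field `sign` keeps track of the parity of `k`.
  chain : ∀ i len {s e p} → i ℕ.+ len ≡ m → Selection s e (word (σ ∘ at) i len) p → Chain i s e p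
  chain i zero {s} i≡m done = record
    { k = 0 ; f = λ _ → fromℕ m ; last = FP.toℕ-fromℕ m
    ; lower = λ _ → ℕP.≤-reflexive (trans (trans (sym (ℕP.+-identityʳ i)) i≡m) (sym (FP.toℕ-fromℕ m)))
    ; increasing = λ { zero zero () }
    ; path = refl
    ; sign = trans (cong (λ i → s xor isEven i) (trans (sym i≡m) (ℕP.+-identityʳ i))) (lem (s xor isEven i)) }
    where
    lem : ∀ b → b ≡ b xor false
    lem true = refl
    lem false = refl
  chain i (suc len) {s} {e} eq (keep {p = p} sel) = record
    { k = suc C.k ; f = f′ ; last = C.last
    ; lower = λ { zero → ℕP.≤-reflexive (sym at-i) ; (suc a) → ℕP.<⇒≤ (C.lower a) }
    ; increasing = λ { zero (suc b) _ → subst (ℕ._< toℕ (C.f b)) (sym at-i) (C.lower b)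
                     ; (suc a) (suc b) (ℕ.s≤s a<b) → C.increasing a b a<b }
    ; path = cong₂ _∷_
        (trans (cong (λ l → sg (s xor isEven i) * sg l , sg (s xor isEven i) * sg (σ (at i)))
            (trans (L-last-column (at i) (C.f (fromℕ C.k)) (subst (ℕ._< m) (sym at-i) i<m) C.last) (cong (not ∘ isEven) at-i)))
          (letter s (isEven i) (σ (at i))))
        (trans (cong (λ t → alternating C.k t (toLast (induced (L (suc m)) C.f)) (λ j → sg (σ (C.f (inject₁ j)))))
            (flip s (isEven i))) C.path)
    ; sign = trans C.sign (lem s (isEven i) (isEven C.k)) }
    where
    C : Chain (suc i) s e p
    C = chain (suc i) len (trans (sym (ℕP.+-suc i len)) eq) sel
    module C = Chain C
    f′ : Fin (suc (suc C.k)) → Fin (suc m)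
    f′ zero = at i
    f′ (suc a) = C.f a
    i<m : i ℕ.< m
    i<m = subst (i ℕ.<_) eq (ℕP.m<m+n i (ℕ.s≤s ℕ.z≤n))
    at-i : toℕ (at {m} i) ≡ i
    at-i = toℕ-at (ℕP.<⇒≤ i<m)
    letter : ∀ s v q → (sg (s xor v) * sg (not v) , sg (s xor v) * sg q) ≡ step s (q xor v)
    letter true true true = refl
    letter true true false = refl
    letter true false true = refl
    letter true false false = refl
    letter false true true = refl
    letter false true false = refl
    letter false false true = refl
    letter false false false = refl
    flip : ∀ s v → - sg (s xor v) ≡ sg (s xor not v)
    flip true true = refl
    flip true false = refl
    flip false true = refl
    flip false false = refl
    lem : ∀ s v w → (s xor not v) xor not w ≡ (s xor v) xor not (not w)
    lem true true true = refl
    lem true true false = refl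
    lem true false true = refl
    lem true false false = refl
    lem false true true = refl
    lem false true false = refl
    lem false false true = refl
    lem false false false = refl
  chain i (suc len) {s} {e} {p} eq (drop sel) = record
    { k = C.k ; f = C.f ; last = C.last
    ; lower = λ a → ℕP.<⇒≤ (C.lower a)
    ; increasing = C.increasing
    ; path = trans (cong (λ b → alternating C.k (sg b) (toLast (induced (L (suc m)) C.f)) (λ j → sg (σ (C.f (inject₁ j)))))
        (lem s (isEven i))) C.path
    ; sign = trans C.sign (cong (_xor not (isEven C.k)) (sym (lem s (isEven i)))) }
    where
    C : Chain (suc i) (not s) e p
    C = chain (suc i) len (trans (sym (ℕP.+-suc i len)) eq) sel
    module C = Chain C
    lem : ∀ s v → s xor v ≡ not s xor not v
    lem true true = refl
    lem true false = refl
    lem false true = refl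
    lem false false = refl

  -- As `m` is odd and the end signs are opposite, `C.sign` forces `C.k` to be even. The area
  -- formula then applies to the subtournament of `u` and the chain, whose determinant is at most
  -- m².
  word-bounded : isEven m ≡ false → DetBounded (m ℕ.* m) (extend (L (suc m)) σ) →
    Bounded m (sg (σ (fromℕ m))) (word (σ ∘ at) 0 m)
  word-bounded odd-m bd s p sel = square-≤⁻¹ (sg (σ (fromℕ m)) + area p) (subst (ℤ._≤ _)
      (trans (det-border-skew-even (k-even s _ _ odd-m C.sign) S
          (induced-tournament (L-tournament m) f-inj) (L-increasing C.f C.increasing) x)
        (cong (λ P → P * P) pf≡)) det≤)
    where
    C : Chain 0 s (not s) p
    C = chain 0 m refl sel
    module C = Chain C
    S : Digraph (suc C.k)
    S = induced (L (suc m)) C.f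
    f-inj : Injective _≡_ _≡_ C.f
    f-inj = increasing⇒injective C.increasing
    x : Fin (suc C.k) → ℤ
    x b = sg (σ (C.f b))
    k-even : ∀ s v w → w ≡ false → not s xor w ≡ (s xor true) xor not v → v ≡ true
    k-even s true w _ _ = refl
    k-even true false false refl ()
    k-even false false false refl ()
    det≤ : det (border x (skew S)) ℤ.≤ + (m ℕ.* m)
    det≤ = subst (ℤ._≤ _)
      (det-cong (skew-border _ (induced-tournament (extend-tournament (L-tournament m) σ) (withApex-injective f-inj))))
      (bd (suc (suc C.k)) (withApex C.f) (withApex-injective f-inj))
    pf≡ : pf S x ≡ sg (σ (fromℕ m)) + area p
    pf≡ = cong₂ _+_ (cong (sg ∘ σ) (FP.toℕ-injective (trans C.last (sym (FP.toℕ-fromℕ m)))))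
      (trans (sym (unsign (s xor true))) (cong area C.path))
      where
      unsign : ∀ b → area (alternating C.k (sg b) (toLast S) (x ∘ inject₁)) ≡
                     area (alternating C.k (+ 1) (toLast S) (x ∘ inject₁))
      unsign true = refl
      unsign false = area-alternating-neg C.k (+ 1) (toLast S) (x ∘ inject₁)

-- Associations read off the word.

countA≡0 : ∀ (g : ℕ → Bool) i len → countA (word g i len) ≡ 0 → ∀ j → i ℕ.≤ j → j ℕ.< i ℕ.+ len → g j ≡ isEven j
countA≡0 g i zero _ j i≤j j<i = contradiction (subst (j ℕ.<_) (ℕP.+-identityʳ i) j<i) (ℕP.≤⇒≯ i≤j)
countA≡0 g i (suc len) c j i≤j j< with g i xor isEven i in q | c
... | false | c with ℕP.m≤n⇒m<n∨m≡n i≤j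
...   | inj₁ i<j = countA≡0 g (suc i) len c j i<j (subst (j ℕ.<_) (ℕP.+-suc i len) j<)
...   | inj₂ refl = xor-false (g i) (isEven i) q
  where
  xor-false : ∀ a b → a xor b ≡ false → a ≡ b
  xor-false true true _ = refl
  xor-false false false _ = refl

countB≡0 : ∀ (g : ℕ → Bool) i len → countB (word g i len) ≡ 0 → ∀ j → i ℕ.≤ j → j ℕ.< i ℕ.+ len → g j ≡ not (isEven j)
countB≡0 g i zero _ j i≤j j<i = contradiction (subst (j ℕ.<_) (ℕP.+-identityʳ i) j<i) (ℕP.≤⇒≯ i≤j)
countB≡0 g i (suc len) c j i≤j j< with g i xor isEven i in q | c
... | true | c with ℕP.m≤n⇒m<n∨m≡n i≤j
...   | inj₁ i<j = countB≡0 g (suc i) len c j i<j (subst (j ℕ.<_) (ℕP.+-suc i len) j<)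
...   | inj₂ refl = xor-true (g i) (isEven i) q
  where
  xor-true : ∀ a b → a xor b ≡ true → a ≡ not b
  xor-true true false _ = refl
  xor-true false true _ = refl

-- The parity term flips at each position, so letters repeat exactly where `g` changes.
repeats-≡ : ∀ (g : ℕ → Bool) i w → g (suc i) ≡ g i →
  repeats ((g i xor isEven i) ∷ (g (suc i) xor isEven (suc i)) ∷ w) ≡ repeats ((g (suc i) xor isEven (suc i)) ∷ w)
repeats-≡ g i w e rewrite e with g i | isEven i
... | true | true = refl
... | true | false = refl
... | false | true = refl
... | false | false = refl

repeats-≢ : ∀ (g : ℕ → Bool) i w → g (suc i) ≡ not (g i) →
  repeats ((g i xor isEven i) ∷ (g (suc i) xor isEven (suc i)) ∷ w) ≡ suc (repeats ((g (suc i) xor isEven (suc i)) ∷ w))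
repeats-≢ g i w e rewrite e with g i | isEven i
... | true | true = refl
... | true | false = refl
... | false | true = refl
... | false | false = refl

bool-cases : ∀ a b → a ≡ b ⊎ a ≡ not b
bool-cases true true = inj₁ refl
bool-cases true false = inj₂ refl
bool-cases false true = inj₂ refl
bool-cases false false = inj₁ refl

repeats≡0 : ∀ (g : ℕ → Bool) i len → repeats (word g i (suc len)) ≡ 0 → ∀ j → i ℕ.≤ j → j ℕ.≤ i ℕ.+ len → g j ≡ g i
repeats≡0 g i len r j i≤j j≤ with ℕP.m≤n⇒m<n∨m≡n i≤j
repeats≡0 g i len r j i≤j j≤ | inj₂ refl = refl
repeats≡0 g i zero r j i≤j j≤ | inj₁ i<j = contradiction (subst (j ℕ.≤_) (ℕP.+-identityʳ i) j≤) (ℕP.<⇒≱ i<j)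
repeats≡0 g i (suc len) r j i≤j j≤ | inj₁ i<j with bool-cases (g (suc i)) (g i)
... | inj₁ e = trans (repeats≡0 g (suc i) len (trans (sym (repeats-≡ g i (word g (suc (suc i)) len) e)) r) j i<j
                 (subst (j ℕ.≤_) (ℕP.+-suc i len) j≤)) e
... | inj₂ e = contradiction (trans (sym (repeats-≢ g i (word g (suc (suc i)) len) e)) r) λ ()

-- The witness is the last position before the only change of `g`, or the final position if there is
-- no change.
repeats≤1 : ∀ (g : ℕ → Bool) i len → repeats (word g i (suc len)) ℕ.≤ 1 → Σ ℕ λ c → i ℕ.≤ c × c ℕ.≤ i ℕ.+ len ×
  (∀ j → i ℕ.≤ j → j ℕ.≤ c → g j ≡ g i) × (∀ j → c ℕ.< j → j ℕ.≤ i ℕ.+ len → g j ≡ not (g i))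
repeats≤1 g i zero r = i , ℕP.≤-refl , ℕP.m≤m+n i 0 , (λ j i≤j j≤i → cong g (ℕP.≤-antisym j≤i i≤j)) ,
  λ j i<j j≤i → contradiction (subst (j ℕ.≤_) (ℕP.+-identityʳ i) j≤i) (ℕP.<⇒≱ i<j)
repeats≤1 g i (suc len) r with bool-cases (g (suc i)) (g i)
... | inj₂ e = i , ℕP.≤-refl , ℕP.m≤m+n i (suc len) , (λ j i≤j j≤i → cong g (ℕP.≤-antisym j≤i i≤j)) ,
  λ j i<j j≤ → trans (repeats≡0 g (suc i) len
      (ℕP.n≤0⇒n≡0 (ℕP.≤-pred (subst (ℕ._≤ 1) (repeats-≢ g i (word g (suc (suc i)) len) e) r))) j i<j
      (subst (j ℕ.≤_) (ℕP.+-suc i len) j≤)) e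
... | inj₁ e with repeats≤1 g (suc i) len (subst (ℕ._≤ 1) (repeats-≡ g i (word g (suc (suc i)) len) e) r)
...   | c , i<c , c≤ , below , above = c , ℕP.<⇒≤ i<c , subst (c ℕ.≤_) (sym (ℕP.+-suc i len)) c≤ ,
  below′ , λ j c<j j≤ → trans (above j c<j (subst (j ℕ.≤_) (ℕP.+-suc i len) j≤)) (cong not e)
  where
  below′ : ∀ j → i ℕ.≤ j → j ℕ.≤ c → g j ≡ g i
  below′ j i≤j j≤c with ℕP.m≤n⇒m<n∨m≡n i≤j
  ... | inj₁ i<j = trans (below j i<j j≤c) e
  ... | inj₂ refl = refl

isTop : ∀ {m} (v : Fin (suc m)) → toℕ v ≡ m → v ≡ fromℕ m
isTop {m} v e = FP.toℕ-injective (trans e (sym (FP.toℕ-fromℕ m)))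

xor-assoc-not : ∀ b v → not (b xor not v) ≡ b xor v
xor-assoc-not true true = refl
xor-assoc-not true false = refl
xor-assoc-not false true = refl
xor-assoc-not false false = refl

xor-true : ∀ b → b xor true ≡ not b
xor-true true = refl
xor-true false = refl

xor-false : ∀ b → b xor false ≡ b
xor-false true = refl
xor-false false = refl

module _ (t : ℕ) (σ : Fin (suc (suc (double t))) → Bool) where
  private
    m : ℕ
    m = suc (double t)
    g : ℕ → Bool
    g = σ ∘ at {m}
    b = g 0
    τ = σ (fromℕ m)
    w = word g 0 m

    value : ∀ v → σ v ≡ g (toℕ v)
    value v = cong σ (sym (at-toℕ v))

    -- Up to reversal u sits between c and c + 1, whose arcs to the last vertex differ, so it is
    -- associated with one of them.
    CR-at : ∀ {c} d → c ℕ.≤ double t → d ≡ c ⊎ d ≡ suc c → d ℕ.≤ double t →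
      (∀ j → 0 ℕ.≤ j → j ℕ.≤ c → g j ≡ b) → (∀ j → c ℕ.< j → j ℕ.≤ double t → g j ≡ not b) →
      τ ≡ b xor not (isEven d) → CRAssoc (extend (L (suc m)) σ) zero (suc (at d))
    CR-at {c} d c≤ d≈c d≤ below above top = CR-of-parallel (at d) b par
      where
      at-d : toℕ (at {m} d) ≡ d
      at-d = toℕ-at (ℕP.m≤n⇒m≤1+n d≤)
      at-d<m : toℕ (at {m} d) ℕ.< m
      at-d<m = subst (ℕ._< m) (sym at-d) (ℕ.s≤s d≤)
      less : ∀ j → j ℕ.< d → d ≡ c ⊎ d ≡ suc c → j ℕ.≤ c
      less j j<d (inj₁ refl) = ℕP.<⇒≤ j<d
      less j j<d (inj₂ refl) = ℕP.≤-pred j<d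
      more : ∀ j → d ℕ.< j → d ≡ c ⊎ d ≡ suc c → c ℕ.< j
      more j d<j (inj₁ refl) = d<j
      more j d<j (inj₂ refl) = ℕP.<-trans (ℕP.n<1+n c) d<j
      par : ∀ v → v ≢ at d → σ v ≡ b xor L (suc m) (at d) v
      par v v≢d with <m⊎≡m v
      ... | inj₂ v≡m = trans (cong σ (isTop v v≡m)) (trans top (cong (b xor_)
              (sym (trans (L-last-column (at d) v at-d<m v≡m) (cong (not ∘ isEven) at-d)))))
      ... | inj₁ v<m with ℕP.<-cmp (toℕ v) d
      ...   | tri< v<d _ _ = trans (value v) (trans (below (toℕ v) ℕ.z≤n (less _ v<d d≈c))
                (trans (sym (xor-false b)) (cong (b xor_) (sym (trans (L-low (at d) v at-d<m v<m)
                  (<ᵇ-false (subst (toℕ v ℕ.≤_) (sym at-d) (ℕP.<⇒≤ v<d))))))))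
      ...   | tri≈ _ v≡d _ = contradiction (FP.toℕ-injective (trans v≡d (sym at-d))) v≢d
      ...   | tri> _ _ d<v = trans (value v) (trans (above (toℕ v) (more _ d<v d≈c) (ℕP.≤-pred v<m))
                (trans (sym (xor-true b)) (cong (b xor_) (sym (trans (L-low (at d) v at-d<m v<m)
                  (<ᵇ-true (subst (ℕ._< toℕ v) (sym at-d) d<v)))))))

    -- The wrap-around case: when the gap lies after the last transitive vertex, its other neighbour
    -- is cyclically the first one, with the orientation reversed.
    CR-first : (∀ j → 0 ℕ.≤ j → j ℕ.≤ double t → g j ≡ b) → τ ≡ not b →
      CRAssoc (extend (L (suc m)) σ) zero (suc zero)
    CR-first const top = CR-of-parallel zero (not b) par
      where
      par : ∀ v → v ≢ zero → σ v ≡ not b xor L (suc m) zero v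
      par v v≢0 with <m⊎≡m v
      ... | inj₂ v≡m = trans (cong σ (isTop v v≡m)) (trans top (trans (sym (xor-false (not b)))
              (cong (not b xor_) (sym (L-last-column zero v (ℕ.s≤s ℕ.z≤n) v≡m)))))
      par zero v≢0 | inj₁ _ = contradiction refl v≢0
      par v@(suc _) v≢0 | inj₁ v<m = trans (value v) (trans (const (toℕ v) ℕ.z≤n (ℕP.≤-pred v<m))
        (trans (sym (not-involutive b)) (trans (sym (xor-true (not b)))
          (cong (not b xor_) (sym (L-low zero v (ℕ.s≤s ℕ.z≤n) v<m))))))

    few-repeats⇒CR : repeats w ℕ.≤ 1 → Σ (Fin (suc m)) λ v → CRAssoc (extend (L (suc m)) σ) zero (suc v)
    few-repeats⇒CR r with repeats≤1 g 0 (double t) r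
    ... | c , _ , c≤ , below , above with bool-cases τ (b xor not (isEven c))
    ...   | inj₁ e = at c , CR-at c c≤ (inj₁ refl) c≤ below above e
    ...   | inj₂ e with ℕP.m≤n⇒m<n∨m≡n c≤
    ...     | inj₁ c< = at (suc c) , CR-at (suc c) c≤ (inj₂ refl) c< below above
                (trans e (trans (xor-assoc-not b (isEven c)) (cong (b xor_) (sym (not-involutive _)))))
    ...     | inj₂ refl = zero , CR-first below
                (trans e (trans (xor-assoc-not b _) (trans (cong (b xor_) (double-even t)) (xor-true b))))

    below : ∀ v → v ≢ fromℕ m → toℕ v ℕ.< m
    below v v≢m with <m⊎≡m v
    ... | inj₁ v<m = v<m
    ... | inj₂ v≡m = contradiction (isTop v v≡m) v≢m

    noA⇒CR : countA w ≡ 0 → CRAssoc (extend (L (suc m)) σ) zero (suc (fromℕ m))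
    noA⇒CR c = CR-of-parallel (fromℕ m) false λ v v≢m → trans (value v)
      (trans (countA≡0 g 0 m c (toℕ v) ℕ.z≤n (below v v≢m))
        (sym (L-last-row (fromℕ m) v (FP.toℕ-fromℕ m) (below v v≢m))))

    noB⇒CR : countB w ≡ 0 → CRAssoc (extend (L (suc m)) σ) zero (suc (fromℕ m))
    noB⇒CR c = CR-of-parallel (fromℕ m) true λ v v≢m → trans (value v)
      (trans (countB≡0 g 0 m c (toℕ v) ℕ.z≤n (below v v≢m))
        (cong not (sym (L-last-row (fromℕ m) v (FP.toℕ-fromℕ m) (below v v≢m)))))

  L-nonCR : NonCRVertex (L (suc m)) σ → ¬ DetBounded (m ℕ.* m) (extend (L (suc m)) σ)
  L-nonCR nonCR bd = bounded⇒few-repeats (sg τ) w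
    (trans (cong isEven len) m-odd)
    (subst (λ l → Bounded l (sg τ) w) (sym len) (word-bounded σ m-odd bd))
    (ℕP.n≢0⇒n>0 λ c → nonCR (fromℕ m , noA⇒CR c))
    (ℕP.n≢0⇒n>0 λ c → nonCR (fromℕ m , noB⇒CR c))
    (ℕP.≰⇒> (nonCR ∘ few-repeats⇒CR))
    where
    len : length w ≡ m
    len = length-word g 0 m
    m-odd : isEven m ≡ false
    m-odd = cong not (double-even t)

-- No two vertices of `L n` are associated.

module _ (t : ℕ) where
  private
    m : ℕ
    m = suc (double (suc t))
    top : Fin (suc m)
    top = fromℕ m
    toℕ-top : toℕ top ≡ m
    toℕ-top = FP.toℕ-fromℕ m
    L′ : Digraph (suc m)
    L′ = L (suc m)

    at≢ : ∀ {j} (a : Fin (suc m)) → j ℕ.≤ m → j ≢ toℕ a → at j ≢ a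
    at≢ a j≤m j≢a e = j≢a (trans (sym (toℕ-at j≤m)) (cong toℕ e))

    below-top : ∀ {j} → j ℕ.< m → j ≢ toℕ top
    below-top j<m e = ℕP.<⇒≢ j<m (trans e toℕ-top)

    L-at : ∀ (a : Fin (suc m)) {j} → toℕ a ℕ.< m → j ℕ.< m → L′ a (at j) ≡ (toℕ a <ᵇ j)
    L-at a a<m j<m = trans (L-low a (at _) a<m (subst (ℕ._< m) (sym (toℕ-at (ℕP.<⇒≤ j<m))) j<m))
      (cong (toℕ a <ᵇ_) (toℕ-at (ℕP.<⇒≤ j<m)))

    top-at : ∀ {j} → j ℕ.< m → L′ top (at j) ≡ isEven j
    top-at j<m = trans (L-last-row top (at _) toℕ-top (subst (ℕ._< m) (sym (toℕ-at (ℕP.<⇒≤ j<m))) j<m))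
      (cong isEven (toℕ-at (ℕP.<⇒≤ j<m)))

    b≢not-b : ∀ b → b ≢ not b
    b≢not-b true ()
    b≢not-b false ()

    top≢ : ∀ {a : Fin (suc m)} → toℕ a ℕ.< m → top ≢ a
    top≢ a<m refl = ℕP.<⇒≢ a<m toℕ-top

    -- Covertices are separated by a vertex between them, or, if they are consecutive, by the last
    -- vertex. For revertices a transitive vertex before or after both agrees on them; if there is
    -- none, they are the two ends, of equal parity, and the last vertex agrees on them.
    low-low : ∀ a b → toℕ a ℕ.< toℕ b → toℕ b ℕ.< m → ¬ CRAssoc L′ a b
    low-low a b a<b b<m (inj₁ co) with ℕP.m≤n⇒m<n∨m≡n a<b
    ... | inj₁ 1+a<b = contradiction (trans (sym (trans (L-at a a<m 1+a<m) (<ᵇ-true (ℕP.n<1+n (toℕ a)))))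
            (trans (co (at (suc (toℕ a))) (at≢ a (ℕP.<⇒≤ 1+a<m) (ℕP.<⇒≢ (ℕP.n<1+n _) ∘ sym))
                (at≢ b (ℕP.<⇒≤ 1+a<m) (ℕP.<⇒≢ 1+a<b)))
              (trans (L-at b b<m 1+a<m) (<ᵇ-false (ℕP.<⇒≤ 1+a<b))))) λ ()
      where
      a<m = ℕP.<-trans a<b b<m
      1+a<m = ℕP.<-trans 1+a<b b<m
    ... | inj₂ 1+a≡b = b≢not-b _ (trans (sym (L-last-column a top a<m toℕ-top))
            (trans (co top (top≢ a<m) (top≢ b<m)) (trans (L-last-column b top b<m toℕ-top)
              (cong (not ∘ isEven) (sym 1+a≡b)))))
      where
      a<m = ℕP.<-trans a<b b<m
    low-low a b a<b b<m (inj₂ re) = reversed (toℕ a) refl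
      where
      a<m = ℕP.<-trans a<b b<m
      0<m : 0 ℕ.< m
      0<m = ℕ.s≤s ℕ.z≤n
      reversed : ∀ x → toℕ a ≡ x → ⊥
      reversed (suc x) ea = contradiction (trans (sym (trans (L-at a a<m 0<m) (<ᵇ-false {toℕ a} ℕ.z≤n)))
        (trans (re (at 0) (at≢ {0} a ℕ.z≤n λ e → contradiction (trans e ea) λ ())
            (at≢ {0} b ℕ.z≤n λ e → ℕP.n≮0 (subst (toℕ a ℕ.<_) (sym e) a<b)))
          (cong not (trans (L-at b b<m 0<m) (<ᵇ-false {toℕ b} ℕ.z≤n))))) λ ()
      reversed zero ea with ℕP.m≤n⇒m<n∨m≡n b<m
      ... | inj₁ 1+b<m = contradiction (trans (sym (trans (L-at a a<m 1+b<m) (<ᵇ-true (ℕP.m<n⇒m<1+n a<b))))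
        (trans (re (at (suc (toℕ b))) (at≢ a (ℕP.<⇒≤ 1+b<m) λ e → contradiction (trans e ea) λ ())
            (at≢ b (ℕP.<⇒≤ 1+b<m) (ℕP.<⇒≢ (ℕP.n<1+n _) ∘ sym)))
          (cong not (trans (L-at b b<m 1+b<m) (<ᵇ-true (ℕP.n<1+n (toℕ b))))))) λ ()
      ... | inj₂ 1+b≡m = contradiction (trans (sym (trans (L-last-column a top a<m toℕ-top) (cong (not ∘ isEven) ea)))
        (trans (re top (top≢ a<m) (top≢ b<m)) (cong not (trans (L-last-column b top b<m toℕ-top)
          (cong not (trans (cong isEven (ℕP.suc-injective 1+b≡m)) (double-even (suc t)))))))) λ ()

    -- The two neighbours of an inner `a` lie on different sides of it but have indices of equal
    -- parity, so the last vertex treats them alike and `a` does not. At either end, one of two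
    -- nearby indices of different parity refutes each kind of association.
    low-top : ∀ a → toℕ a ℕ.< m → ¬ CRAssoc L′ a top
    low-top a a<m cr = by-position (toℕ a) refl cr
      where
      at-≢ : ∀ {j} → j ℕ.< m → j ≢ toℕ a → at j ≢ a × at j ≢ top
      at-≢ j<m j≢a = at≢ a (ℕP.<⇒≤ j<m) j≢a , at≢ top (ℕP.<⇒≤ j<m) (below-top j<m)
      co-at : ∀ {j} → Covertices L′ a top → j ℕ.< m → j ≢ toℕ a → (toℕ a <ᵇ j) ≡ isEven j
      co-at co j<m j≢a = trans (sym (L-at a a<m j<m))
        (trans (co (at _) (proj₁ (at-≢ j<m j≢a)) (proj₂ (at-≢ j<m j≢a))) (top-at j<m))
      re-at : ∀ {j} → Revertices L′ a top → j ℕ.< m → j ≢ toℕ a → (toℕ a <ᵇ j) ≡ not (isEven j)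
      re-at re j<m j≢a = trans (sym (L-at a a<m j<m))
        (trans (re (at _) (proj₁ (at-≢ j<m j≢a)) (proj₂ (at-≢ j<m j≢a))) (cong not (top-at j<m)))
      0<m : 0 ℕ.< m
      0<m = ℕ.s≤s ℕ.z≤n
      1<m : 1 ℕ.< m
      1<m = ℕ.s≤s (ℕ.s≤s ℕ.z≤n)
      2<m : 2 ℕ.< m
      2<m = ℕ.s≤s (ℕ.s≤s (ℕ.s≤s ℕ.z≤n))
      by-position : ∀ x → toℕ a ≡ x → CRAssoc L′ a top → ⊥
      by-position zero ea (inj₁ co) = contradiction
        (trans (sym (<ᵇ-true (subst (ℕ._< 1) (sym ea) ℕP.0<1+n))) (co-at co 1<m λ e → contradiction (trans e ea) λ ())) λ ()
      by-position zero ea (inj₂ re) = contradiction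
        (trans (sym (<ᵇ-true (subst (ℕ._< 2) (sym ea) ℕP.0<1+n))) (re-at re 2<m λ e → contradiction (trans e ea) λ ())) λ ()
      by-position (suc x) ea cr with ℕP.m≤n⇒m<n∨m≡n (subst (ℕ._< m) ea a<m)
      ... | inj₁ 2+x<m = middle cr
        where
        x<m : x ℕ.< m
        x<m = ℕP.<-trans (ℕP.n<1+n x) (subst (ℕ._< m) ea a<m)
        x≢a : x ≢ toℕ a
        x≢a e = ℕP.<⇒≢ (ℕP.n<1+n x) (trans e ea)
        2+x≢a : suc (suc x) ≢ toℕ a
        2+x≢a e = ℕP.<⇒≢ (ℕP.n<1+n (suc x)) (sym (trans e ea))
        not-below : (toℕ a <ᵇ x) ≡ false
        not-below = <ᵇ-false (subst (x ℕ.≤_) (sym ea) (ℕP.n≤1+n x))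
        above : (toℕ a <ᵇ suc (suc x)) ≡ true
        above = <ᵇ-true (subst (ℕ._< suc (suc x)) (sym ea) (ℕP.n<1+n (suc x)))
        middle : CRAssoc L′ a top → ⊥
        middle (inj₁ co) = contradiction (trans (sym above) (trans (co-at co 2+x<m 2+x≢a)
          (trans (not-involutive _) (trans (sym (co-at co x<m x≢a)) not-below)))) λ ()
        middle (inj₂ re) = contradiction (trans (sym above) (trans (re-at re 2+x<m 2+x≢a)
          (trans (cong not (not-involutive _)) (trans (sym (re-at re x<m x≢a)) not-below)))) λ ()
      ... | inj₂ 2+x≡m = end cr
        where
        a≡ : toℕ a ≡ suc (suc (double t))
        a≡ = trans ea (ℕP.suc-injective 2+x≡m)
        end : CRAssoc L′ a top → ⊥
        end (inj₁ co) = contradiction (trans (sym (<ᵇ-false {toℕ a} ℕ.z≤n))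
          (co-at co 0<m λ e → contradiction (trans e a≡) λ ())) λ ()
        end (inj₂ re) = contradiction (trans (sym (<ᵇ-false (subst (1 ℕ.≤_) (sym a≡) (ℕ.s≤s ℕ.z≤n))))
          (re-at re 1<m λ e → contradiction (trans e a≡) λ ())) λ ()

    CR-sym : ∀ a b → CRAssoc L′ a b → CRAssoc L′ b a
    CR-sym a b (inj₁ co) = inj₁ λ v v≢b v≢a → sym (co v v≢a v≢b)
    CR-sym a b (inj₂ re) = inj₂ λ v v≢b v≢a → sym (trans (cong not (re v v≢a v≢b)) (not-involutive _))

  L-noCR : ∀ a b → a ≢ b → ¬ CRAssoc (L (suc m)) a b
  L-noCR a b a≢b cr with <m⊎≡m a | <m⊎≡m b
  ... | inj₂ a≡m | inj₂ b≡m = a≢b (trans (isTop a a≡m) (sym (isTop b b≡m)))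
  ... | inj₁ a<m | inj₂ b≡m = low-top a a<m (subst (CRAssoc L′ a) (isTop b b≡m) cr)
  ... | inj₂ a≡m | inj₁ b<m = low-top b b<m (subst (CRAssoc L′ b) (isTop a a≡m) (CR-sym a b cr))
  ... | inj₁ a<m | inj₁ b<m with ℕP.<-cmp (toℕ a) (toℕ b)
  ...   | tri< a<b _ _ = low-low a b a<b b<m cr
  ...   | tri≈ _ a≡b _ = a≢b (FP.toℕ-injective a≡b)
  ...   | tri> _ _ b<a = low-low b a b<a a<m (CR-sym a b cr)

-- Transitive blowups

module _ {n : ℕ} (T : Digraph n) (i : Fin n) where

  blowup-zero-i : blowup T i zero (suc i) ≡ true
  blowup-zero-i with i ≟ i
  ... | yes _ = refl
  ... | no i≢i = contradiction refl i≢i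

  blowup-i-zero : blowup T i (suc i) zero ≡ false
  blowup-i-zero with i ≟ i
  ... | yes _ = refl
  ... | no i≢i = contradiction refl i≢i

  blowup-zero-suc : ∀ w → w ≢ i → blowup T i zero (suc w) ≡ T i w
  blowup-zero-suc w w≢i with w ≟ i
  ... | yes w≡i = contradiction w≡i w≢i
  ... | no _ = refl

  blowup-suc-zero : ∀ w → w ≢ i → blowup T i (suc w) zero ≡ T w i
  blowup-suc-zero w w≢i with w ≟ i
  ... | yes w≡i = contradiction w≡i w≢i
  ... | no _ = refl

  blowup-tournament : IsTournament T → IsTournament (blowup T i)
  blowup-tournament tour zero zero 0≢0 = contradiction refl 0≢0
  blowup-tournament tour zero (suc w) _ with w ≟ i
  ... | yes _ = refl
  ... | no w≢i = tour i w (w≢i ∘ sym)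
  blowup-tournament tour (suc w) zero _ with w ≟ i
  ... | yes _ = refl
  ... | no w≢i = tour w i w≢i
  blowup-tournament tour (suc a) (suc b) a≢b = tour a b (a≢b ∘ cong suc)

  collapse : Fin (suc n) → Fin n
  collapse zero = i
  collapse (suc w) = w

  NoPair : ∀ {k} → (Fin k → Fin (suc n)) → Set
  NoPair f = ∀ a b → f a ≡ zero → f b ≢ suc i

  private
    blowup-collapse : ∀ x y → (x ≡ zero → y ≢ suc i) → (y ≡ zero → x ≢ suc i) → x ≢ y →
      blowup T i x y ≡ T (collapse x) (collapse y)
    blowup-collapse zero zero _ _ 0≢0 = contradiction refl 0≢0
    blowup-collapse zero (suc w) p _ _ = blowup-zero-suc w (p refl ∘ cong suc)
    blowup-collapse (suc w) zero _ p _ = blowup-suc-zero w (p refl ∘ cong suc)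
    blowup-collapse (suc a) (suc b) _ _ _ = refl

    collapse-injective : ∀ x y → (x ≡ zero → y ≢ suc i) → (y ≡ zero → x ≢ suc i) → collapse x ≡ collapse y → x ≡ y
    collapse-injective zero zero _ _ _ = refl
    collapse-injective zero (suc w) p _ refl = contradiction refl (p refl)
    collapse-injective (suc w) zero _ p refl = contradiction refl (p refl)
    collapse-injective (suc a) (suc b) _ _ e = cong suc e

    blowup-noPair : ∀ {c} → DetBounded c T → ∀ k (f : Fin k → Fin (suc n)) → Injective _≡_ _≡_ f → NoPair f →
      detT (induced (blowup T i) f) ℤ.≤ + c
    blowup-noPair bd k f f-inj np = subst (ℤ._≤ _)
      (sym (detT-cong λ a b a≢b → blowup-collapse (f a) (f b) (np a b) (np b a) (a≢b ∘ f-inj)))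
      (bd k (collapse ∘ f) λ {a} {b} e → f-inj (collapse-injective (f a) (f b) (np a b) (np b a) e))

    -- The twins are covertices, so both can be deleted without changing the determinant, and what
    -- is left embeds in `T`.
    blowup-pair : ∀ {c} → IsTournament T → DetBounded c T → ∀ k (f : Fin k → Fin (suc n)) → Injective _≡_ _≡_ f →
      ∀ a b → f a ≡ zero → f b ≡ suc i → detT (induced (blowup T i) f) ℤ.≤ + c
    blowup-pair tour bd (suc zero) f f-inj zero zero fa fb = contradiction (trans (sym fa) fb) λ ()
    blowup-pair {c} tour bd (suc (suc k)) f f-inj a b fa fb = subst (ℤ._≤ + c) (begin
        detT (λ x y → S (suc (suc x)) (suc (suc y)))
          ≡⟨ sym (detT-CR S (induced-tournament (blowup-tournament tour) (π-inj ∘ f-inj)) (inj₁ co)) ⟩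
        detT S
          ≡⟨ detT-permute (signed-∘ (signed-toFront a) (signed-lift (signed-toFront b′))) π-inj (induced (blowup T i) f) ⟩
        detT (induced (blowup T i) f) ∎)
      (blowup-noPair bd k (λ x → f (π (suc (suc x)))) (λ e → FP.suc-injective (FP.suc-injective (π-inj (f-inj e))))
        λ x y e _ → contradiction (π-inj {suc (suc x)} {zero} (f-inj (trans e (sym fa)))) λ ())
      where
      a≢b : a ≢ b
      a≢b refl = contradiction (trans (sym fa) fb) λ ()
      b′ = punchOut a≢b
      π : Fin (suc (suc k)) → Fin (suc (suc k))
      π x = toFront a (lift (toFront b′) x)
      π-inj : Injective _≡_ _≡_ π
      π-inj e = lift-injective (toFront-injective b′) (toFront-injective a e)
      S : Digraph (suc (suc k))
      S = induced (blowup T i) (f ∘ π)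
      π₁ : f (π (suc zero)) ≡ suc i
      π₁ = trans (cong f (FP.punchIn-punchOut a≢b)) fb
      parallel : ∀ x → x ≢ zero → x ≢ suc i → blowup T i zero x ≡ blowup T i (suc i) x
      parallel zero 0≢0 _ = contradiction refl 0≢0
      parallel (suc w) _ w≢i = blowup-zero-suc w (w≢i ∘ cong suc)
      co : Covertices S zero (suc zero)
      co v v≢0 v≢1 = trans (cong (λ x → blowup T i x (f (π v))) fa) (trans
        (parallel (f (π v)) (λ e → v≢0 (π-inj (f-inj (trans e (sym fa)))))
                            (λ e → v≢1 (π-inj (f-inj (trans e (sym π₁))))))
        (cong (λ x → blowup T i x (f (π v))) (sym π₁)))

  blowup-bounded : ∀ {c} → IsTournament T → DetBounded c T → DetBounded c (blowup T i)
  blowup-bounded tour bd k f f-inj with FP.any? (λ a → f a ≟ zero) | FP.any? (λ b → f b ≟ suc i)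
  ... | yes (a , fa) | yes (b , fb) = blowup-pair tour bd k f f-inj a b fa fb
  ... | no none | _ = blowup-noPair bd k f f-inj λ a b fa _ → none (a , fa)
  ... | yes _ | no none = blowup-noPair bd k f f-inj λ a b _ fb → none (b , fb)

-- The first coordinates do not involve the row, so each cross product is linear in it.
area-linear : ∀ k s a x y c → area (alternating k s a (λ j → x j + c * y j)) ≡
  area (alternating k s a x) + c * area (alternating k s a y)
area-linear k s a x y c = proj₂ (proj₂ (all k s a x y))
  where
  all : ∀ k s a x y → let p = ΣV (alternating k s a (λ j → x j + c * y j)) in
    (proj₁ p ≡ proj₁ (ΣV (alternating k s a x)) × proj₁ (ΣV (alternating k s a x)) ≡ proj₁ (ΣV (alternating k s a y))) ×
    proj₂ p ≡ proj₂ (ΣV (alternating k s a x)) + c * proj₂ (ΣV (alternating k s a y)) ×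
    area (alternating k s a (λ j → x j + c * y j)) ≡ area (alternating k s a x) + c * area (alternating k s a y)
  all zero s a x y = (refl , refl) , lem c , lem c
    where
    lem : ∀ c → + 0 ≡ + 0 + c * + 0
    lem = solve-∀
  all (suc k) s a x y with all k (- s) (a ∘ suc) (x ∘ suc) (y ∘ suc)
  ... | (e₁ , e₂) , e₃ , e₄ = (cong (_+_ (s * a zero)) e₁ , cong (_+_ (s * a zero)) e₂) ,
    trans (cong (_+_ (s * (x zero + c * y zero))) e₃) (lem₁ s (x zero) c (y zero) _ _) ,
    trans (cong₂ _+_ (cong₂ (λ p r → s * a zero * r - s * (x zero + c * y zero) * p) e₁ e₃) e₄)
      (trans (lem₂ s (a zero) (x zero) c (y zero) _ _ _ _ _)
        (cong (λ q → s * a zero * X₂ - s * x zero * X₁ + XA + c * (s * a zero * Y₂ - s * y zero * q + YA)) e₂))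
    where
    X₁ = proj₁ (ΣV (alternating k (- s) (a ∘ suc) (x ∘ suc)))
    X₂ = proj₂ (ΣV (alternating k (- s) (a ∘ suc) (x ∘ suc)))
    XA = area (alternating k (- s) (a ∘ suc) (x ∘ suc))
    Y₂ = proj₂ (ΣV (alternating k (- s) (a ∘ suc) (y ∘ suc)))
    YA = area (alternating k (- s) (a ∘ suc) (y ∘ suc))
    lem₁ : ∀ s x c y X Y → s * (x + c * y) + (X + c * Y) ≡ s * x + X + c * (s * y + Y)
    lem₁ = solve-∀
    lem₂ : ∀ s a x c y X₁ X₂ XA Y₂ YA →
      s * a * (X₂ + c * Y₂) - s * (x + c * y) * X₁ + (XA + c * YA) ≡
      s * a * X₂ - s * x * X₁ + XA + c * (s * a * Y₂ - s * y * X₁ + YA)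
    lem₂ = solve-∀

pf-linear : ∀ {k} (S : Digraph (suc k)) x y c → pf S (λ b → x b + c * y b) ≡ pf S x + c * pf S y
pf-linear {k} S x y c = trans (cong (_+_ (x l + c * y l)) (area-linear k (+ 1) (toLast S) (x ∘ inject₁) (y ∘ inject₁) c))
  (lem (x l) c (y l) _ _)
  where
  l = fromℕ k
  lem : ∀ p c q X Y → p + c * q + (X + c * Y) ≡ p + X + c * (q + Y)
  lem = solve-∀

parallel-of-CR : ∀ {n} {T : Digraph n} {σ} w → CRAssoc (extend T σ) zero (suc w) →
  Σ Bool λ β → ∀ v → v ≢ w → σ v ≡ β xor T w v
parallel-of-CR w (inj₁ co) = false , λ v v≢w → co (suc v) (λ ()) (v≢w ∘ FP.suc-injective)
parallel-of-CR w (inj₂ re) = true , λ v v≢w → re (suc v) (λ ()) (v≢w ∘ FP.suc-injective)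

module _ {n : ℕ} (T : Digraph n) (i : Fin n) (σ : Fin (suc n) → Bool) where

  -- If `u` treats the twins alike, an association with another vertex persists. One with `v_i`
  -- becomes an association with one of the twins, chosen by the arc from `u` so that it fits the
  -- arc between the twins.
  blowup-CR-same : σ zero ≡ σ (suc i) → ∀ w → CRAssoc (extend T (σ ∘ suc)) zero (suc w) →
    ¬ NonCRVertex (blowup T i) σ
  blowup-CR-same eq w cr nonCR with parallel-of-CR w cr
  ... | β , par with w ≟ i
  ...   | no w≢i = nonCR (suc w , CR-of-parallel (suc w) β λ
            { zero _ → trans eq (trans (par i (w≢i ∘ sym)) (cong (β xor_) (sym (blowup-suc-zero T i w w≢i))))
            ; (suc v) v≢w → par v (v≢w ∘ cong suc) })
  ...   | yes refl with bool-cases (σ zero) β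
  ...     | inj₁ e = nonCR (suc i , CR-of-parallel (suc i) β λ
              { zero _ → trans e (trans (sym (xor-false β)) (cong (β xor_) (sym (blowup-i-zero T i))))
              ; (suc v) v≢i → par v (v≢i ∘ cong suc) })
  ...     | inj₂ e = nonCR (zero , CR-of-parallel zero β λ
              { zero 0≢0 → contradiction refl 0≢0
              ; (suc v) _ → twin v (v ≟ i) })
    where
    twin : ∀ v → _ → σ (suc v) ≡ β xor blowup T i zero (suc v)
    twin v (yes refl) = trans (sym eq) (trans e (trans (sym (xor-true β)) (cong (β xor_) (sym (blowup-zero-i T i)))))
    twin v (no v≢i) = trans (par v v≢i) (cong (β xor_) (sym (blowup-zero-suc T i v v≢i)))

  restrict : Fin (suc n) → Fin (suc (suc n))
  restrict zero = zero
  restrict (suc w) = suc (suc w)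

  restrict-injective : Injective _≡_ _≡_ restrict
  restrict-injective {zero} {zero} _ = refl
  restrict-injective {suc a} {suc b} refl = refl

  restrict-bounded : ∀ {c} → DetBounded c (extend (blowup T i) σ) → DetBounded c (extend T (σ ∘ suc))
  restrict-bounded bd k f f-inj = subst (ℤ._≤ _)
    (detT-cong λ a b _ → same (f a) (f b)) (bd k (restrict ∘ f) (f-inj ∘ restrict-injective))
    where
    same : ∀ x y → extend (blowup T i) σ (restrict x) (restrict y) ≡ extend T (σ ∘ suc) x y
    same zero zero = refl
    same zero (suc y) = refl
    same (suc x) zero = refl
    same (suc x) (suc y) = refl

-- The functional p plays the role of the Pfaffian of T - v_i bordered by a given row.
module TwinExtension {n : ℕ} (T : Digraph (suc (suc n))) (tour : IsTournament T) (i : Fin (suc (suc n)))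
  (σ : Fin (suc (suc (suc n))) → Bool) {q m : ℕ} (q<m : q ℕ.< m)
  (p : (Fin (suc n) → ℤ) → ℤ) (p-cong : ∀ {x y : Fin (suc n) → ℤ} → (∀ b → x b ≡ y b) → p x ≡ p y)
  (p-linear : ∀ (x y : Fin (suc n) → ℤ) (c : ℤ) → p (λ b → x b + c * y b) ≡ p x + c * p y)
  (p² : ∀ (x : Fin (suc n) → ℤ) → det (border x (skew (induced T (punchIn i)))) ≡ p x * p x)
  (detT-T : detT T ≡ + (m ℕ.* m))
  (small : ∀ (f : Fin n → Fin (suc (suc n))) → Injective _≡_ _≡_ f → detT (induced T f) ℤ.≤ + (q ℕ.* q))
  where
  private
    σ′ : Fin (suc (suc n)) → Bool
    σ′ = σ ∘ suc
    X : Digraph (suc (suc (suc (suc n))))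
    X = extend (blowup T i) σ
    X-tour : IsTournament X
    X-tour = extend-tournament (blowup-tournament T i tour) σ
    E : Digraph (suc (suc (suc n)))
    E = extend T σ′
    E-tour : IsTournament E
    E-tour = extend-tournament tour σ′

    S : Digraph (suc n)
    S = induced T (punchIn i)
    punchIn-inj : Injective _≡_ _≡_ (punchIn i)
    punchIn-inj = FP.punchIn-injective i _ _

    u vᵢ : Fin (suc n) → ℤ
    u b = sg (σ′ (punchIn i b))
    vᵢ b = sg (T i (punchIn i b))
    P Q c : ℤ
    P = p u
    Q = p vᵢ
    c = sg (σ zero) + sg (σ zero)

    Eᵢ : Digraph (suc (suc n))
    Eᵢ = induced E (withApex (punchIn i))

    P² : detT Eᵢ ≡ P * P
    P² = trans (det-cong {M = skew Eᵢ} {N = border u (skew S)} (skew-border Eᵢ (induced-tournament E-tour (withApex-injective punchIn-inj))))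
      (p² u)

    Q² : Q * Q ≡ + (m ℕ.* m)
    Q² = begin
      Q * Q ≡⟨ sym (p² vᵢ) ⟩
      det (border vᵢ (skew S))
        ≡⟨ sym (det-cong {M = skew (induced T (toFront i))} {N = border vᵢ (skew S)}
             (skew-border (induced T (toFront i)) (induced-tournament tour (toFront-injective i)))) ⟩
      detT (induced T (toFront i)) ≡⟨ detT-permute (signed-toFront i) (toFront-injective i) T ⟩
      detT T ≡⟨ detT-T ⟩
      + (m ℕ.* m) ∎

    m≤∣Q∣ : m ℕ.≤ ℤ.∣ Q ∣
    m≤∣Q∣ = ℕP.≮⇒≥ λ lt → ℕP.<⇒≢ (ℕP.*-mono-< lt lt) (ℤP.+-injective (trans (sym (square-abs Q)) Q²))

    all : Fin (suc (suc (suc (suc n)))) → Fin (suc (suc (suc (suc n))))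
    all zero = suc zero
    all (suc zero) = suc (suc i)
    all (suc (suc zero)) = zero
    all (suc (suc (suc b))) = suc (suc (punchIn i b))

    all-injective : Injective _≡_ _≡_ all
    all-injective {zero} {zero} _ = refl
    all-injective {zero} {suc zero} ()
    all-injective {zero} {suc (suc zero)} ()
    all-injective {zero} {suc (suc (suc b))} ()
    all-injective {suc zero} {zero} ()
    all-injective {suc zero} {suc zero} _ = refl
    all-injective {suc zero} {suc (suc zero)} ()
    all-injective {suc zero} {suc (suc (suc b))} e =
      contradiction (sym (FP.suc-injective (FP.suc-injective e))) (FP.punchInᵢ≢i i b)
    all-injective {suc (suc zero)} {zero} ()
    all-injective {suc (suc zero)} {suc zero} ()
    all-injective {suc (suc zero)} {suc (suc zero)} _ = refl
    all-injective {suc (suc zero)} {suc (suc (suc b))} ()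
    all-injective {suc (suc (suc a))} {zero} ()
    all-injective {suc (suc (suc a))} {suc zero} e =
      contradiction (FP.suc-injective (FP.suc-injective e)) (FP.punchInᵢ≢i i a)
    all-injective {suc (suc (suc a))} {suc (suc zero)} ()
    all-injective {suc (suc (suc a))} {suc (suc (suc b))} e =
      cong (λ x → suc (suc (suc x))) (punchIn-inj (FP.suc-injective (FP.suc-injective e)))

    -- Pivoting on the twins v_i′ → v_i adds c v_i to the row of u.
    total² : σ zero ≡ not (σ (suc i)) → detT (induced X all) ≡ (P + c * Q) * (P + c * Q)
    total² diff = begin
      detT Y
        ≡⟨ det-cong {M = skew Y} {N = border r (border s (border u (skew S)))} (λ a b → trans (skew-border Y Y-tour a b) (border-cong (λ _ → refl)
             (λ a b → trans (skew-border Y₁ Y₁-tour a b) (border-cong (λ _ → refl)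
                (skew-border Y₂ (induced-tournament Y₁-tour FP.suc-injective)) a b)) a b)) ⟩
      det (border r (border s (border u (skew S))))
        ≡⟨ det-border₂ r s (border u (skew S)) (cong sg (blowup-zero-i T i)) ⟩
      det (schur (r ∘ suc) s (border u (skew S)))
        ≡⟨ det-cong {M = schur (r ∘ suc) s (border u (skew S))} {N = border (λ b → u b + c * vᵢ b) (skew S)} eq ⟩
      det (border (λ b → u b + c * vᵢ b) (skew S))
        ≡⟨ p² (λ b → u b + c * vᵢ b) ⟩
      p (λ b → u b + c * vᵢ b) * p (λ b → u b + c * vᵢ b)
        ≡⟨ cong (λ z → z * z) (p-linear u vᵢ c) ⟩
      (P + c * Q) * (P + c * Q) ∎
      where
      Y : Digraph (suc (suc (suc (suc n))))
      Y = induced X all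
      Y-tour : IsTournament Y
      Y-tour = induced-tournament X-tour all-injective
      Y₁ : Digraph (suc (suc (suc n)))
      Y₁ = induced Y suc
      Y₁-tour : IsTournament Y₁
      Y₁-tour = induced-tournament Y-tour FP.suc-injective
      Y₂ : Digraph (suc (suc n))
      Y₂ = induced Y₁ suc
      r : Fin (suc (suc (suc n))) → ℤ
      r b = sg (Y zero (suc b))
      s : Fin (suc (suc n)) → ℤ
      s b = sg (Y₁ zero (suc b))
      r-twin : ∀ b → r (suc (suc b)) ≡ vᵢ b
      r-twin b = cong sg (blowup-zero-suc T i (punchIn i b) (FP.punchInᵢ≢i i b))
      r₁ : r (suc zero) ≡ - sg (σ zero)
      r₁ = sg-not (σ zero)
      s₀ : s zero ≡ sg (σ zero)
      s₀ = cong sg (sym diff)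
      eq : ∀ a b → schur (r ∘ suc) s (border u (skew S)) a b ≡ border (λ b → u b + c * vᵢ b) (skew S) a b
      eq zero zero = lem (r (suc zero)) (s zero)
        where
        lem : ∀ p q → + 0 + - p * q - - q * p ≡ + 0
        lem = solve-∀
      eq zero (suc b) = trans (cong₂ (λ p q → u b + - p * vᵢ b - - q * r (suc (suc b))) r₁ s₀)
        (trans (cong (λ q → u b + - - sg (σ zero) * vᵢ b - - sg (σ zero) * q) (r-twin b))
          (lem (u b) (sg (σ zero)) (vᵢ b)))
        where
        lem : ∀ x y v → x + - - y * v - - y * v ≡ x + (y + y) * v
        lem = solve-∀
      eq (suc a) zero = trans (cong₂ (λ p q → - u a + - r (suc (suc a)) * q - - vᵢ a * p) r₁ s₀)
        (trans (cong (λ q → - u a + - q * sg (σ zero) - - vᵢ a * - sg (σ zero)) (r-twin a))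
          (lem (u a) (sg (σ zero)) (vᵢ a)))
        where
        lem : ∀ x y v → - x + - v * y - - v * - y ≡ - (x + (y + y) * v)
        lem = solve-∀
      eq (suc a) (suc b) = trans (cong₂ (λ p q → skew S a b + - p * vᵢ b - - vᵢ a * q) (r-twin a) (r-twin b))
        (lem (skew S a b) (vᵢ a) (vᵢ b))
        where
        lem : ∀ x p q → x + - p * q - - p * q ≡ x
        lem = solve-∀

    ∣cQ∣ : ℤ.∣ c * Q ∣ ≡ ℤ.∣ Q ∣ ℕ.+ ℤ.∣ Q ∣
    ∣cQ∣ = trans (ℤP.abs-* c Q) (trans (cong (ℕ._* ℤ.∣ Q ∣) (two (σ zero))) (cong (ℤ.∣ Q ∣ ℕ.+_) (ℕP.+-identityʳ _)))
      where
      two : ∀ b → ℤ.∣ sg b + sg b ∣ ≡ 2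
      two true = refl
      two false = refl

    -- Deleting the associated pair `u`, `w` from `Eᵢ` preserves the determinant P² and leaves a
    -- subtournament of `T` of order `n`, to which `small` applies.
    other-twin : ∀ w → w ≢ i → CRAssoc E zero (suc w) → ℤ.∣ P ∣ ℕ.≤ q
    other-twin w w≢i cr = square-≤⁻¹ P (subst (ℤ._≤ _) (begin
        detT (induced T (λ a → punchIn i (punchIn b a)))
          ≡⟨ sym (detT-CR (induced Eᵢ ρ) (induced-tournament E-tour (ρ-inj ∘ withApex-injective punchIn-inj)) (transfer cr)) ⟩
        detT (induced Eᵢ ρ)
          ≡⟨ detT-permute (signed-lift (signed-toFront b)) ρ-inj Eᵢ ⟩
        detT Eᵢ
          ≡⟨ P² ⟩
        P * P ∎)
      (small (λ a → punchIn i (punchIn b a)) (FP.punchIn-injective b _ _ ∘ punchIn-inj)))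
      where
      b = punchOut (w≢i ∘ sym)
      ρ : Fin (suc (suc n)) → Fin (suc (suc n))
      ρ = lift (toFront b)
      ρ-inj : Injective _≡_ _≡_ ρ
      ρ-inj = lift-injective (toFront-injective b)
      ρ₁ : withApex (punchIn i) (ρ (suc zero)) ≡ suc w
      ρ₁ = cong suc (FP.punchIn-punchOut (w≢i ∘ sym))
      ≢0 : ∀ v → v ≢ zero → withApex (punchIn i) (ρ v) ≢ zero
      ≢0 v v≢0 e = v≢0 (ρ-inj (withApex-injective punchIn-inj e))
      ≢w : ∀ v → v ≢ suc zero → withApex (punchIn i) (ρ v) ≢ suc w
      ≢w v v≢1 e = v≢1 (ρ-inj (withApex-injective punchIn-inj (trans e (sym ρ₁))))
      transfer : CRAssoc E zero (suc w) → CRAssoc (induced Eᵢ ρ) zero (suc zero)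
      transfer (inj₁ co) = inj₁ λ v v≢0 v≢1 → trans (co _ (≢0 v v≢0) (≢w v v≢1))
        (cong (λ x → E x (withApex (punchIn i) (ρ v))) (sym ρ₁))
      transfer (inj₂ re) = inj₂ λ v v≢0 v≢1 → trans (re _ (≢0 v v≢0) (≢w v v≢1))
        (cong (λ x → not (E x (withApex (punchIn i) (ρ v)))) (sym ρ₁))

    -- The row of `u` is plus or minus that of `v_i`, and `p` is linear.
    same-twin : ∀ β → (∀ v → v ≢ i → σ′ v ≡ β xor T i v) → P ≡ sg (not β) * Q
    same-twin β par = begin
      p u
        ≡⟨ p-cong entry ⟩
      p (λ b → + 0 + sg (not β) * vᵢ b)
        ≡⟨ p-linear (λ _ → + 0) vᵢ (sg (not β)) ⟩
      p (λ _ → + 0) + sg (not β) * Q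
        ≡⟨ cong (_+ sg (not β) * Q) pf-zero ⟩
      + 0 + sg (not β) * Q
        ≡⟨ ℤP.+-identityˡ _ ⟩
      sg (not β) * Q ∎
      where
      entry : ∀ b → u b ≡ + 0 + sg (not β) * vᵢ b
      entry b = trans (cong sg (par (punchIn i b) (FP.punchInᵢ≢i i b))) (lem β (T i (punchIn i b)))
        where
        lem : ∀ β q → sg (β xor q) ≡ + 0 + sg (not β) * sg q
        lem true true = refl
        lem true false = refl
        lem false true = refl
        lem false false = refl
      pf-zero : p (λ _ → + 0) ≡ + 0
      pf-zero = cancel (p (λ _ → + 0)) (p-linear (λ _ → + 0) (λ _ → + 0) (+ 1))
        where
        cancel : ∀ z → z ≡ z + + 1 * z → z ≡ + 0
        cancel z e = trans (lem₁ z) (trans (cong (_- z) (sym e)) (lem₂ z))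
          where
          lem₁ : ∀ z → z ≡ z + + 1 * z - z
          lem₁ = solve-∀
          lem₂ : ∀ z → z - z ≡ + 0
          lem₂ = solve-∀

  -- An association of `u` in `T` is refuted through |P + cQ| ≤ m, where |cQ| = 2|Q| ≥ 2m, once `u`
  -- treats the twins differently.
  twin-unbounded : DetBounded (m ℕ.* m) (extend (blowup T i) σ) → NonCRVertex (blowup T i) σ →
    NonCRVertex T (σ ∘ suc)
  twin-unbounded bd nonCR (w , cr) = twin w cr (bool-cases (σ zero) (σ (suc i)))
    where
    bdX : DetBounded (m ℕ.* m) X
    bdX = bd
    0<m : 0 ℕ.< m
    0<m = ℕP.≤-<-trans ℕ.z≤n q<m
    twin : ∀ w → CRAssoc E zero (suc w) → σ zero ≡ σ (suc i) ⊎ σ zero ≡ not (σ (suc i)) → ⊥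
    twin w cr (inj₁ same) = blowup-CR-same T i σ same w cr nonCR
    twin w cr (inj₂ diff) with w ≟ i | parallel-of-CR w cr
    -- Here |P| ≤ q < m, so |cQ| ≤ |P + cQ| + |P| < 2m.
    ... | no w≢i | _ = ℕP.<⇒≱ (ℕP.+-mono-≤-< total≤ (ℕP.≤-<-trans (other-twin w w≢i cr) q<m))
          (ℕP.≤-trans (ℕP.+-mono-≤ m≤∣Q∣ m≤∣Q∣) (subst (ℕ._≤ ℤ.∣ P + c * Q ∣ ℕ.+ ℤ.∣ P ∣) ∣cQ∣ triangle))
      where
      total≤ : ℤ.∣ P + c * Q ∣ ℕ.≤ m
      total≤ = square-≤⁻¹ (P + c * Q) (subst (ℤ._≤ _) (total² diff) (bdX _ all all-injective))
      triangle : ℤ.∣ c * Q ∣ ℕ.≤ ℤ.∣ P + c * Q ∣ ℕ.+ ℤ.∣ P ∣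
      triangle = subst (λ z → ℤ.∣ z ∣ ℕ.≤ ℤ.∣ P + c * Q ∣ ℕ.+ ℤ.∣ P ∣) (lem P (c * Q)) (ℤP.∣i-j∣≤∣i∣+∣j∣ (P + c * Q) P)
        where
        lem : ∀ p q → p + q - p ≡ q
        lem = solve-∀
    ... | yes refl | β , par with bool-cases (σ zero) β
    -- The arc from `u` to the new twin fits the association with `v_i`, which therefore extends to
    -- the blowup.
    ...   | inj₁ e = nonCR (suc i , CR-of-parallel (suc i) β λ
              { zero _ → trans e (trans (sym (xor-false β)) (cong (β xor_) (sym (blowup-i-zero T i))))
              ; (suc v) v≢i → par v (v≢i ∘ cong suc) })
    -- Now `P` is `sg (σ zero) * Q`, of the same sign as `c * Q`, so the two add up to absolute
    -- value 3|Q| ≥ 3m.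
    ...   | inj₂ e = ℕP.<⇒≱ (ℕP.m<m+n m (ℕP.≤-trans 0<m (ℕP.m≤m+n m m)))
              (ℕP.≤-trans (ℕP.+-mono-≤ m≤∣Q∣ (ℕP.+-mono-≤ m≤∣Q∣ m≤∣Q∣)) (subst (ℕ._≤ m) thrice total≤))
      where
      total≤ : ℤ.∣ P + c * Q ∣ ℕ.≤ m
      total≤ = square-≤⁻¹ (P + c * Q) (subst (ℤ._≤ _) (total² diff) (bdX _ all all-injective))
      thrice : ℤ.∣ P + c * Q ∣ ≡ ℤ.∣ Q ∣ ℕ.+ (ℤ.∣ Q ∣ ℕ.+ ℤ.∣ Q ∣)
      thrice = begin
        ℤ.∣ P + c * Q ∣
          ≡⟨ cong (λ p → ℤ.∣ p + c * Q ∣) (trans (same-twin β par) (cong (λ b → sg b * Q) (sym e))) ⟩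
        ℤ.∣ sg (σ zero) * Q + c * Q ∣
          ≡⟨ cong ℤ.∣_∣ (sym (ℤP.*-distribʳ-+ Q (sg (σ zero)) c)) ⟩
        ℤ.∣ (sg (σ zero) + c) * Q ∣
          ≡⟨ ℤP.abs-* (sg (σ zero) + c) Q ⟩
        ℤ.∣ sg (σ zero) + c ∣ ℕ.* ℤ.∣ Q ∣
          ≡⟨ cong (ℕ._* ℤ.∣ Q ∣) (three (σ zero)) ⟩
        3 ℕ.* ℤ.∣ Q ∣
          ≡⟨ cong (λ z → ℤ.∣ Q ∣ ℕ.+ (ℤ.∣ Q ∣ ℕ.+ z)) (ℕP.+-identityʳ _) ⟩
        ℤ.∣ Q ∣ ℕ.+ (ℤ.∣ Q ∣ ℕ.+ ℤ.∣ Q ∣) ∎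
        where
        three : ∀ b → ℤ.∣ sg b + (sg b + sg b) ∣ ≡ 3
        three true = refl
        three false = refl

-- Application to `L n` and its blowups.

pf-cong : ∀ {k} (S : Digraph (suc k)) {x y} → (∀ b → x b ≡ y b) → pf S x ≡ pf S y
pf-cong {k} S e = cong₂ _+_ (e (fromℕ k)) (cong area (alternating-cong k (+ 1) (λ _ → refl) (λ j → e (inject₁ j))))

detT-L-even : ∀ k → isEven k ≡ true → detT (L (suc (suc k))) ≡ + (suc k ℕ.* suc k)
detT-L-even k e with parity k
... | even t = detT-L t
... | odd t = contradiction (trans (sym e) (cong not (double-even t))) λ ()

L-nonCR-even : ∀ k → isEven k ≡ true → ∀ σ → NonCRVertex (L (suc (suc k))) σ →
  ¬ DetBounded (suc k ℕ.* suc k) (extend (L (suc (suc k))) σ)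
L-nonCR-even k e with parity k
... | even t = L-nonCR t
... | odd t = contradiction (trans (sym e) (cong not (double-even t))) λ ()

-- Removing any vertex of `L n` leaves a tournament transitive up to its last vertex, whose `pf`
-- supplies the functional of `TwinExtension`. The hypothesis `2 ≤ k` makes q = k - 1 smaller than m
-- = k + 1.
blowup-nonCR : ∀ k → isEven k ≡ true → 2 ℕ.≤ k → ∀ i σ → NonCRVertex (blowup (L (suc (suc k))) i) σ →
  ¬ DetBounded (suc k ℕ.* suc k) (extend (blowup (L (suc (suc k))) i) σ)
blowup-nonCR k k-even 2≤k i σ nonCR bd = L-nonCR-even k k-even (σ ∘ suc)
  (TwinExtension.twin-unbounded T (L-tournament (suc k)) i σ q<m
    (pf (induced T (punchIn i))) (pf-cong (induced T (punchIn i))) (pf-linear (induced T (punchIn i)))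
    (det-border-skew-even k-even (induced T (punchIn i))
      (induced-tournament (L-tournament (suc k)) punchIn-inj) (L-increasing (punchIn i) increasing))
    (detT-L-even k k-even) detT-L-≤ bd nonCR)
  (restrict-bounded T i σ bd)
  where
  T : Digraph (suc (suc k))
  T = L (suc (suc k))
  punchIn-inj : Injective _≡_ _≡_ (punchIn i)
  punchIn-inj = FP.punchIn-injective i _ _
  increasing : ∀ a b → toℕ a ℕ.< toℕ b → toℕ (punchIn i a) ℕ.< toℕ (punchIn i b)
  increasing a b a<b = ℕP.≤∧≢⇒< (FP.punchIn-mono-≤ i a b (ℕP.<⇒≤ a<b))
    λ e → ℕP.<⇒≢ a<b (cong toℕ (punchIn-inj (FP.toℕ-injective e)))
  q<m : suc (k ∸ 2) ℕ.< suc k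
  q<m = ℕ.s≤s (shrink 2≤k)
    where
    shrink : ∀ {k} → 2 ℕ.≤ k → suc (k ∸ 2) ℕ.≤ k
    shrink (ℕ.s≤s (ℕ.s≤s _)) = ℕ.s≤s (ℕP.n≤1+n _)

L-bounded : ∀ m → 1 ℕ.≤ m → DetBounded (m ℕ.* m) (L (suc m))
L-bounded m 1≤m k f f-inj = ℤP.≤-trans (detT-L-≤ f f-inj) (ℤ.+≤+ (ℕP.*-mono-≤ le le))
  where
  k≤n : ∀ k → k ℕ.≤ suc m → suc (k ∸ 2) ℕ.≤ m
  k≤n zero _ = 1≤m
  k≤n (suc zero) _ = 1≤m
  k≤n (suc (suc k)) (ℕ.s≤s le) = le
  le : suc (k ∸ 2) ℕ.≤ m
  le = k≤n k (FP.injective⇒≤ f-inj)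

L-strongCR : ∀ k j → isEven k ≡ true → 2 ℕ.≤ k → suc k ≡ 2 ℕ.* j ℕ.+ 1 → IsStrongCR (L (suc (suc k)))
L-strongCR k j k-even 2≤k k≡ =
  (j , (toInD T bounded , large T id id (detT-L-even k k-even)) ,
    inj₂ (inj₂ (inj₂ λ σ nonCR bd → L-nonCR-even k k-even σ nonCR (fromInD (extend T σ) bd)))) ,
  λ i → j , (toInD (blowup T i) (blowup-bounded T i (L-tournament (suc k)) bounded) ,
      large (blowup T i) suc FP.suc-injective (trans
        (detT-cong {S = induced (blowup T i) suc} {T = T} λ _ _ _ → refl) (detT-L-even k k-even))) ,
    inj₂ (inj₂ (inj₂ λ σ nonCR bd → blowup-nonCR k k-even 2≤k i σ nonCR (fromInD (extend (blowup T i) σ) bd)))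
  where
  m : ℕ
  m = suc k
  T : Digraph (suc m)
  T = L (suc m)
  bounded : DetBounded (m ℕ.* m) T
  bounded = L-bounded m (ℕ.s≤s ℕ.z≤n)
  toInD : ∀ {n} (T : Digraph n) → DetBounded (m ℕ.* m) T → InD j T
  toInD T = subst (λ c → DetBounded (c ℕ.* c) T) k≡
  fromInD : ∀ {n} (T : Digraph n) → InD j T → DetBounded (m ℕ.* m) T
  fromInD T = subst (λ c → DetBounded (c ℕ.* c) T) (sym k≡)
  -- A copy of `L n` inside `T` has determinant m² with m = 2j + 1, which exceeds (2j′ + 1)².
  large : ∀ {n} (T : Digraph n) (f : Fin (suc m) → Fin n) → Injective _≡_ _≡_ f →
    detT (induced T f) ≡ + (m ℕ.* m) → ∀ j′ → j ≡ suc j′ → ¬ InD j′ T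
  large T f f-inj e j′ j≡ bd = ℕP.<⇒≱ (ℕP.*-mono-< lt lt)
    (ℤP.drop‿+≤+ (subst (ℤ._≤ _) e (bd (suc m) f f-inj)))
    where
    lt : 2 ℕ.* j′ ℕ.+ 1 ℕ.< m
    lt = subst (2 ℕ.* j′ ℕ.+ 1 ℕ.<_) (sym k≡)
      (ℕP.+-monoˡ-< 1 (ℕP.*-monoʳ-< 2 (ℕP.≤-reflexive (sym j≡))))

double≡2* : ∀ t → double t ≡ 2 ℕ.* t
double≡2* zero = refl
double≡2* (suc t) = cong suc (trans (cong suc (double≡2* t)) (sym (ℕP.+-suc t (t ℕ.+ 0))))

theorem6p1 : ∀ (n : ℕ) → 4 ≤ n → 2 ∣ n → IsBasic (L n) × IsStrongCR (L n)
theorem6p1 n 4≤n 2∣n with parity n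
... | odd t = contradiction (∣1⇒≡1 (∣m+n∣m⇒∣n (subst (2 ∣_) (ℕP.+-comm 1 (double t)) 2∣n)
        (divides t (trans (double≡2* t) (ℕP.*-comm 2 t))))) λ ()
... | even zero = contradiction 4≤n λ ()
... | even (suc zero) = contradiction 4≤n λ { (ℕ.s≤s (ℕ.s≤s ())) }
... | even (suc (suc t)) = (4≤n , L-noCR t) ,
        L-strongCR (double (suc t)) (suc t) (double-even (suc t)) (ℕ.s≤s (ℕ.s≤s ℕ.z≤n))
          (trans (cong suc (double≡2* (suc t))) (ℕP.+-comm 1 (2 ℕ.* suc t)))
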